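{- There exist infinitely many (pairwise non-isomorphic) $4$-connected $1$-plane graphs that have no $2$-connected spanning plane subgraphs.
   Context: All graphs are finite, simple and undirected. A (plane) drawing of a graph represents the vertices by distinct points of the plane and the edges by non-self-intersecting arcs joining the points of their end vertices and containing no vertex point in their interior. A $1$-plane graph is a graph given together with a plane drawing in which each edge is crossed at most once by another edge, i.e. each edge has at most one crossing point; crossings of adjacent edges are forbidden. A spanning plane subgraph of a $1$-plane graph $G$ is a subgraph $F$ with $V(F)=V(G)$ that is a plane graph with respect to the given drawing of $G$, i.e. no two edges of $F$ cross in that drawing. The connectivity is $\kappa(G)=\min\{p(u,v) : u,v\in V(G), u\neq v\}$, where $p(u,v)$ is the maximum number of pairwise internally vertex-disjoint $uv$-paths; $G$ is $k$-connected if $\kappa(G)\ge k$. -}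

module Defs where

open import Data.Fin.Base using (Fin) renaming (_<_ to _<ᶠ_)
open import Data.List.Base using (List; []; _∷_; _∷ʳ_; length)
open import Data.List.Membership.Propositional using (_∈_)
open import Data.List.Relation.Binary.Disjoint.Propositional using (Disjoint)
open import Data.List.Relation.Unary.All using (All)
open import Data.List.Relation.Unary.AllPairs using (AllPairs)
open import Data.List.Relation.Unary.Any using (Any)
open import Data.List.Relation.Unary.Linked using (Linked)
open import Data.List.Relation.Unary.Unique.Propositional using (Unique)
open import Data.Nat.Base as ℕ using (ℕ)
open import Data.Product.Base using (_×_; _,_; ∃)
open import Data.Rational.Base using (ℚ; 0ℚ; 1ℚ; _+_; _-_; _*_; _≤_; _<_)
open import Data.Sum.Base using (_⊎_)
open import Data.Unit.Base using (⊤)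
open import Function.Bundles using (_↔_; _⇔_; module Inverse)
open import Level using (0ℓ)
open import Relation.Binary.Core using (Rel)
open import Relation.Binary.Definitions using (Decidable; Irreflexive; Symmetric)
open import Relation.Binary.PropositionalEquality.Core using (_≡_; _≢_)
open import Relation.Nullary.Negation.Core using (¬_)

------------------------------------------------------------------------
-- Finite simple graphs

record Graph (n : ℕ) : Set₁ where
  infix 4 _~_ _~?_
  field
    _~_    : Rel (Fin n) 0ℓ
    _~?_   : Decidable _~_
    irrefl : Irreflexive _≡_ _~_
    sym    : Symmetric _~_

infix 4 _≅_ _⊆_

_≅_ : ∀ {m n} → Graph m → Graph n → Set
_≅_ {m} {n} G H =
  ∃ λ (φ : Fin m ↔ Fin n) →
    ∀ u v → (u G.~ v) ⇔ (Inverse.to φ u H.~ Inverse.to φ v)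
  where
  module G = Graph G
  module H = Graph H

-- Both graphs have the vertex set Fin n, so F ⊆ G says that F is a
-- spanning subgraph of G.
_⊆_ : ∀ {n} → Graph n → Graph n → Set
F ⊆ G = ∀ {u v} → Graph._~_ F u v → Graph._~_ G u v

------------------------------------------------------------------------
-- Connectivity

module _ {n : ℕ} (G : Graph n) where
  open Graph G

  -- A uv-path is represented by the list of its inner vertices.
  IsPath : Fin n → Fin n → List (Fin n) → Set
  IsPath u v xs = Unique vertices × Linked _~_ vertices
    where
    vertices : List (Fin n)
    vertices = u ∷ (xs ∷ʳ v)

  -- The inequality xs ≢ ys matters only when both lists are empty: it
  -- prevents the edge uv from being counted more than once.
  InternallyDisjoint : Rel (List (Fin n)) 0ℓ
  InternallyDisjoint xs ys = xs ≢ ys × Disjoint xs ys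

  -- p(u,v) ≥ k, where p(u,v) is the maximum size of a set of pairwise
  -- internally disjoint uv-paths.
  LocalConnectivity≥ : Fin n → Fin n → ℕ → Set
  LocalConnectivity≥ u v k =
    ∃ λ (ps : List (List (Fin n))) →
      All (IsPath u v) ps × AllPairs InternallyDisjoint ps × k ℕ.≤ length ps

-- κ(G) ≥ k, where κ(G) is the minimum of p(u,v) over all pairs u ≢ v.
-- There are such pairs only if n ≥ 2.
KConnected : ℕ → ∀ {n} → Graph n → Set
KConnected k {n} G = 2 ℕ.≤ n × (∀ u v → u ≢ v → LocalConnectivity≥ G u v k)

------------------------------------------------------------------------
-- Polygonal arcs in the rational plane

-- Edges are drawn as polygonal arcs with rational coordinates.  Rational
-- segments that meet in ℝ² also meet in ℚ², so these are drawings in the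
-- real plane with the same crossings.  Every 1-plane drawing can be redrawn
-- in this form with the same pairs of crossing edges.
Point : Set
Point = ℚ × ℚ

Segment : Set
Segment = Point × Point

along : Segment → ℚ → Point
along ((x₁ , y₁) , (x₂ , y₂)) t = x₁ + t * (x₂ - x₁) , y₁ + t * (y₂ - y₁)

OnSegment : Point → Segment → Set
OnSegment p s = ∃ λ t → 0ℚ ≤ t × t ≤ 1ℚ × p ≡ along s t

InsideSegment : Point → Segment → Set
InsideSegment p s = ∃ λ t → 0ℚ < t × t < 1ℚ × p ≡ along s t

NonParallel : Rel Segment 0ℓ
NonParallel ((x₁ , y₁) , (x₂ , y₂)) ((x₃ , y₃) , (x₄ , y₄)) =
  (x₂ - x₁) * (y₄ - y₃) ≢ (y₂ - y₁) * (x₄ - x₃)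

segments : List Point → List Segment
segments []           = []
segments (_ ∷ [])     = []
segments (a ∷ b ∷ ps) = (a , b) ∷ segments (b ∷ ps)

OnPolyline : Point → List Point → Set
OnPolyline p ps = Any (OnSegment p) (segments ps)

-- No segment is degenerate, and each one meets the part of the polyline
-- that follows it only in the point where that part begins.
NonSelfIntersecting : List Point → Set
NonSelfIntersecting []           = ⊤
NonSelfIntersecting (_ ∷ [])     = ⊤
NonSelfIntersecting (a ∷ b ∷ ps) =
  a ≢ b
  × (∀ p → OnSegment p (a , b) → OnPolyline p (b ∷ ps) → p ≡ b)
  × NonSelfIntersecting (b ∷ ps)

-- p is an inner point of a segment of either polyline, and these two
-- segments are not parallel, so one polyline passes at p from
-- one side of the other to the opposite side.
TransversalAt : Point → Rel (List Point) 0ℓ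
TransversalAt p ps qs =
  ∃ λ s → ∃ λ t →
    s ∈ segments ps × t ∈ segments qs
    × InsideSegment p s × InsideSegment p t × NonParallel s t

------------------------------------------------------------------------
-- Drawings

-- An undirected edge is listed once, from its smaller to its larger end.
record Edge {n : ℕ} (G : Graph n) : Set where
  open Graph G
  field
    src tgt  : Fin n
    ordered  : src <ᶠ tgt
    adjacent : src ~ tgt

  ends : Fin n × Fin n
  ends = src , tgt

module _ {n : ℕ} {G : Graph n} where
  open Edge

  -- Edges are compared by their ends, as proofs of adjacency need not be
  -- unique.
  Distinct : Rel (Edge G) 0ℓ
  Distinct e f = ends e ≢ ends f

  EndOf : Fin n → Edge G → Set
  EndOf w e = w ≡ src e ⊎ w ≡ tgt e

  ShareEnd : Rel (Edge G) 0ℓ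
  ShareEnd e f = ∃ λ w → EndOf w e × EndOf w f

-- The arc of an edge uv with u < v runs from u to v through the points
-- bends u v. All other values of bends are irrelevant.
module Arcs {n : ℕ} (G : Graph n)
            (pos : Fin n → Point) (bends : Fin n → Fin n → List Point) where
  open Edge

  arc : Edge G → List Point
  arc e = pos (src e) ∷ (bends (src e) (tgt e) ∷ʳ pos (tgt e))

  InteriorPoint : Point → Edge G → Set
  InteriorPoint p e =
    OnPolyline p (arc e) × p ≢ pos (src e) × p ≢ pos (tgt e)

  CommonInteriorPoint : Point → Rel (Edge G) 0ℓ
  CommonInteriorPoint p e f = InteriorPoint p e × InteriorPoint p f

-- Condition transversal is the usual convention that edges have no contacts
-- other than crossings; thus the common interior points of two distinct
-- edges are exactly their crossing points.
record Drawing {n : ℕ} (G : Graph n) : Set where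
  field
    pos   : Fin n → Point
    bends : Fin n → Fin n → List Point

  open Arcs G pos bends public

  field
    pos-injective : ∀ {u v} → pos u ≡ pos v → u ≡ v
    arc-simple    : ∀ e → NonSelfIntersecting (arc e)
    arc-avoids    : ∀ e w → ¬ InteriorPoint (pos w) e
    transversal   : ∀ e f p → Distinct e f → CommonInteriorPoint p e f →
                    TransversalAt p (arc e) (arc f)

  CrossAt : Point → Rel (Edge G) 0ℓ
  CrossAt p e f = Distinct e f × CommonInteriorPoint p e f

  Cross : Rel (Edge G) 0ℓ
  Cross e f = ∃ λ p → CrossAt p e f

record Is1Plane {n : ℕ} {G : Graph n} (D : Drawing G) : Set where
  open Drawing D
  field
    crossed-once   : ∀ e f g p q → CrossAt p e f → CrossAt q e g →
                     p ≡ q × Edge.ends f ≡ Edge.ends g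
    adjacent-apart : ∀ e f → ShareEnd e f → ¬ Cross e f

record OnePlaneGraph : Set₁ where
  field
    order    : ℕ
    graph    : Graph order
    drawing  : Drawing graph
    is1Plane : Is1Plane drawing

record IsSpanningPlaneSubgraph (H : OnePlaneGraph)
         (F : Graph (OnePlaneGraph.order H)) : Set where
  open OnePlaneGraph H
  open Drawing drawing
  open Edge
  module F = Graph F
  field
    subgraph : F ⊆ graph
    plane    : ∀ e f → src e F.~ tgt e → src f F.~ tgt f → ¬ Cross e f

module Submission where

-- Take five plane pieces, each joined to the others by exactly four edges with
-- four different ends, such that these ten edges cross in five pairs.  A plane
-- spanning subgraph keeps at most one edge of each pair, so if it is
-- 2-connected it keeps exactly five, and they form a Hamiltonian cycle of the
-- multigraph obtained by contracting the pieces.  The crossings are chosen so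
-- that no selection of one edge from each pair is such a cycle: every
-- selection leaves one of seven cuts with at most one edge.
--
-- Four pieces are copies of K₄ drawn as quadrilaterals with both diagonals.
-- The fifth is a quadrilateral whose diagonal, the axis, is subdivided by
-- 1 + i beads that are joined to both remaining corners, the apexes; this
-- gives the infinite family.  All edges are straight segments.

open import Defs
open import Data.Bool.Base using (Bool; true; false; if_then_else_)
import Data.Bool.Properties as Bool
open import Data.Empty using (⊥)
open import Data.Fin.Base using (Fin; zero; suc; toℕ)
open import Data.Fin.Permutation using (↔⇒≡)
import Data.Fin.Properties as Fin
open import Data.Integer.Base as ℤ using (ℤ; +_; -[1+_]; 0ℤ)
import Data.Integer.Properties as ℤ
open import Data.List.Base using (List; []; _∷_; _∷ʳ_; _++_; map; filter; head; length; reverse; take; upTo; applyUpTo; applyDownFrom)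
open import Data.List.Membership.Propositional using (_∈_; _∉_; find)
open import Data.List.Membership.Propositional.Properties using (∈-filter⁺; ∈-filter⁻; ∈-++⁺ˡ; ∈-++⁺ʳ; ∈-++⁻; ∈-map⁺; ∈-map⁻; ∈-upTo⁺; ∈-applyUpTo⁺)
import Data.List.Properties as List
open import Data.List.Relation.Binary.Disjoint.Propositional using (Disjoint)
open import Data.List.Relation.Binary.Permutation.Propositional using (↭-sym; ↭⇒↭ₛ)
open import Data.List.Relation.Binary.Permutation.Propositional.Properties using (↭-reverse)
open import Data.List.Relation.Binary.Permutation.Setoid.Properties using (AllPairs-resp-↭)
open import Data.List.Relation.Unary.All as All using (All; []; _∷_; all?)
import Data.List.Relation.Unary.All.Properties as All
open import Data.List.Relation.Unary.AllPairs as AllPairs using (AllPairs; []; _∷_; allPairs?)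
import Data.List.Relation.Unary.AllPairs.Properties as AllPairs
open import Data.List.Relation.Unary.Any as Any using (Any; here; there; any?)
open import Data.List.Relation.Unary.Any.Properties using (reverse⁻)
open import Data.List.Relation.Unary.Linked as Linked using (Linked; []; [-]; _∷_; linked?)
import Data.List.Relation.Unary.Linked.Properties as Linked
open import Data.List.Relation.Unary.Unique.Propositional using (Unique)
import Data.List.Relation.Unary.Unique.Propositional.Properties as Unique
open import Data.Maybe.Base using (just)
import Data.Maybe.Properties as Maybe
open import Data.Nat.Base as ℕ using (ℕ; zero; suc; z≤n; s≤s; _∸_)
import Data.Nat.Properties as ℕ
open import Data.List.Membership.DecPropositional ℕ._≟_ using () renaming (_∈?_ to _∈ₙ?_)
open import Data.List.Relation.Binary.Disjoint.DecPropositional ℕ._≟_ using (disjoint?)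
open import Data.List.Relation.Unary.Unique.DecPropositional ℕ._≟_ using (unique?)
open import Data.Product.Base using (_×_; _,_; ∃; proj₁; proj₂; swap)
open import Data.Product.Properties using (≡-dec)
open import Data.Rational.Base as ℚ using (ℚ; 0ℚ; 1ℚ; ½; _+_; _-_; _*_; -_; _/_; _≤_; _<_; 1/_; ≢-nonZero; *≤*; *<*; positive; negative)
open import Data.Rational.Literals using (fromℤ)
open import Data.Rational.Properties as ℚ hiding (_≟_)
open import Data.Rational.Solver using (module +-*-Solver)
import Data.Rational.Unnormalised.Base as ℚᵘ
import Data.Rational.Unnormalised.Properties as ℚᵘ
open import Data.Sum.Base as Sum using (_⊎_; inj₁; inj₂)
open import Function.Base using (_∘_)
open import Level using (0ℓ)
open import Relation.Binary.Core using (Rel)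
open import Relation.Binary.Definitions using (Decidable; DecidableEquality; Symmetric; tri<; tri≈; tri>)
open import Relation.Binary.PropositionalEquality using (_≡_; _≢_; refl; sym; trans; cong; cong₂; subst; subst₂; ≢-sym; setoid)
open import Relation.Nullary.Decidable using (Dec; yes; no; does; map′; _×-dec_; _⊎-dec_; _→-dec_; ¬?; True; toWitness; from-yes; dec-true; dec-false)
open import Relation.Nullary.Negation using (¬_; contradiction)
import Relation.Unary as Unary
open OnePlaneGraph using (order; graph)
open +-*-Solver using (solve; con; _:=_; _:+_; _:*_; _:-_; :-_)

-- Ten edges in five crossing pairs meet five pieces. A plane subgraph keeps at most five of the
-- ten, while 2-connectedness asks for at least two at each piece, so exactly five are kept and
-- every piece has degree 2 after contraction. Such a selection is a Hamiltonian cycle or a union of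
-- shorter cycles, and the pairing is designed so that only the latter occurs.
--
-- The obstacle is to treat all `i` at once although the numerical claims are settled by evaluation.
-- Hence everything off the axis has fixed integer coordinates, and `i` only decides how the segment
-- between two fixed points is cut up. Geometric claims about beads then follow by convexity from
-- claims about the two ends of the axis. Path systems either name at most three axis vertices or
-- are prolonged along the axis, so that finite tables suffice here as well. A bead has exactly four
-- neighbours, the two apexes and the vertices before and after it on the axis, just as many as
-- 4-connectedness demands.

-- Affine functionals and separated segments

Functional : Set
Functional = ℚ × ℚ × ℚ

eval : Functional → Point → ℚ
eval (α , β , γ) (x , y) = α * x + β * y + γ

opposite : Functional → Functional
opposite (α , β , γ) = - α , - β , - γ

eval-opposite : ∀ f p → eval (opposite f) p ≡ - eval f p
eval-opposite (α , β , γ) (x , y) =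
  solve 5 (λ α β γ x y → :- α :* x :+ :- β :* y :+ :- γ := :- (α :* x :+ β :* y :+ γ)) refl α β γ x y

eval-along : ∀ f a b t → eval f (along (a , b) t) ≡ (1ℚ - t) * eval f a + t * eval f b
eval-along (α , β , γ) (x₁ , y₁) (x₂ , y₂) t =
  solve 8 (λ α β γ x₁ y₁ x₂ y₂ t →
    α :* (x₁ :+ t :* (x₂ :- x₁)) :+ β :* (y₁ :+ t :* (y₂ :- y₁)) :+ γ
    := (con 1ℚ :- t) :* (α :* x₁ :+ β :* y₁ :+ γ) :+ t :* (α :* x₂ :+ β :* y₂ :+ γ))
    refl α β γ x₁ y₁ x₂ y₂ t

0<p*q : ∀ {p q} → 0ℚ < p → 0ℚ < q → 0ℚ < p * q
0<p*q {p} {q} 0<p 0<q = subst (_< p * q) (*-zeroʳ p) (*-monoʳ-<-pos p ⦃ positive 0<p ⦄ 0<q)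

0≤p*q : ∀ {p q} → 0ℚ < p → 0ℚ ≤ q → 0ℚ ≤ p * q
0≤p*q {p} {q} 0<p 0≤q = subst (_≤ p * q) (*-zeroʳ p) (*-monoˡ-≤-nonNeg p ⦃ pos⇒nonNeg p ⦃ positive 0<p ⦄ ⦄ 0≤q)

p<q⇒p-q<0 : ∀ {p q} → p < q → p - q < 0ℚ
p<q⇒p-q<0 {p} {q} p<q = subst (p - q <_) (+-inverseʳ q) (+-monoˡ-< (- q) p<q)

p≤q⇒p-q≤0 : ∀ {p q} → p ≤ q → p - q ≤ 0ℚ
p≤q⇒p-q≤0 {p} {q} p≤q = subst (p - q ≤_) (+-inverseʳ q) (+-monoˡ-≤ (- q) p≤q)

p<q⇒0<q-p : ∀ {p q} → p < q → 0ℚ < q - p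
p<q⇒0<q-p {p} {q} p<q = subst (_< q - p) (+-inverseʳ p) (+-monoˡ-< (- p) p<q)

p≤q⇒0≤q-p : ∀ {p q} → p ≤ q → 0ℚ ≤ q - p
p≤q⇒0≤q-p {p} {q} p≤q = subst (_≤ q - p) (+-inverseʳ p) (+-monoˡ-≤ (- p) p≤q)

module _ {t u v : ℚ} (0<t : 0ℚ < t) (t<1 : t < 1ℚ) (0≤u : 0ℚ ≤ u) (0≤v : 0ℚ ≤ v) where

  convex-≥0 : 0ℚ ≤ (1ℚ - t) * u + t * v
  convex-≥0 = +-mono-≤ (0≤p*q (p<q⇒0<q-p t<1) 0≤u) (0≤p*q 0<t 0≤v)

  convex->0 : 0ℚ < u ⊎ 0ℚ < v → 0ℚ < (1ℚ - t) * u + t * v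
  convex->0 (inj₁ 0<u) = +-mono-<-≤ (0<p*q (p<q⇒0<q-p t<1) 0<u) (0≤p*q 0<t 0≤v)
  convex->0 (inj₂ 0<v) = +-mono-≤-< (0≤p*q (p<q⇒0<q-p t<1) 0≤u) (0<p*q 0<t 0<v)

module _ (f : Functional) (a b : Point) {p : Point} where

  eval-inside-≥0 : InsideSegment p (a , b) → 0ℚ ≤ eval f a → 0ℚ ≤ eval f b → 0ℚ ≤ eval f p
  eval-inside-≥0 (t , 0<t , t<1 , refl) 0≤fa 0≤fb =
    subst (0ℚ ≤_) (sym (eval-along f a b t)) (convex-≥0 0<t t<1 0≤fa 0≤fb)

  eval-inside->0 : InsideSegment p (a , b) → 0ℚ ≤ eval f a → 0ℚ ≤ eval f b →
                   0ℚ < eval f a ⊎ 0ℚ < eval f b → 0ℚ < eval f p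
  eval-inside->0 (t , 0<t , t<1 , refl) 0≤fa 0≤fb 0<f =
    subst (0ℚ <_) (sym (eval-along f a b t)) (convex->0 0<t t<1 0≤fa 0≤fb 0<f)

neg-involutive : ∀ p → - (- p) ≡ p
neg-involutive = solve 1 (λ p → :- (:- p) := p) refl

-0≤0 : ∀ {p} → 0ℚ ≤ - p → p ≤ 0ℚ
-0≤0 {p} 0≤-p = subst (_≤ 0ℚ) (neg-involutive p) (neg-antimono-≤ 0≤-p)

-0<0 : ∀ {p} → 0ℚ < - p → p < 0ℚ
-0<0 {p} 0<-p = subst (_< 0ℚ) (neg-involutive p) (neg-antimono-< 0<-p)

module _ (f : Functional) (a b : Point) {p : Point} (p∈ab : InsideSegment p (a , b))
         (fa≤0 : eval f a ≤ 0ℚ) (fb≤0 : eval f b ≤ 0ℚ) where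

  private
    flip-≤ : ∀ q → eval f q ≤ 0ℚ → 0ℚ ≤ eval (opposite f) q
    flip-≤ q fq≤0 = subst (0ℚ ≤_) (sym (eval-opposite f q)) (neg-antimono-≤ fq≤0)

    flip-< : ∀ q → eval f q < 0ℚ → 0ℚ < eval (opposite f) q
    flip-< q fq<0 = subst (0ℚ <_) (sym (eval-opposite f q)) (neg-antimono-< fq<0)

  eval-inside-≤0 : eval f p ≤ 0ℚ
  eval-inside-≤0 = -0≤0 (subst (0ℚ ≤_) (eval-opposite f p)
    (eval-inside-≥0 (opposite f) a b p∈ab (flip-≤ a fa≤0) (flip-≤ b fb≤0)))

  eval-inside-<0 : eval f a < 0ℚ ⊎ eval f b < 0ℚ → eval f p < 0ℚ
  eval-inside-<0 f<0 = -0<0 (subst (0ℚ <_) (eval-opposite f p)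
    (eval-inside->0 (opposite f) a b p∈ab (flip-≤ a fa≤0) (flip-≤ b fb≤0) (strict f<0)))
    where
    strict : eval f a < 0ℚ ⊎ eval f b < 0ℚ → 0ℚ < eval (opposite f) a ⊎ 0ℚ < eval (opposite f) b
    strict (inj₁ fa<0) = inj₁ (flip-< a fa<0)
    strict (inj₂ fb<0) = inj₂ (flip-< b fb<0)

-- The line may touch both segments, because edges with a common end must be separable too. One end
-- off the line is enough: it pulls the whole interior of its segment off the line.
Separates : Functional → Segment → Segment → Set
Separates f (a , b) (c , d) =
  (eval f a ≤ 0ℚ × eval f b ≤ 0ℚ) × (0ℚ ≤ eval f c × 0ℚ ≤ eval f d) ×
  ((eval f a < 0ℚ ⊎ eval f b < 0ℚ) ⊎ (0ℚ < eval f c ⊎ 0ℚ < eval f d))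

-- A record and not a bare function type, so that unification recovers both segments from the type.
record InteriorDisjoint (s t : Segment) : Set where
  constructor interiorDisjoint
  field no-common : ∀ p → InsideSegment p s → ¬ InsideSegment p t

open InteriorDisjoint public

InteriorDisjoint-sym : ∀ {s t} → InteriorDisjoint s t → InteriorDisjoint t s
InteriorDisjoint-sym disj = interiorDisjoint λ p p∈t p∈s → no-common disj p p∈s p∈t

separates⇒disjoint : ∀ f s t → Separates f s t → InteriorDisjoint s t
separates⇒disjoint f (a , b) (c , d) ((fa , fb) , (fc , fd) , inj₁ strict) = interiorDisjoint λ p p∈s p∈t →
  <-irrefl refl (<-≤-trans (eval-inside-<0 f a b p∈s fa fb strict) (eval-inside-≥0 f c d p∈t fc fd))
separates⇒disjoint f (a , b) (c , d) ((fa , fb) , (fc , fd) , inj₂ strict) = interiorDisjoint λ p p∈s p∈t →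
  <-irrefl refl (<-≤-trans (eval-inside->0 f c d p∈t fc fd strict) (eval-inside-≤0 f a b p∈s fa fb))

point-inside : ∀ p → InsideSegment p (p , p)
point-inside (x , y) = ½ , from-yes (0ℚ <? ½) , from-yes (½ <? 1ℚ) , cong₂ _,_ (eq x) (eq y)
  where
  eq : ∀ z → z ≡ z + ½ * (z - z)
  eq z = solve 1 (λ z → z := z :+ con ½ :* (z :- z)) refl z

on⇒inside : ∀ {p a b} → OnSegment p (a , b) → p ≢ a → p ≢ b → InsideSegment p (a , b)
on⇒inside {a = x₁ , y₁} {b = x₂ , y₂} (t , 0≤t , t≤1 , refl) p≢a p≢b =
  t , ≤∧≢⇒< 0≤t (λ {refl → p≢a (cong₂ _,_ (at0 x₁ x₂) (at0 y₁ y₂))})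
    , ≤∧≢⇒< t≤1 (λ {refl → p≢b (cong₂ _,_ (at1 x₁ x₂) (at1 y₁ y₂))}) , refl
  where
  ≤∧≢⇒< : ∀ {p q} → p ≤ q → p ≢ q → p < q
  ≤∧≢⇒< p≤q p≢q = ≰⇒> (λ q≤p → p≢q (≤-antisym p≤q q≤p))
  at0 : ∀ u v → u + 0ℚ * (v - u) ≡ u
  at0 = solve 2 (λ u v → u :+ con 0ℚ :* (v :- u) := u) refl
  at1 : ∀ u v → u + 1ℚ * (v - u) ≡ v
  at1 = solve 2 (λ u v → u :+ con 1ℚ :* (v :- u) := v) refl

*-cancelʳ : ∀ {p q r} → r ≢ 0ℚ → p * r ≡ q * r → p ≡ q
*-cancelʳ {p} {q} {r} r≢0 eq = trans (sym (undo p)) (trans (cong (_* r⁻¹) eq) (undo q))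
  where
  instance _ = ≢-nonZero r≢0
  r⁻¹ : ℚ
  r⁻¹ = 1/ r
  undo : ∀ s → s * r * r⁻¹ ≡ s
  undo s = trans (*-assoc s r r⁻¹) (trans (cong (s *_) (*-inverseʳ r)) (*-identityʳ s))

-- A functional that vanishes on t takes different values at different points
-- of s.
crossing-unique : ∀ {s t p q} → NonParallel s t →
                  InsideSegment p s → InsideSegment p t → InsideSegment q s → InsideSegment q t → p ≡ q
crossing-unique {(x₁ , y₁) , (x₂ , y₂)} {(x₃ , y₃) , (x₄ , y₄)} {p} {q} np
  (λ₁ , _ , _ , p≡) (λ₂ , _ , _ , p≡′) (μ₁ , _ , _ , q≡) (μ₂ , _ , _ , q≡′) =
  trans p≡ (trans (cong (along ((x₁ , y₁) , (x₂ , y₂))) λ₁≡μ₁) (sym q≡))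
  where
  δ : ℚ
  δ = (x₂ - x₁) * (y₄ - y₃) - (y₂ - y₁) * (x₄ - x₃)
  δ≢0 : δ ≢ 0ℚ
  δ≢0 eq = np (trans (solve 2 (λ u v → u := (u :- v) :+ v) refl _ _)
    (trans (cong (_+ (y₂ - y₁) * (x₄ - x₃)) eq) (+-identityˡ _)))
  shift : ∀ r s → along ((x₁ , y₁) , (x₂ , y₂)) r ≡ along ((x₃ , y₃) , (x₄ , y₄)) s →
          r * δ ≡ (x₃ - x₁) * (y₄ - y₃) - (y₃ - y₁) * (x₄ - x₃)
  shift r s eq = trans (solve 9 (λ x₁ y₁ x₂ y₂ x₃ y₃ x₄ y₄ r →
      r :* ((x₂ :- x₁) :* (y₄ :- y₃) :- (y₂ :- y₁) :* (x₄ :- x₃))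
      := ((x₁ :+ r :* (x₂ :- x₁)) :- x₁) :* (y₄ :- y₃) :- ((y₁ :+ r :* (y₂ :- y₁)) :- y₁) :* (x₄ :- x₃))
      refl x₁ y₁ x₂ y₂ x₃ y₃ x₄ y₄ r)
    (trans (cong₂ (λ u v → (u - x₁) * (y₄ - y₃) - (v - y₁) * (x₄ - x₃)) (cong proj₁ eq) (cong proj₂ eq))
    (solve 7 (λ x₁ y₁ x₃ y₃ x₄ y₄ s →
      ((x₃ :+ s :* (x₄ :- x₃)) :- x₁) :* (y₄ :- y₃) :- ((y₃ :+ s :* (y₄ :- y₃)) :- y₁) :* (x₄ :- x₃)
      := (x₃ :- x₁) :* (y₄ :- y₃) :- (y₃ :- y₁) :* (x₄ :- x₃)) refl x₁ y₁ x₃ y₃ x₄ y₄ s))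
  λ₁≡μ₁ : λ₁ ≡ μ₁
  λ₁≡μ₁ = *-cancelʳ δ≢0 (trans (shift λ₁ λ₂ (trans (sym p≡) p≡′)) (sym (shift μ₁ μ₂ (trans (sym q≡) q≡′))))

-- Integers inside the rationals

fromℤ-mono-≤ : ∀ {m n} → m ℤ.≤ n → fromℤ m ≤ fromℤ n
fromℤ-mono-≤ {m} {n} m≤n = *≤* (subst₂ ℤ._≤_ (sym (ℤ.*-identityʳ m)) (sym (ℤ.*-identityʳ n)) m≤n)

fromℤ-mono-< : ∀ {m n} → m ℤ.< n → fromℤ m < fromℤ n
fromℤ-mono-< {m} {n} m<n = *<* (subst₂ ℤ._<_ (sym (ℤ.*-identityʳ m)) (sym (ℤ.*-identityʳ n)) m<n)

fromℤ-injective : ∀ {m n} → fromℤ m ≡ fromℤ n → m ≡ n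
fromℤ-injective refl = refl

fromℤ-+ : ∀ m n → fromℤ (m ℤ.+ n) ≡ fromℤ m + fromℤ n
fromℤ-+ m n = toℚᵘ-injective (ℚᵘ.≃-trans (ℚᵘ.*≡* eq) (ℚᵘ.≃-sym (toℚᵘ-homo-+ (fromℤ m) (fromℤ n))))
  where
  eq : (m ℤ.+ n) ℤ.* (+ 1 ℤ.* + 1) ≡ (m ℤ.* + 1 ℤ.+ n ℤ.* + 1) ℤ.* + 1
  eq = cong (ℤ._* + 1) (sym (cong₂ ℤ._+_ (ℤ.*-identityʳ m) (ℤ.*-identityʳ n)))

fromℤ-* : ∀ m n → fromℤ (m ℤ.* n) ≡ fromℤ m * fromℤ n
fromℤ-* m n = toℚᵘ-injective (ℚᵘ.≃-trans (ℚᵘ.*≡* refl) (ℚᵘ.≃-sym (toℚᵘ-homo-* (fromℤ m) (fromℤ n))))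

fromℤ-neg : ∀ m → fromℤ (ℤ.- m) ≡ - fromℤ m
fromℤ-neg m = toℚᵘ-injective (ℚᵘ.≃-trans (ℚᵘ.*≡* refl) (ℚᵘ.≃-sym (toℚᵘ-homo‿- (fromℤ m))))

fromℤ-- : ∀ m n → fromℤ (m ℤ.- n) ≡ fromℤ m - fromℤ n
fromℤ-- m n = trans (fromℤ-+ m (ℤ.- n)) (cong (λ k → fromℤ m + k) (fromℤ-neg n))

-- The fixed part of the graph and its coordinates

-- The vertices of the skeleton are the apexes 0 and 1, the corners 2, …, 17 of
-- four copies of K₄, and the ends 18 and 19 of the axis.  The first ten edges
-- join different parts of the skeleton and cross in consecutive pairs; the
-- next eight are the diagonals of the copies of K₄.
skeleton : List (ℕ × ℕ)
skeleton =
  (3 , 16) ∷ (6 , 15) ∷ (4 , 11) ∷ (14 , 18) ∷ (5 , 19) ∷ (0 , 2) ∷ (7 , 10) ∷ (1 , 13) ∷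
  (8 , 17) ∷ (9 , 12) ∷ (2 , 4) ∷ (3 , 5) ∷ (6 , 8) ∷ (7 , 9) ∷ (10 , 12) ∷ (11 , 13) ∷
  (14 , 16) ∷ (15 , 17) ∷ (0 , 18) ∷ (0 , 19) ∷ (1 , 18) ∷ (1 , 19) ∷ (2 , 3) ∷ (2 , 5) ∷
  (3 , 4) ∷ (4 , 5) ∷ (6 , 7) ∷ (6 , 9) ∷ (7 , 8) ∷ (8 , 9) ∷ (10 , 11) ∷ (10 , 13) ∷
  (11 , 12) ∷ (12 , 13) ∷ (14 , 15) ∷ (14 , 17) ∷ (15 , 16) ∷ (16 , 17) ∷ []

crossingPairs : List ((ℕ × ℕ) × (ℕ × ℕ))
crossingPairs =
  ((3 , 16) , (6 , 15)) ∷ ((4 , 11) , (14 , 18)) ∷ ((5 , 19) , (0 , 2)) ∷ ((7 , 10) , (1 , 13)) ∷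
  ((8 , 17) , (9 , 12)) ∷ ((2 , 4) , (3 , 5)) ∷ ((6 , 8) , (7 , 9)) ∷ ((10 , 12) , (11 , 13)) ∷
  ((14 , 16) , (15 , 17)) ∷ []

-- The axis is horizontal, from (0, 0) to (13, 0), with apex 0 above it and apex 1 below it, and no
-- other corner has height 0. The last clause is a filler for labels from 20 on.
corner : ℕ → ℤ × ℤ
corner 0  = + 3 , + 1
corner 1  = + 9 , -[1+ 0 ]
corner 2  = + 7 , + 4
corner 3  = + 7 , + 7
corner 4  = + 2 , + 5
corner 5  = + 1 , + 3
corner 6  = + 14 , + 8
corner 7  = + 20 , -[1+ 0 ]
corner 8  = + 13 , + 20
corner 9  = + 12 , + 17
corner 10 = + 0 , -[1+ 4 ]
corner 11 = -[1+ 1 ] , + 2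
corner 12 = -[1+ 7 ] , + 10
corner 13 = -[1+ 0 ] , -[1+ 7 ]
corner 14 = + 1 , + 11
corner 15 = + 2 , + 9
corner 16 = + 12 , + 13
corner 17 = + 9 , + 14
corner 18 = + 0 , + 0
corner 19 = + 13 , + 0
corner _  = + 0 , + 0

-- Integer copies of the notions above: comparisons in ℤ evaluate without normalising fractions, so
-- separations on the skeleton are decided there and transferred by `embed`.
Functionalℤ : Set
Functionalℤ = ℤ × ℤ × ℤ

evalℤ : Functionalℤ → ℤ × ℤ → ℤ
evalℤ (α , β , γ) (x , y) = α ℤ.* x ℤ.+ β ℤ.* y ℤ.+ γ

embed : ℤ × ℤ → Point
embed (x , y) = fromℤ x , fromℤ y

functional : Functionalℤ → Functional
functional (α , β , γ) = fromℤ α , fromℤ β , fromℤ γ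

eval-embed : ∀ f p → eval (functional f) (embed p) ≡ fromℤ (evalℤ f p)
eval-embed (α , β , γ) (x , y) = sym (trans (fromℤ-+ (α ℤ.* x ℤ.+ β ℤ.* y) γ) (cong (_+ fromℤ γ)
  (trans (fromℤ-+ (α ℤ.* x) (β ℤ.* y)) (cong₂ _+_ (fromℤ-* α x) (fromℤ-* β y)))))

module _ (f : Functionalℤ) (p : ℤ × ℤ) where

  eval-≤0 : evalℤ f p ℤ.≤ 0ℤ → eval (functional f) (embed p) ≤ 0ℚ
  eval-≤0 le = subst (_≤ 0ℚ) (sym (eval-embed f p)) (fromℤ-mono-≤ le)

  eval-≥0 : 0ℤ ℤ.≤ evalℤ f p → 0ℚ ≤ eval (functional f) (embed p)
  eval-≥0 le = subst (0ℚ ≤_) (sym (eval-embed f p)) (fromℤ-mono-≤ le)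

  eval-<0 : evalℤ f p ℤ.< 0ℤ → eval (functional f) (embed p) < 0ℚ
  eval-<0 lt = subst (_< 0ℚ) (sym (eval-embed f p)) (fromℤ-mono-< lt)

  eval->0 : 0ℤ ℤ.< evalℤ f p → 0ℚ < eval (functional f) (embed p)
  eval->0 lt = subst (0ℚ <_) (sym (eval-embed f p)) (fromℤ-mono-< lt)

-- The value at p is the determinant of b - a and p - a: it vanishes on the line through a and b and
-- is positive to the left of the direction from a to b. Exchanging a and b changes the sign.
line : ℤ × ℤ → ℤ × ℤ → Functionalℤ
line (x₁ , y₁) (x₂ , y₂) = y₁ ℤ.- y₂ , x₂ ℤ.- x₁ , x₁ ℤ.* y₂ ℤ.- x₂ ℤ.* y₁

Separatesℤ : Functionalℤ → (a b c d : ℤ × ℤ) → Set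
Separatesℤ f a b c d =
  (evalℤ f a ℤ.≤ 0ℤ × evalℤ f b ℤ.≤ 0ℤ) × (0ℤ ℤ.≤ evalℤ f c × 0ℤ ℤ.≤ evalℤ f d) ×
  ((evalℤ f a ℤ.< 0ℤ ⊎ evalℤ f b ℤ.< 0ℤ) ⊎ (0ℤ ℤ.< evalℤ f c ⊎ 0ℤ ℤ.< evalℤ f d))

separatesℤ? : ∀ a b c d f → Dec (Separatesℤ f a b c d)
separatesℤ? a b c d f =
  ((evalℤ f a ℤ.≤? 0ℤ) ×-dec (evalℤ f b ℤ.≤? 0ℤ)) ×-dec
  ((0ℤ ℤ.≤? evalℤ f c) ×-dec (0ℤ ℤ.≤? evalℤ f d)) ×-dec
  (((evalℤ f a ℤ.<? 0ℤ) ⊎-dec (evalℤ f b ℤ.<? 0ℤ)) ⊎-dec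
   ((0ℤ ℤ.<? evalℤ f c) ⊎-dec (0ℤ ℤ.<? evalℤ f d)))

separatesℤ⇒disjoint : ∀ f a b c d → Separatesℤ f a b c d →
                      InteriorDisjoint (embed a , embed b) (embed c , embed d)
separatesℤ⇒disjoint f a b c d ((fa , fb) , (fc , fd) , strict) =
  separates⇒disjoint (functional f) (embed a , embed b) (embed c , embed d)
    ((eval-≤0 f a fa , eval-≤0 f b fb) , (eval-≥0 f c fc , eval-≥0 f d fd) , strict′ strict)
  where
  strict′ : (evalℤ f a ℤ.< 0ℤ ⊎ evalℤ f b ℤ.< 0ℤ) ⊎ (0ℤ ℤ.< evalℤ f c ⊎ 0ℤ ℤ.< evalℤ f d) →
            (eval (functional f) (embed a) < 0ℚ ⊎ eval (functional f) (embed b) < 0ℚ) ⊎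
            (0ℚ < eval (functional f) (embed c) ⊎ 0ℚ < eval (functional f) (embed d))
  strict′ (inj₁ (inj₁ lt)) = inj₁ (inj₁ (eval-<0 f a lt))
  strict′ (inj₁ (inj₂ lt)) = inj₁ (inj₂ (eval-<0 f b lt))
  strict′ (inj₂ (inj₁ lt)) = inj₂ (inj₁ (eval->0 f c lt))
  strict′ (inj₂ (inj₂ lt)) = inj₂ (inj₂ (eval->0 f d lt))

-- Both orders of every pair, so that membership is symmetric.
crossings : List ((ℕ × ℕ) × (ℕ × ℕ))
crossings = crossingPairs ++ map swap crossingPairs

_≟ₑ_ : DecidableEquality (ℕ × ℕ)
_≟ₑ_ = ≡-dec ℕ._≟_ ℕ._≟_

_≟ₓ_ : DecidableEquality ((ℕ × ℕ) × (ℕ × ℕ))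
_≟ₓ_ = ≡-dec _≟ₑ_ _≟ₑ_

open import Data.List.Membership.DecPropositional _≟ₑ_ using () renaming (_∈?_ to _∈ₑ?_)
open import Data.List.Membership.DecPropositional _≟ₓ_ using () renaming (_∈?_ to _∈ₓ?_)

-- If two segments can be separated at all, a line through one of them does it.
Apart : (a b c d : ℤ × ℤ) → Set
Apart a b c d = Any (λ f → Separatesℤ f a b c d) (line a b ∷ line b a ∷ line c d ∷ line d c ∷ [])

apart? : ∀ a b c d → Dec (Apart a b c d)
apart? a b c d = any? (separatesℤ? a b c d) (line a b ∷ line b a ∷ line c d ∷ line d c ∷ [])

apart⇒disjoint : ∀ a b c d → Apart a b c d → InteriorDisjoint (embed a , embed b) (embed c , embed d)
apart⇒disjoint a b c d ap with f , sep ← Any.satisfied ap = separatesℤ⇒disjoint f a b c d sep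

Compatible : ℕ × ℕ → ℕ × ℕ → Set
Compatible e@(a , b) f@(c , d) =
  e ≡ f ⊎ (e , f) ∈ crossings ⊎ Apart (corner a) (corner b) (corner c) (corner d)

-- Finite checks on the drawing of the skeleton

abstract

  -- Bounds the crossings from above: among the 38 edges of the skeleton, only the listed pairs can
  -- have a common interior point. That `bondCrossings` do occur is shown separately. `abstract`
  -- keeps the evaluated proof from being unfolded later.
  skeleton-compatible : All (λ e → All (Compatible e) skeleton) skeleton
  skeleton-compatible = from-yes (all? (λ e@(a , b) → all? (λ f@(c , d) →
    (e ≟ₑ f) ⊎-dec ((e , f) ∈ₓ? crossings) ⊎-dec
    apart? (corner a) (corner b) (corner c) (corner d)) skeleton) skeleton)

abstract

  -- A vertex enters as the degenerate segment at its corner, so the separation test for segments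
  -- also decides whether an edge passes through it.
  skeleton-avoids : All (λ v → All (λ (a , b) →
                      v ≡ a ⊎ v ≡ b ⊎ Apart (corner v) (corner v) (corner a) (corner b)) skeleton) (upTo 20)
  skeleton-avoids = from-yes (all? (λ v → all? (λ (a , b) →
    (v ℕ.≟ a) ⊎-dec (v ℕ.≟ b) ⊎-dec apart? (corner v) (corner v) (corner a) (corner b)) skeleton) (upTo 20))

abstract

  corner-injective : All (λ u → All (λ v → corner u ≡ corner v → u ≡ v) (upTo 20)) (upTo 20)
  corner-injective = All.map (All.map resolve) (from-yes (all? (λ u → all? (λ v →
    (u ℕ.≟ v) ⊎-dec ¬? (≡-dec ℤ._≟_ ℤ._≟_ (corner u) (corner v))) (upTo 20)) (upTo 20)))
    where
    resolve : ∀ {u v} → u ≡ v ⊎ ¬ corner u ≡ corner v → corner u ≡ corner v → u ≡ v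
    resolve (inj₁ u≡v) _  = u≡v
    resolve (inj₂ u≢v) eq = contradiction eq u≢v

abstract

  corner-off-axis : All (λ v → proj₂ (corner v) ≢ 0ℤ) (upTo 18)
  corner-off-axis = from-yes (all? (λ v → ¬? (proj₂ (corner v) ℤ.≟ 0ℤ)) (upTo 18))

abstract

  -- The combinatorial half of 1-planarity. The geometric half, one point for each pair, is
  -- `crossing-unique`.
  crossing-functional : All (λ (e , f) → All (λ (e′ , f′) → e ≡ e′ → f ≡ f′) crossings) crossings
  crossing-functional = from-yes (all? (λ (e , f) → all? (λ (e′ , f′) → (e ≟ₑ e′) →-dec (f ≟ₑ f′)) crossings) crossings)

Nonparallelℤ : (a b c d : ℤ × ℤ) → Set
Nonparallelℤ (x₁ , y₁) (x₂ , y₂) (x₃ , y₃) (x₄ , y₄) =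
  (x₂ ℤ.- x₁) ℤ.* (y₄ ℤ.- y₃) ≢ (y₂ ℤ.- y₁) ℤ.* (x₄ ℤ.- x₃)

nonparallelℤ? : ∀ a b c d → Dec (Nonparallelℤ a b c d)
nonparallelℤ? (x₁ , y₁) (x₂ , y₂) (x₃ , y₃) (x₄ , y₄) =
  ¬? ((x₂ ℤ.- x₁) ℤ.* (y₄ ℤ.- y₃) ℤ.≟ (y₂ ℤ.- y₁) ℤ.* (x₄ ℤ.- x₃))

nonparallel : ∀ a b c d → Nonparallelℤ a b c d → NonParallel (embed a , embed b) (embed c , embed d)
nonparallel (x₁ , y₁) (x₂ , y₂) (x₃ , y₃) (x₄ , y₄) np eq = np (fromℤ-injective
  (trans (sym (product x₁ x₂ y₃ y₄)) (trans eq (product y₁ y₂ x₃ x₄))))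
  where
  product : ∀ k l m n → (fromℤ l - fromℤ k) * (fromℤ n - fromℤ m) ≡ fromℤ ((l ℤ.- k) ℤ.* (n ℤ.- m))
  product k l m n = sym (trans (fromℤ-* (l ℤ.- k) (n ℤ.- m)) (cong₂ _*_ (fromℤ-- l k) (fromℤ-- n m)))

NoCommonEnd : ℕ × ℕ → ℕ × ℕ → Set
NoCommonEnd (a , b) (c , d) = a ≢ c × a ≢ d × b ≢ c × b ≢ d

abstract

  -- Nonparallel segments make a crossing transversal and unique; four different ends rule out
  -- crossings of adjacent edges.
  crossings-proper : All (λ ((a , b) , (c , d)) →
    Nonparallelℤ (corner a) (corner b) (corner c) (corner d) × NoCommonEnd (a , b) (c , d)) crossings
  crossings-proper = from-yes (all? (λ ((a , b) , (c , d)) →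
    nonparallelℤ? (corner a) (corner b) (corner c) (corner d) ×-dec
    ¬? (a ℕ.≟ c) ×-dec ¬? (a ℕ.≟ d) ×-dec ¬? (b ℕ.≟ c) ×-dec ¬? (b ℕ.≟ d)) crossings)

-- The quadrilateral of the apexes 0, 1 and the axis ends 18, 19 lies below
-- the wall, which does not contain the axis.
record Wall (a b : ℤ × ℤ) (f : Functionalℤ) : Set where
  constructor wall
  field
    apexes : evalℤ f (corner 0) ℤ.≤ 0ℤ × evalℤ f (corner 1) ℤ.≤ 0ℤ
    ends   : evalℤ f (corner 18) ℤ.≤ 0ℤ × evalℤ f (corner 19) ℤ.≤ 0ℤ
    proper : evalℤ f (corner 18) ℤ.< 0ℤ ⊎ evalℤ f (corner 19) ℤ.< 0ℤ
    beyond : 0ℤ ℤ.≤ evalℤ f a × 0ℤ ℤ.≤ evalℤ f b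

-- Candidates: the line of the edge itself in both directions, and the four sides of the
-- quadrilateral, oriented so that the quadrilateral lies on the nonpositive side.
walls : (a b : ℤ × ℤ) → List Functionalℤ
walls a b = line a b ∷ line b a ∷ line (corner 18) (corner 0) ∷ line (corner 1) (corner 18) ∷
            line (corner 19) (corner 1) ∷ line (corner 0) (corner 19) ∷ []

wall? : ∀ a b f → Dec (Wall a b f)
wall? a b f = map′ (λ (as , es , p , bs) → wall as es p bs) (λ (wall as es p bs) → as , es , p , bs)
  (((evalℤ f (corner 0) ℤ.≤? 0ℤ) ×-dec (evalℤ f (corner 1) ℤ.≤? 0ℤ)) ×-dec
   ((evalℤ f (corner 18) ℤ.≤? 0ℤ) ×-dec (evalℤ f (corner 19) ℤ.≤? 0ℤ)) ×-dec
   ((evalℤ f (corner 18) ℤ.<? 0ℤ) ⊎-dec (evalℤ f (corner 19) ℤ.<? 0ℤ)) ×-dec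
   ((0ℤ ℤ.≤? evalℤ f a) ×-dec (0ℤ ℤ.≤? evalℤ f b)))

abstract

  -- One finite check that serves all `i`: a wall of an edge parts it from every spoke and every
  -- step, wherever the beads lie on the axis.
  edge-walls : All (λ (a , b) → Any (Wall (corner a) (corner b)) (walls (corner a) (corner b))) skeleton
  edge-walls = from-yes (all? (λ (a , b) → any? (wall? (corner a) (corner b)) (walls (corner a) (corner b))) skeleton)

abstract

  vertex-walls : All (λ v → Any (Wall (corner v) (corner v)) (walls (corner v) (corner v))) (applyUpTo (λ k → 2 ℕ.+ k) 16)
  vertex-walls = from-yes (all? (λ v →
    any? (wall? (corner v) (corner v)) (walls (corner v) (corner v))) (applyUpTo (λ k → 2 ℕ.+ k) 16))

skeleton-ordered : All (λ (a , b) → a ℕ.< 18 × a ℕ.< b × b ℕ.< 20) skeleton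
skeleton-ordered = from-yes (all? (λ (a , b) → (a ℕ.<? 18) ×-dec (a ℕ.<? b) ×-dec (b ℕ.<? 20)) skeleton)

-- Segments that depend on the beads

axisPoint : ℚ → Point
axisPoint t = t * fromℤ (+ 13) , 0ℚ

axis : Segment
axis = embed (corner 18) , embed (corner 19)

along-axis : ∀ t → along axis t ≡ axisPoint t
along-axis t = cong₂ _,_
  (solve 1 (λ t → con 0ℚ :+ t :* con (fromℤ (+ 13)) := t :* con (fromℤ (+ 13))) refl t)
  (solve 1 (λ t → con 0ℚ :+ t :* con 0ℚ := con 0ℚ) refl t)

inside-axis : ∀ {t} → 0ℚ < t → t < 1ℚ → InsideSegment (axisPoint t) axis
inside-axis {t} 0<t t<1 = t , 0<t , t<1 , sym (along-axis t)

height : Functional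
height = 0ℚ , 1ℚ , 0ℚ

eval-height : ∀ x y → eval height (x , y) ≡ y
eval-height = solve 2 (λ x y → con 0ℚ :* x :+ con 1ℚ :* y :+ con 0ℚ := y) refl

rightOf : ℚ → Functional
rightOf u = 1ℚ , 0ℚ , - u

eval-rightOf : ∀ u x y → eval (rightOf u) (x , y) ≡ x - u
eval-rightOf = solve 3 (λ u x y → con 1ℚ :* x :+ con 0ℚ :* y :+ :- u := x :- u) refl

-- Vanishes at (p , q) and at (u , 0).
through : ℚ → ℚ → ℚ → Functional
through p q u = q , u - p , - (u * q)

eval-through-apex : ∀ p q u → eval (through p q u) (p , q) ≡ 0ℚ
eval-through-apex = solve 3 (λ p q u → q :* p :+ (u :- p) :* q :+ :- (u :* q) := con 0ℚ) refl

eval-through-axis : ∀ p q u x → eval (through p q u) (x , 0ℚ) ≡ q * (x - u)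
eval-through-axis = solve 4 (λ p q u x → q :* x :+ (u :- p) :* con 0ℚ :+ :- (u :* q) := q :* (x :- u)) refl

spokeTo : ℚ → ℚ → ℚ → Segment
spokeTo p q u = (p , q) , (u , 0ℚ)

-- The line of the spoke with the right-hand foot passes through the common apex, and the other foot
-- lies strictly on one side of it. Which side that is depends on whether the apex is above or below
-- the axis, hence the distinction by the sign of `q`.
spokes-disjoint : ∀ p q {u v} → q ≢ 0ℚ → u < v → InteriorDisjoint (spokeTo p q u) (spokeTo p q v)
spokes-disjoint p q {u} {v} q≢0 u<v with <-cmp 0ℚ q
... | tri≈ _ 0≡q _ = contradiction (sym 0≡q) q≢0
... | tri< 0<q _ _ = separates⇒disjoint (through p q v) (spokeTo p q u) (spokeTo p q v)
  ((≤-reflexive apex , <⇒≤ lt) , (≤-reflexive (sym apex) , ≤-reflexive (sym foot)) , inj₁ (inj₂ lt))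
  where
  apex = eval-through-apex p q v
  foot : eval (through p q v) (v , 0ℚ) ≡ 0ℚ
  foot = trans (eval-through-axis p q v v) (trans (cong (q *_) (+-inverseʳ v)) (*-zeroʳ q))
  lt : eval (through p q v) (u , 0ℚ) < 0ℚ
  lt = subst₂ _<_ (sym (eval-through-axis p q v u)) (*-zeroʳ q)
         (*-monoʳ-<-pos q ⦃ positive 0<q ⦄ (p<q⇒p-q<0 u<v))
... | tri> _ _ q<0 = InteriorDisjoint-sym (separates⇒disjoint (through p q v) (spokeTo p q v) (spokeTo p q u)
  ((≤-reflexive apex , ≤-reflexive foot) , (≤-reflexive (sym apex) , <⇒≤ gt) , inj₂ (inj₂ gt)))
  where
  apex = eval-through-apex p q v
  foot : eval (through p q v) (v , 0ℚ) ≡ 0ℚ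
  foot = trans (eval-through-axis p q v v) (trans (cong (q *_) (+-inverseʳ v)) (*-zeroʳ q))
  gt : 0ℚ < eval (through p q v) (u , 0ℚ)
  gt = subst₂ _<_ (*-zeroʳ q) (sym (eval-through-axis p q v u))
         (*-monoʳ-<-neg q ⦃ negative q<0 ⦄ (p<q⇒p-q<0 u<v))

-- The separating line is the one that carries the axis. It parts spokes of different apexes, and
-- spokes from steps.
height-disjoint : ∀ {x₁ y₁ x₂ y₂ x₃ y₃ x₄ y₄} → y₁ ≤ 0ℚ → y₂ ≤ 0ℚ → 0ℚ ≤ y₃ → 0ℚ ≤ y₄ →
                  (y₁ < 0ℚ ⊎ y₂ < 0ℚ) ⊎ (0ℚ < y₃ ⊎ 0ℚ < y₄) →
                  InteriorDisjoint ((x₁ , y₁) , (x₂ , y₂)) ((x₃ , y₃) , (x₄ , y₄))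
height-disjoint {x₁} {y₁} {x₂} {y₂} {x₃} {y₃} {x₄} {y₄} l₁ l₂ l₃ l₄ strict =
  separates⇒disjoint height ((x₁ , y₁) , (x₂ , y₂)) ((x₃ , y₃) , (x₄ , y₄))
    (subst₂ (λ u v → (u ≤ 0ℚ) × (v ≤ 0ℚ)) (h x₁ y₁) (h x₂ y₂) (l₁ , l₂) ,
     subst₂ (λ u v → (0ℚ ≤ u) × (0ℚ ≤ v)) (h x₃ y₃) (h x₄ y₄) (l₃ , l₄) ,
     strict′ strict)
  where
  h : ∀ x y → y ≡ eval height (x , y)
  h x y = sym (eval-height x y)
  strict′ : (y₁ < 0ℚ ⊎ y₂ < 0ℚ) ⊎ (0ℚ < y₃ ⊎ 0ℚ < y₄) →
            (eval height (x₁ , y₁) < 0ℚ ⊎ eval height (x₂ , y₂) < 0ℚ) ⊎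
            (0ℚ < eval height (x₃ , y₃) ⊎ 0ℚ < eval height (x₄ , y₄))
  strict′ = Sum.map
    (Sum.map (subst (_< 0ℚ) (h x₁ y₁)) (subst (_< 0ℚ) (h x₂ y₂)))
    (Sum.map (subst (0ℚ <_) (h x₃ y₃)) (subst (0ℚ <_) (h x₄ y₄)))

-- The separating line is vertical; this serves segments that both lie on the axis.
axis-disjoint : ∀ {x₁ y₁ x₂ y₂ x₃ y₃ x₄ y₄} u → x₁ ≤ u → x₂ ≤ u → u ≤ x₃ → u ≤ x₄ →
                (x₁ < u ⊎ x₂ < u) ⊎ (u < x₃ ⊎ u < x₄) →
                InteriorDisjoint ((x₁ , y₁) , (x₂ , y₂)) ((x₃ , y₃) , (x₄ , y₄))
axis-disjoint {x₁} {y₁} {x₂} {y₂} {x₃} {y₃} {x₄} {y₄} u l₁ l₂ l₃ l₄ strict =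
  separates⇒disjoint (rightOf u) ((x₁ , y₁) , (x₂ , y₂)) ((x₃ , y₃) , (x₄ , y₄))
    ((≤0 x₁ y₁ l₁ , ≤0 x₂ y₂ l₂) , (≥0 x₃ y₃ l₃ , ≥0 x₄ y₄ l₄) ,
     Sum.map (Sum.map (<0 x₁ y₁) (<0 x₂ y₂)) (Sum.map (>0 x₃ y₃) (>0 x₄ y₄)) strict)
  where
  ≤0 : ∀ x y → x ≤ u → eval (rightOf u) (x , y) ≤ 0ℚ
  ≤0 x y x≤u = subst (_≤ 0ℚ) (sym (eval-rightOf u x y)) (p≤q⇒p-q≤0 x≤u)
  <0 : ∀ x y → x < u → eval (rightOf u) (x , y) < 0ℚ
  <0 x y x<u = subst (_< 0ℚ) (sym (eval-rightOf u x y)) (p<q⇒p-q<0 x<u)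
  ≥0 : ∀ x y → u ≤ x → 0ℚ ≤ eval (rightOf u) (x , y)
  ≥0 x y u≤x = subst (0ℚ ≤_) (sym (eval-rightOf u x y)) (p≤q⇒0≤q-p u≤x)
  >0 : ∀ x y → u < x → 0ℚ < eval (rightOf u) (x , y)
  >0 x y u<x = subst (0ℚ <_) (sym (eval-rightOf u x y)) (p<q⇒0<q-p u<x)

≤⇒∃ : ∀ {k v} → k ℕ.≤ v → ∃ λ ℓ → v ≡ k ℕ.+ ℓ
≤⇒∃ k≤v with ℓ , eq ← ℕ.m≤n⇒∃[o]m+o≡n k≤v = ℓ , sym eq

≤-split : ∀ k {n v} → k ℕ.≤ v → v ℕ.≤ k ℕ.+ n → ∃ λ ℓ → v ≡ k ℕ.+ ℓ × ℓ ℕ.≤ n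
≤-split k {n} k≤v v≤ with ℕ.m≤n⇒∃[o]m+o≡n k≤v
... | ℓ , refl = ℓ , refl , ℕ.+-cancelˡ-≤ k ℓ n v≤

-- Vertices, links and their segments for a fixed number of beads

module Geometry (i : ℕ) where

  -- The vertices of the i-th graph are 0, …, 20 + i, where 18, 19, …, 20 + i lie
  -- on the axis in this order, so that 20 + i is the vertex 19 of the skeleton.
  stretch : ℕ → ℕ
  stretch v = if does (v ℕ.<? 19) then v else 20 ℕ.+ i

  stretch-< : ∀ {v} → v ℕ.< 19 → stretch v ≡ v
  stretch-< {v} v<19 rewrite dec-true (v ℕ.<? 19) v<19 = refl

  -- Sources of skeleton edges are below 18, so only targets need stretching. `Spoke` covers the
  -- beads alone, as the edges from the apexes to the ends of the axis belong to the skeleton.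
  -- `Step` has no upper bound; that comes from the range of the vertices.
  Rigid Spoke Step Link : ℕ → ℕ → Set
  Rigid a b = Any (λ (c , d) → a ≡ c × b ≡ stretch d) skeleton
  Spoke a b = a ℕ.≤ 1 × 19 ℕ.≤ b × b ℕ.≤ 19 ℕ.+ i
  Step  a b = 18 ℕ.≤ a × b ≡ suc a
  Link  a b = Rigid a b ⊎ Spoke a b ⊎ Step a b

  -- Unfolding these would normalise fractions with symbolic denominators.
  abstract
    unit : ℚ
    unit = 1/ fromℤ (+ (2 ℕ.+ i))

    ratio : ℕ → ℚ
    ratio ℓ = fromℤ (+ ℓ) * unit

    ratio-mono : ∀ {k ℓ} → k ℕ.< ℓ → ratio k < ratio ℓ
    ratio-mono k<ℓ = *-monoˡ-<-pos unit (fromℤ-mono-< (ℤ.+<+ k<ℓ))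

    ratio-0 : ratio 0 ≡ 0ℚ
    ratio-0 = *-zeroˡ unit

    ratio-last : ratio (2 ℕ.+ i) ≡ 1ℚ
    ratio-last = *-inverseʳ (fromℤ (+ (2 ℕ.+ i)))

  level : ℕ → ℚ
  level ℓ = ratio ℓ * fromℤ (+ 13)

  level-mono-< : ∀ {k ℓ} → k ℕ.< ℓ → level k < level ℓ
  level-mono-< k<ℓ = *-monoˡ-<-pos (fromℤ (+ 13)) (ratio-mono k<ℓ)

  level-mono-≤ : ∀ {k ℓ} → k ℕ.≤ ℓ → level k ≤ level ℓ
  level-mono-≤ k≤ℓ with ℕ.m≤n⇒m<n∨m≡n k≤ℓ
  ... | inj₁ k<ℓ  = <⇒≤ (level-mono-< k<ℓ)
  ... | inj₂ refl = ≤-refl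

  -- The axis vertices are equally spaced: `18 + ℓ` sits at the fraction ℓ / (2 + i) of the axis,
  -- which consists of 2 + i steps.
  place : ℕ → Point
  place v = if does (v ℕ.<? 18) then embed (corner v) else axisPoint (ratio (v ∸ 18))

  place-core : ∀ {v} → v ℕ.< 18 → place v ≡ embed (corner v)
  place-core {v} v<18 rewrite dec-true (v ℕ.<? 18) v<18 = refl

  place-first : place 18 ≡ embed (corner 18)
  place-first = trans (cong axisPoint ratio-0) refl

  place-last : place (20 ℕ.+ i) ≡ embed (corner 19)
  place-last = trans (cong axisPoint ratio-last) refl

  <20-cases : ∀ {v} → v ℕ.< 20 → v ℕ.< 18 ⊎ v ≡ 18 ⊎ v ≡ 19
  <20-cases (s≤s v≤19) with ℕ.m≤n⇒m<n∨m≡n v≤19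
  ... | inj₂ eq = inj₂ (inj₂ eq)
  ... | inj₁ (s≤s v≤18) with ℕ.m≤n⇒m<n∨m≡n v≤18
  ...   | inj₂ eq   = inj₂ (inj₁ eq)
  ...   | inj₁ v<18 = inj₁ v<18

  place-skeleton : ∀ {v} → v ℕ.< 20 → place (stretch v) ≡ embed (corner v)
  place-skeleton v<20 with <20-cases v<20
  ... | inj₁ v<18 = trans (cong place (stretch-< (ℕ.m<n⇒m<1+n v<18))) (place-core v<18)
  ... | inj₂ (inj₁ refl) = place-first
  ... | inj₂ (inj₂ refl) = place-last

  seg : ℕ → ℕ → Segment
  seg a b = place a , place b

  -- `Link` with its equations absorbed into the indices, so that matching determines the ends.
  data Shape : ℕ → ℕ → Set where
    rigid : ∀ {c d} → (c , d) ∈ skeleton → Shape c (stretch d)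
    spoke : ∀ {a ℓ} → a ℕ.≤ 1 → ℓ ℕ.≤ i → Shape a (19 ℕ.+ ℓ)
    step  : ∀ ℓ → Shape (18 ℕ.+ ℓ) (19 ℕ.+ ℓ)

  shape : ∀ {a b} → Link a b → Shape a b
  shape (inj₁ r) = rigid′ (find r)
    where
    rigid′ : ∀ {a b} → (∃ λ (e : ℕ × ℕ) → e ∈ skeleton × a ≡ proj₁ e × b ≡ stretch (proj₂ e)) → Shape a b
    rigid′ (_ , cd∈ , refl , refl) = rigid cd∈
  shape (inj₂ (inj₁ (a≤1 , 19≤b , b≤19+i))) = spoke′ a≤1 (≤-split 19 {i} 19≤b b≤19+i)
    where
    spoke′ : ∀ {a b} → a ℕ.≤ 1 → (∃ λ ℓ → b ≡ 19 ℕ.+ ℓ × ℓ ℕ.≤ i) → Shape a b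
    spoke′ a≤1 (ℓ , refl , ℓ≤i) = spoke a≤1 ℓ≤i
  shape (inj₂ (inj₂ (18≤a , b≡1+a))) = step′ (≤⇒∃ 18≤a) b≡1+a
    where
    step′ : ∀ {a b} → (∃ λ ℓ → a ≡ 18 ℕ.+ ℓ) → b ≡ suc a → Shape a b
    step′ (ℓ , refl) refl = step ℓ

  data Vertex : ℕ → Set where
    core : ∀ {v} → v ℕ.< 18 → Vertex v
    onAxis : ∀ {ℓ} → ℓ ℕ.≤ 2 ℕ.+ i → Vertex (18 ℕ.+ ℓ)

  vertex : ∀ {v} → v ℕ.≤ 20 ℕ.+ i → Vertex v
  vertex {v} v≤ with v ℕ.<? 18
  ... | yes v<18 = core v<18
  ... | no v≮18  = onAxis′ (≤-split 18 {2 ℕ.+ i} (ℕ.≮⇒≥ v≮18) v≤)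
    where
    onAxis′ : ∀ {v} → (∃ λ ℓ → v ≡ 18 ℕ.+ ℓ × ℓ ℕ.≤ 2 ℕ.+ i) → Vertex v
    onAxis′ (ℓ , refl , ℓ≤) = onAxis ℓ≤

  module _ {p q f} (w : Wall p q f) where

    open Wall

    private
      F : Functional
      F = functional f

    first-below : eval F (embed (corner 18)) ≤ 0ℚ
    first-below = eval-≤0 f (corner 18) (proj₁ (ends w))

    last-below : eval F (embed (corner 19)) ≤ 0ℚ
    last-below = eval-≤0 f (corner 19) (proj₂ (ends w))

    apex-below : ∀ {a} → a ℕ.≤ 1 → eval F (place a) ≤ 0ℚ
    apex-below z≤n       = eval-≤0 f (corner 0) (proj₁ (apexes w))
    apex-below (s≤s z≤n) = eval-≤0 f (corner 1) (proj₂ (apexes w))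

    -- A bead is a proper convex combination of the two ends of the axis, one of which is strictly
    -- below the wall.
    bead-below : ∀ {ℓ} → 1 ℕ.≤ ℓ → ℓ ℕ.≤ 1 ℕ.+ i → eval F (place (18 ℕ.+ ℓ)) < 0ℚ
    bead-below {ℓ} 1≤ℓ ℓ≤ = eval-inside-<0 F (embed (corner 18)) (embed (corner 19))
      (inside-axis (subst (_< ratio ℓ) ratio-0 (ratio-mono 1≤ℓ)) (subst (ratio ℓ <_) ratio-last (ratio-mono (s≤s ℓ≤))))
      first-below last-below
      (Sum.map (eval-<0 f (corner 18)) (eval-<0 f (corner 19)) (proper w))

    axis-below : ∀ {ℓ} → ℓ ℕ.≤ 2 ℕ.+ i → eval F (place (18 ℕ.+ ℓ)) ≤ 0ℚ
    axis-below {zero} _ = subst (λ z → eval F z ≤ 0ℚ) (sym place-first) first-below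
    axis-below {suc ℓ} ℓ≤ with ℕ.m≤n⇒m<n∨m≡n ℓ≤
    ... | inj₁ (s≤s ℓ<) = <⇒≤ (bead-below (s≤s z≤n) ℓ<)
    ... | inj₂ refl     = subst (λ z → eval F z ≤ 0ℚ) (sym place-last) last-below

    above : 0ℚ ≤ eval F (embed p) × 0ℚ ≤ eval F (embed q)
    above = eval-≥0 f p (proj₁ (beyond w)) , eval-≥0 f q (proj₂ (beyond w))

  -- Meant for segments whose position depends on `i`. The quantification over all walls is what
  -- makes the finite list `edge-walls` applicable to them.
  Flexible : Segment → Set
  Flexible s = ∀ {p q f} → Wall p q f → InteriorDisjoint s (embed p , embed q)

  spoke-flexible : ∀ {a ℓ} → a ℕ.≤ 1 → ℓ ℕ.≤ i → Flexible (seg a (19 ℕ.+ ℓ))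
  spoke-flexible {a} {ℓ} a≤1 ℓ≤i {p} {q} {f} w =
    separates⇒disjoint (functional f) (seg a (19 ℕ.+ ℓ)) (embed p , embed q)
      ((apex-below w a≤1 , <⇒≤ lt) , above w , inj₁ (inj₂ lt))
    where
    lt : eval (functional f) (place (19 ℕ.+ ℓ)) < 0ℚ
    lt = bead-below w {suc ℓ} (s≤s z≤n) (s≤s ℓ≤i)

  step-flexible : ∀ {ℓ} → ℓ ℕ.≤ 1 ℕ.+ i → Flexible (seg (18 ℕ.+ ℓ) (19 ℕ.+ ℓ))
  step-flexible {ℓ} ℓ≤ {p} {q} {f} w =
    separates⇒disjoint (functional f) (seg (18 ℕ.+ ℓ) (19 ℕ.+ ℓ)) (embed p , embed q)
      ((axis-below w (ℕ.m≤n⇒m≤1+n ℓ≤) , axis-below w {suc ℓ} (s≤s ℓ≤)) , above w , inj₁ (strict ℓ≤))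
    where
    strict : ∀ {ℓ} → ℓ ℕ.≤ 1 ℕ.+ i → eval (functional f) (place (18 ℕ.+ ℓ)) < 0ℚ ⊎ eval (functional f) (place (19 ℕ.+ ℓ)) < 0ℚ
    strict {zero}  _  = inj₂ (bead-below w {1} (s≤s z≤n) (s≤s z≤n))
    strict {suc ℓ} ℓ≤ = inj₁ (bead-below w (s≤s z≤n) ℓ≤)

  module _ {c d} (cd∈ : (c , d) ∈ skeleton) where

    private
      ordered : c ℕ.< 18 × c ℕ.< d × d ℕ.< 20
      ordered = All.lookup skeleton-ordered cd∈

    place-src : place c ≡ embed (corner c)
    place-src = place-core (proj₁ ordered)

    place-tgt : place (stretch d) ≡ embed (corner d)
    place-tgt = place-skeleton (proj₂ (proj₂ ordered))

    rigid-seg : seg c (stretch d) ≡ (embed (corner c) , embed (corner d))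
    rigid-seg = cong₂ _,_ place-src place-tgt

    flexible-rigid : ∀ {s} → Flexible s → InteriorDisjoint s (seg c (stretch d))
    flexible-rigid {s} flex = subst (InteriorDisjoint s) (sym rigid-seg)
      (flex (proj₂ (Any.satisfied (All.lookup edge-walls cd∈))))

  Crossing : (a b c d : ℕ) → Set
  Crossing a b c d = ∃ λ b′ → ∃ λ d′ → ((a , b′) , (c , d′)) ∈ crossings ×
    ((a , b′) ∈ skeleton × b ≡ stretch b′) × ((c , d′) ∈ skeleton × d ≡ stretch d′)

  spoke-spoke : ∀ {a c k ℓ} → a ℕ.≤ 1 → c ℕ.≤ 1 → (a , k) ≢ (c , ℓ) →
                InteriorDisjoint (seg a (19 ℕ.+ k)) (seg c (19 ℕ.+ ℓ))
  spoke-spoke {k = k} {ℓ} z≤n z≤n neq with ℕ.<-cmp k ℓ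
  -- (3, 1), and further down (9, -1), are the positions of the apexes; the foot of the spoke to
  -- `19 + k` is at level 1 + k.
  ... | tri< k<ℓ _ _ = spokes-disjoint (fromℤ (+ 3)) (fromℤ (+ 1)) (λ ()) (level-mono-< (s≤s k<ℓ))
  ... | tri≈ _ refl _ = contradiction refl neq
  ... | tri> _ _ ℓ<k = InteriorDisjoint-sym
    (spokes-disjoint (fromℤ (+ 3)) (fromℤ (+ 1)) (λ ()) (level-mono-< (s≤s ℓ<k)))
  spoke-spoke {k = k} {ℓ} (s≤s z≤n) (s≤s z≤n) neq with ℕ.<-cmp k ℓ
  ... | tri< k<ℓ _ _ = spokes-disjoint (fromℤ (+ 9)) (fromℤ -[1+ 0 ]) (λ ()) (level-mono-< (s≤s k<ℓ))
  ... | tri≈ _ refl _ = contradiction refl neq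
  ... | tri> _ _ ℓ<k = InteriorDisjoint-sym
    (spokes-disjoint (fromℤ (+ 9)) (fromℤ -[1+ 0 ]) (λ ()) (level-mono-< (s≤s ℓ<k)))
  spoke-spoke {k = k} {ℓ} (s≤s z≤n) z≤n neq =
    height-disjoint (<⇒≤ neg) ≤-refl (<⇒≤ pos) ≤-refl (inj₂ (inj₁ pos))
    where
    neg = fromℤ-mono-< ℤ.-<+
    pos = fromℤ-mono-< (ℤ.+<+ (s≤s z≤n))
  spoke-spoke {k = k} {ℓ} z≤n (s≤s z≤n) neq =
    InteriorDisjoint-sym
      (height-disjoint (<⇒≤ neg) ≤-refl (<⇒≤ pos) ≤-refl (inj₂ (inj₁ pos)))
    where
    neg = fromℤ-mono-< ℤ.-<+
    pos = fromℤ-mono-< (ℤ.+<+ (s≤s z≤n))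

  spoke-level : ∀ {a ℓ} m n → a ℕ.≤ 1 → InteriorDisjoint (seg a (19 ℕ.+ ℓ)) (seg (18 ℕ.+ m) (18 ℕ.+ n))
  spoke-level {ℓ = ℓ} m n z≤n = InteriorDisjoint-sym
    (height-disjoint ≤-refl ≤-refl (<⇒≤ pos) ≤-refl (inj₂ (inj₁ pos)))
    where pos = fromℤ-mono-< (ℤ.+<+ (s≤s z≤n))
  spoke-level m n (s≤s z≤n) = height-disjoint (<⇒≤ neg) ≤-refl ≤-refl ≤-refl (inj₁ (inj₁ neg))
    where neg = fromℤ-mono-< ℤ.-<+

  step-step : ∀ {k ℓ} → k ≢ ℓ → InteriorDisjoint (seg (18 ℕ.+ k) (19 ℕ.+ k)) (seg (18 ℕ.+ ℓ) (19 ℕ.+ ℓ))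
  step-step {k} {ℓ} k≢ℓ with ℕ.<-cmp k ℓ
  ... | tri≈ _ k≡ℓ _ = contradiction k≡ℓ k≢ℓ
  ... | tri< k<ℓ _ _ = axis-disjoint (level (suc k)) (level-mono-≤ (ℕ.n≤1+n k)) ≤-refl
    (level-mono-≤ k<ℓ) (level-mono-≤ (ℕ.m≤n⇒m≤1+n k<ℓ)) (inj₁ (inj₁ (level-mono-< {k} ℕ.≤-refl)))
  ... | tri> _ _ ℓ<k = InteriorDisjoint-sym
    (axis-disjoint (level (suc ℓ)) (level-mono-≤ (ℕ.n≤1+n ℓ)) ≤-refl
      (level-mono-≤ ℓ<k) (level-mono-≤ (ℕ.m≤n⇒m≤1+n ℓ<k)) (inj₁ (inj₁ (level-mono-< {ℓ} ℕ.≤-refl))))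

  step-bound : ∀ {ℓ} → 19 ℕ.+ ℓ ℕ.≤ 20 ℕ.+ i → ℓ ℕ.≤ 1 ℕ.+ i
  step-bound {ℓ} = ℕ.+-cancelˡ-≤ 19 ℓ (1 ℕ.+ i)

  -- Only two rigid edges can cross, which the checks on the skeleton settle. A rigid edge is parted
  -- from a spoke or a step by its wall, and the remaining pairs are parted by a line through an
  -- apex, the axis or a vertical line.
  shapes-disjoint : ∀ {a b c d} → Shape a b → Shape c d → b ℕ.≤ 20 ℕ.+ i → d ℕ.≤ 20 ℕ.+ i →
                    (a , b) ≢ (c , d) → Crossing a b c d ⊎ InteriorDisjoint (seg a b) (seg c d)
  shapes-disjoint (rigid {a} {b} ab∈) (rigid {c} {d} cd∈) _ _ neq
    with All.lookup (All.lookup skeleton-compatible ab∈) cd∈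
  ... | inj₁ refl = contradiction refl neq
  ... | inj₂ (inj₁ x) = inj₁ (b , d , x , (ab∈ , refl) , (cd∈ , refl))
  ... | inj₂ (inj₂ ap) = inj₂ (subst₂ InteriorDisjoint (sym (rigid-seg ab∈)) (sym (rigid-seg cd∈))
    (apart⇒disjoint (corner a) (corner b) (corner c) (corner d) ap))
  shapes-disjoint (rigid {a} {b} ab∈) (spoke {c} {ℓ} c≤1 ℓ≤i) _ _ _ =
    inj₂ (InteriorDisjoint-sym (flexible-rigid ab∈ (spoke-flexible c≤1 ℓ≤i)))
  shapes-disjoint (rigid {a} {b} ab∈) (step ℓ) _ d≤ _ =
    inj₂ (InteriorDisjoint-sym
      (flexible-rigid ab∈ (step-flexible (step-bound d≤))))
  shapes-disjoint (spoke a≤1 k≤i) (rigid cd∈) _ _ _ = inj₂ (flexible-rigid cd∈ (spoke-flexible a≤1 k≤i))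
  shapes-disjoint (spoke a≤1 _) (spoke c≤1 _) _ _ neq = inj₂ (spoke-spoke a≤1 c≤1 (λ {refl → neq refl}))
  shapes-disjoint (spoke a≤1 _) (step ℓ) _ _ _ = inj₂ (spoke-level ℓ (suc ℓ) a≤1)
  shapes-disjoint (step k) (rigid cd∈) b≤ _ _ = inj₂ (flexible-rigid cd∈ (step-flexible (step-bound b≤)))
  shapes-disjoint (step k) (spoke {c} {ℓ} c≤1 _) _ _ _ =
    inj₂ (InteriorDisjoint-sym (spoke-level k (suc k) c≤1))
  shapes-disjoint (step k) (step ℓ) _ _ neq = inj₂ (step-step (λ {refl → neq refl}))

  pointed : ℕ → Segment
  pointed w = seg w w

  -- A vertex inside a segment is an interior point common to the segment and
  -- the degenerate segment at that vertex.
  avoids : ∀ {w s} → InteriorDisjoint (pointed w) s → ¬ InsideSegment (place w) s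
  avoids {w} disj = no-common disj (place w) (point-inside (place w))

  core-wall : ∀ {w} → 2 ℕ.≤ w → w ℕ.< 18 → ∃ (Wall (corner w) (corner w))
  core-wall {w} 2≤w w<18 with ℕ.m≤n⇒∃[o]m+o≡n 2≤w
  ... | k , refl = Any.satisfied (All.lookup vertex-walls (∈-applyUpTo⁺ (λ k → 2 ℕ.+ k) (ℕ.+-cancelˡ-≤ 2 (suc k) 16 w<18)))

  core-flexible : ∀ {w s} → 2 ℕ.≤ w → w ℕ.< 18 → Flexible s → InteriorDisjoint (pointed w) s
  core-flexible {w} {s} 2≤w w<18 flex = InteriorDisjoint-sym
    (subst (InteriorDisjoint s) (cong₂ _,_ (sym (place-core w<18)) (sym (place-core w<18)))
      (flex (proj₂ (core-wall 2≤w w<18))))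

  skeleton-vertex-rigid : ∀ {c d v w} → (c , d) ∈ skeleton → v ℕ.< 20 → w ≡ stretch v →
                          w ≢ c → w ≢ stretch d → InteriorDisjoint (pointed w) (seg c (stretch d))
  skeleton-vertex-rigid {c} {d} {v} cd∈ v<20 refl w≢c w≢d
    with All.lookup (All.lookup skeleton-avoids (∈-upTo⁺ v<20)) cd∈
  ... | inj₁ refl = contradiction (stretch-< (ℕ.m<n⇒m<1+n (proj₁ (All.lookup skeleton-ordered cd∈)))) w≢c
  ... | inj₂ (inj₁ refl) = contradiction refl w≢d
  ... | inj₂ (inj₂ ap) = subst₂ InteriorDisjoint (cong₂ _,_ (sym (place-skeleton v<20)) (sym (place-skeleton v<20)))
    (sym (rigid-seg cd∈)) (apart⇒disjoint (corner v) (corner v) (corner c) (corner d) ap)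

  bead-flexible : ∀ {ℓ} → 1 ℕ.≤ ℓ → ℓ ℕ.≤ 1 ℕ.+ i → Flexible (pointed (18 ℕ.+ ℓ))
  bead-flexible {ℓ} 1≤ℓ ℓ≤ {p} {q} {f} w =
    separates⇒disjoint (functional f) (pointed (18 ℕ.+ ℓ)) (embed p , embed q)
      ((<⇒≤ lt , <⇒≤ lt) , above w , inj₁ (inj₁ lt))
    where lt = bead-below w 1≤ℓ ℓ≤

  -- Against spokes and steps, the corners 2 to 17 are handled by their walls and the apexes by
  -- their height. Against rigid edges, the beads use the wall of the edge and all other vertices
  -- the checks on the skeleton.
  vertex-disjoint : ∀ {w a b} → Vertex w → Shape a b → b ℕ.≤ 20 ℕ.+ i → w ≢ a → w ≢ b →
                    InteriorDisjoint (pointed w) (seg a b)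
  vertex-disjoint (core {w} w<18) (rigid cd∈) _ =
    skeleton-vertex-rigid cd∈ (ℕ.m<n⇒m<1+n (ℕ.m<n⇒m<1+n w<18)) (sym (stretch-< (ℕ.m<n⇒m<1+n w<18)))
  vertex-disjoint (onAxis {zero} _) (rigid cd∈) _ =
    skeleton-vertex-rigid {v = 18} cd∈ (s≤s (ℕ.n≤1+n 18)) refl
  vertex-disjoint (onAxis {suc ℓ} ℓ≤) (rigid cd∈) _ w≢a w≢b with ℕ.m≤n⇒m<n∨m≡n ℓ≤
  ... | inj₁ (s≤s ℓ<) = flexible-rigid cd∈ (bead-flexible {suc ℓ} (s≤s z≤n) ℓ<)
  ... | inj₂ refl = skeleton-vertex-rigid {v = 19} cd∈ ℕ.≤-refl refl w≢a w≢b
  vertex-disjoint {w} (core w<18) (spoke {a} {ℓ} a≤1 ℓ≤i) _ w≢a _ with 2 ℕ.≤? w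
  ... | yes 2≤w = core-flexible {s = seg a (19 ℕ.+ ℓ)} 2≤w w<18 (spoke-flexible a≤1 ℓ≤i)
  ... | no 2≰w = apex-spoke (ℕ.s≤s⁻¹ (ℕ.≰⇒> 2≰w)) a≤1 w≢a
    where
    apex-spoke : ∀ {w a} → w ℕ.≤ 1 → a ℕ.≤ 1 → w ≢ a → InteriorDisjoint (pointed w) (seg a (19 ℕ.+ ℓ))
    apex-spoke z≤n z≤n w≢a = contradiction refl w≢a
    apex-spoke (s≤s z≤n) (s≤s z≤n) w≢a = contradiction refl w≢a
    apex-spoke (s≤s z≤n) z≤n _ = height-disjoint (<⇒≤ neg) (<⇒≤ neg) (<⇒≤ pos) ≤-refl (inj₁ (inj₁ neg))
      where
      neg = fromℤ-mono-< ℤ.-<+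
      pos = fromℤ-mono-< (ℤ.+<+ (s≤s z≤n))
    apex-spoke z≤n (s≤s z≤n) _ = InteriorDisjoint-sym
      (height-disjoint (<⇒≤ neg) ≤-refl (<⇒≤ pos) (<⇒≤ pos) (inj₁ (inj₁ neg)))
      where
      neg = fromℤ-mono-< ℤ.-<+
      pos = fromℤ-mono-< (ℤ.+<+ (s≤s z≤n))
  vertex-disjoint (onAxis {m} _) (spoke {a} {ℓ} a≤1 ℓ≤i) _ _ _ =
    InteriorDisjoint-sym (spoke-level m m a≤1)
  vertex-disjoint {w} (core w<18) (step ℓ) b≤ _ _ with 2 ℕ.≤? w
  ... | yes 2≤w = core-flexible {s = seg (18 ℕ.+ ℓ) (19 ℕ.+ ℓ)} 2≤w w<18 (step-flexible (step-bound b≤))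
  ... | no 2≰w = apex-step (ℕ.s≤s⁻¹ (ℕ.≰⇒> 2≰w))
    where
    apex-step : ∀ {w} → w ℕ.≤ 1 → InteriorDisjoint (pointed w) (seg (18 ℕ.+ ℓ) (19 ℕ.+ ℓ))
    apex-step z≤n = InteriorDisjoint-sym
      (height-disjoint ≤-refl ≤-refl (<⇒≤ pos) (<⇒≤ pos) (inj₂ (inj₁ pos)))
      where pos = fromℤ-mono-< (ℤ.+<+ (s≤s z≤n))
    apex-step (s≤s z≤n) = height-disjoint (<⇒≤ neg) (<⇒≤ neg) ≤-refl ≤-refl (inj₁ (inj₁ neg))
      where neg = fromℤ-mono-< ℤ.-<+
  vertex-disjoint (onAxis {m} _) (step ℓ) _ m≢ℓ m≢1+ℓ with ℕ.<-cmp m ℓ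
  ... | tri≈ _ refl _ = contradiction refl m≢ℓ
  ... | tri< m<ℓ _ _ = axis-disjoint (level ℓ) (level-mono-≤ (ℕ.<⇒≤ m<ℓ)) (level-mono-≤ (ℕ.<⇒≤ m<ℓ))
    ≤-refl (level-mono-≤ (ℕ.n≤1+n ℓ)) (inj₁ (inj₁ (level-mono-< m<ℓ)))
  ... | tri> _ _ ℓ<m = InteriorDisjoint-sym
    (axis-disjoint (level (suc ℓ)) (level-mono-≤ (ℕ.n≤1+n ℓ)) ≤-refl (level-mono-≤ ℓ<m) (level-mono-≤ ℓ<m)
      (inj₁ (inj₁ (level-mono-< {ℓ} ℕ.≤-refl))))

  level-injective : ∀ {k ℓ} → level k ≡ level ℓ → k ≡ ℓ
  level-injective {k} {ℓ} eq with ℕ.<-cmp k ℓ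
  ... | tri< k<ℓ _ _ = contradiction eq (<⇒≢ (level-mono-< k<ℓ))
  ... | tri≈ _ k≡ℓ _ = k≡ℓ
  ... | tri> _ _ ℓ<k = contradiction (sym eq) (<⇒≢ (level-mono-< ℓ<k))

  core≢axis : ∀ {v} ℓ → v ℕ.< 18 → place v ≢ place (18 ℕ.+ ℓ)
  core≢axis ℓ v<18 eq = All.lookup corner-off-axis (∈-upTo⁺ v<18)
    (fromℤ-injective (cong proj₂ (trans (sym (place-core v<18)) eq)))

  place-injective : ∀ {v w} → Vertex v → Vertex w → place v ≡ place w → v ≡ w
  place-injective (core v<18) (core w<18) eq =
    All.lookup (All.lookup corner-injective (∈-upTo⁺ (up v<18))) (∈-upTo⁺ (up w<18))
      (cong₂ _,_ (fromℤ-injective (cong proj₁ eq′)) (fromℤ-injective (cong proj₂ eq′)))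
    where
    up : ∀ {v} → v ℕ.< 18 → v ℕ.< 20
    up v<18 = ℕ.m<n⇒m<1+n (ℕ.m<n⇒m<1+n v<18)
    eq′ = trans (sym (place-core v<18)) (trans eq (place-core w<18))
  place-injective (core v<18) (onAxis {ℓ} _) eq = contradiction eq (core≢axis ℓ v<18)
  place-injective (onAxis {ℓ} _) (core w<18) eq = contradiction (sym eq) (core≢axis ℓ w<18)
  place-injective (onAxis {k} _) (onAxis {ℓ} _) eq = cong (18 ℕ.+_) (level-injective (cong proj₁ eq))

  stretch-≥ : ∀ {v} → ¬ v ℕ.< 19 → stretch v ≡ 20 ℕ.+ i
  stretch-≥ {v} v≮19 rewrite dec-false (v ℕ.<? 19) v≮19 = refl

  link-ordered : ∀ {a b} → Shape a b → a ℕ.< b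
  link-ordered (rigid {c} {d} cd∈) with All.lookup skeleton-ordered cd∈
  ... | c<18 , c<d , _ = below (d ℕ.<? 19)
    where
    below : Dec (d ℕ.< 19) → c ℕ.< stretch d
    below (yes d<19) = subst (c ℕ.<_) (sym (stretch-< d<19)) c<d
    below (no d≮19)  = subst (c ℕ.<_) (sym (stretch-≥ d≮19)) (ℕ.<-≤-trans c<18 (ℕ.m≤m+n 18 (2 ℕ.+ i)))
  link-ordered (spoke {ℓ = ℓ} a≤1 _) = ℕ.≤-<-trans a≤1 (ℕ.<-≤-trans (s≤s (s≤s z≤n)) (ℕ.m≤m+n 19 ℓ))
  link-ordered (step ℓ) = ℕ.≤-refl

  -- Equal stretched labels are drawn at the same point, and the twenty corners are different
  -- points.
  stretch-injective : ∀ {v w} → v ℕ.< 20 → w ℕ.< 20 → stretch v ≡ stretch w → v ≡ w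
  stretch-injective {v} {w} v<20 w<20 eq = All.lookup (All.lookup corner-injective (∈-upTo⁺ v<20)) (∈-upTo⁺ w<20)
    (cong₂ _,_ (fromℤ-injective (cong proj₁ eq′)) (fromℤ-injective (cong proj₂ eq′)))
    where
    eq′ : embed (corner v) ≡ embed (corner w)
    eq′ = trans (sym (place-skeleton v<20)) (trans (cong place eq) (place-skeleton w<20))

  link? : ∀ a b → Dec (Link a b)
  link? a b = any? (λ (c , d) → (a ℕ.≟ c) ×-dec (b ℕ.≟ stretch d)) skeleton ⊎-dec
              ((a ℕ.≤? 1) ×-dec (19 ℕ.≤? b) ×-dec (b ℕ.≤? 19 ℕ.+ i)) ⊎-dec
              ((18 ℕ.≤? a) ×-dec (b ℕ.≟ suc a))

-- The graph and its 1-plane drawing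

module Family (i : ℕ) where

  open Geometry i
  open Edge

  G : Graph (21 ℕ.+ i)
  G = record
    { _~_    = λ u v → Link (toℕ u) (toℕ v) ⊎ Link (toℕ v) (toℕ u)
    ; _~?_   = λ u v → link? (toℕ u) (toℕ v) ⊎-dec link? (toℕ v) (toℕ u)
    ; irrefl = λ { refl → Sum.[ loopless , loopless ] }
    ; sym    = Sum.swap
    }
    where
    loopless : ∀ {v} → ¬ Link v v
    loopless l = ℕ.<-irrefl refl (link-ordered (shape l))

  position : Fin (21 ℕ.+ i) → Point
  position u = place (toℕ u)

  bound : ∀ (u : Fin (21 ℕ.+ i)) → toℕ u ℕ.≤ 20 ℕ.+ i
  bound u = ℕ.s≤s⁻¹ (Fin.toℕ<n u)

  position-injective : ∀ {u v} → position u ≡ position v → u ≡ v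
  position-injective {u} {v} eq = Fin.toℕ-injective (place-injective (vertex (bound u)) (vertex (bound v)) eq)

  open Arcs G position (λ _ _ → [])

  edge-shape : ∀ (e : Edge G) → Shape (toℕ (src e)) (toℕ (tgt e))
  edge-shape e = orient (adjacent e)
    where
    orient : Link (toℕ (src e)) (toℕ (tgt e)) ⊎ Link (toℕ (tgt e)) (toℕ (src e)) → Shape (toℕ (src e)) (toℕ (tgt e))
    orient (inj₁ l) = shape l
    orient (inj₂ l) = contradiction (link-ordered (shape l)) (ℕ.<-asym (ordered e))

  segment : Edge G → Segment
  segment e = position (src e) , position (tgt e)

  interior⇒inside : ∀ {p} e → InteriorPoint p e → InsideSegment p (segment e)
  interior⇒inside e (here on , p≢src , p≢tgt) = on⇒inside on p≢src p≢tgt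

  inside⇒interior : ∀ {p} e → InsideSegment p (segment e) → p ≢ position (src e) → p ≢ position (tgt e) → InteriorPoint p e
  inside⇒interior e (t , 0<t , t<1 , p≡) p≢src p≢tgt = here (t , <⇒≤ 0<t , <⇒≤ t<1 , p≡) , p≢src , p≢tgt

  CrossingEdges : Edge G → Edge G → Set
  CrossingEdges e f = Crossing (toℕ (src e)) (toℕ (tgt e)) (toℕ (src f)) (toℕ (tgt f))

  meet⇒crossing : ∀ {p} e f → Distinct e f → CommonInteriorPoint p e f → CrossingEdges e f
  meet⇒crossing {p} e f distinct (p∈e , p∈f)
    with shapes-disjoint (edge-shape e) (edge-shape f) (bound (tgt e)) (bound (tgt f))
           (λ eq → distinct (cong₂ _,_ (Fin.toℕ-injective (cong proj₁ eq)) (Fin.toℕ-injective (cong proj₂ eq))))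
  ... | inj₁ x = x
  ... | inj₂ disj = contradiction (interior⇒inside f p∈f) (no-common disj p (interior⇒inside e p∈e))

  crossing-nonparallel : ∀ e f → CrossingEdges e f → NonParallel (segment e) (segment f)
  crossing-nonparallel e f (b , d , x , (ab∈ , b≡) , (cd∈ , d≡)) =
    subst₂ NonParallel
      (trans (sym (rigid-seg ab∈)) (cong (seg (toℕ (src e))) (sym b≡)))
      (trans (sym (rigid-seg cd∈)) (cong (seg (toℕ (src f))) (sym d≡)))
      (nonparallel (corner (toℕ (src e))) (corner b) (corner (toℕ (src f))) (corner d) (proj₁ (All.lookup crossings-proper x)))

  drawing : Drawing G
  drawing = record
    { pos           = position
    ; bends         = λ _ _ → []
    ; pos-injective = position-injective
    -- An arc is a single segment, so the polyline that follows it has no segments to meet; only its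
    -- two ends have to differ.
    ; arc-simple    = λ e → (λ eq → ℕ.<-irrefl (cong toℕ (position-injective eq)) (ordered e)) , (λ _ _ ()) , _
    ; arc-avoids    = λ e w p∈e@(_ , w≢src , w≢tgt) → avoids {toℕ w}
        (vertex-disjoint (vertex (bound w)) (edge-shape e) (bound (tgt e))
          (λ eq → w≢src (cong place eq)) (λ eq → w≢tgt (cong place eq)))
        (interior⇒inside e p∈e)
    ; transversal   = λ e f p distinct common@(p∈e , p∈f) →
        segment e , segment f , here refl , here refl , interior⇒inside e p∈e , interior⇒inside f p∈f ,
        crossing-nonparallel e f (meet⇒crossing e f distinct common)
    }

  open Drawing drawing using (CrossAt; Cross)

  skeleton-< : ∀ {a b} → (a , b) ∈ skeleton → a ℕ.< 20 × b ℕ.< 20 × stretch a ≡ a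
  skeleton-< ab∈ with All.lookup skeleton-ordered ab∈
  ... | a<18 , _ , b<20 = ℕ.m<n⇒m<1+n (ℕ.m<n⇒m<1+n a<18) , b<20 , stretch-< (ℕ.m<n⇒m<1+n a<18)

  -- The common edge is traced back to a single skeleton edge by undoing `stretch`; the list then
  -- determines the partner.
  crossing-partner : ∀ {a b c d c′ d′} → Crossing a b c d → Crossing a b c′ d′ → (c , d) ≡ (c′ , d′)
  crossing-partner (b₁ , d₁ , x , (ab∈ , b≡) , (_ , refl)) (b₂ , d₂ , y , (ab∈′ , b≡′) , (_ , refl))
    with stretch-injective (proj₁ (proj₂ (skeleton-< ab∈))) (proj₁ (proj₂ (skeleton-< ab∈′))) (trans (sym b≡) b≡′)
  ... | refl with All.lookup (All.lookup crossing-functional x) y refl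
  ...   | refl = refl

  crossing-ends : ∀ {a b c d} → Crossing a b c d → a ≢ c × a ≢ d × b ≢ c × b ≢ d
  crossing-ends {a} {c = c} (b , d , x , (ab∈ , refl) , (cd∈ , refl))
    with All.lookup crossings-proper x | skeleton-< ab∈ | skeleton-< cd∈
  ... | _ , a≢c , a≢d , b≢c , b≢d | a<20 , b<20 , a≡ | c<20 , d<20 , c≡ =
    a≢c , (λ eq → a≢d (stretch-injective a<20 d<20 (trans a≡ eq))) ,
    (λ eq → b≢c (stretch-injective b<20 c<20 (trans eq (sym c≡)))) ,
    (λ eq → b≢d (stretch-injective b<20 d<20 eq))

  is1Plane : Is1Plane drawing
  is1Plane = record
    { crossed-once   = once
    ; adjacent-apart = apart
    }
    where
    once : ∀ e f g p q → CrossAt p e f → CrossAt q e g → p ≡ q × ends f ≡ ends g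
    once e f g p q (e≢f , p∈) (e≢g , q∈) = p≡q , f≡g
      where
      ef : CrossingEdges e f
      ef = meet⇒crossing e f e≢f p∈
      same : (toℕ (src f) , toℕ (tgt f)) ≡ (toℕ (src g) , toℕ (tgt g))
      same = crossing-partner ef (meet⇒crossing e g e≢g q∈)
      f≡g : ends f ≡ ends g
      f≡g = cong₂ _,_ (Fin.toℕ-injective (cong proj₁ same)) (Fin.toℕ-injective (cong proj₂ same))
      q∈f : InsideSegment q (segment f)
      q∈f = subst (λ (u , v) → InsideSegment q (position u , position v)) (sym f≡g) (interior⇒inside g (proj₂ q∈))
      p≡q : p ≡ q
      p≡q = crossing-unique {segment e} {segment f} (crossing-nonparallel e f ef)
        (interior⇒inside e (proj₁ p∈)) (interior⇒inside f (proj₂ p∈)) (interior⇒inside e (proj₁ q∈)) q∈f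

    apart : ∀ e f → ShareEnd e f → ¬ Cross e f
    apart e f (w , w∈e , w∈f) (p , e≢f , p∈)
      with crossing-ends (meet⇒crossing e f e≢f p∈)
    ... | a≢c , a≢d , b≢c , b≢d with w∈e | w∈f
    ...   | inj₁ refl | inj₁ eq = a≢c (cong toℕ eq)
    ...   | inj₁ refl | inj₂ eq = a≢d (cong toℕ eq)
    ...   | inj₂ refl | inj₁ eq = b≢c (cong toℕ eq)
    ...   | inj₂ refl | inj₂ eq = b≢d (cong toℕ eq)

  onePlane : OnePlaneGraph
  onePlane = record { order = 21 ℕ.+ i ; graph = G ; drawing = drawing ; is1Plane = is1Plane }

-- Sublists and exits from a vertex set

clamp : ∀ {n} → ℕ → Fin (suc n)
clamp         zero    = zero
clamp {zero}  (suc _) = zero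
clamp {suc n} (suc k) = suc (clamp k)

-- Numbers out of range are sent to the last index; the bound excludes this default.
toℕ-clamp : ∀ {n k} → k ℕ.≤ n → toℕ (clamp {n} k) ≡ k
toℕ-clamp             z≤n       = refl
toℕ-clamp {suc n} (s≤s k≤n) = cong suc (toℕ-clamp k≤n)

sublists : ∀ {A : Set} → List A → List (List A)
sublists []       = [] ∷ []
sublists (x ∷ xs) = map (x ∷_) (sublists xs) ++ sublists xs

-- Makes a statement about arbitrary spanning subgraphs finite: whatever such a subgraph keeps of
-- the ten `bonds` is one of their 1024 sublists.
filter∈sublists : ∀ {A : Set} {P : A → Set} (P? : Unary.Decidable P) xs → filter P? xs ∈ sublists xs
filter∈sublists P? [] = here refl
filter∈sublists P? (x ∷ xs) with does (P? x)
... | true  = ∈-++⁺ˡ (∈-map⁺ (x ∷_) (filter∈sublists P? xs))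
... | false = ∈-++⁺ʳ (map (x ∷_) (sublists xs)) (filter∈sublists P? xs)

distinct-members : ∀ {A : Set} {x y : A} {xs} → x ∈ xs → y ∈ xs → x ≢ y → ¬ length xs ℕ.≤ 1
distinct-members {xs = _ ∷ []} (here refl) (here refl) x≢y _ = x≢y refl
distinct-members {xs = _ ∷ _ ∷ _} _ _ _ (s≤s ())

module _ {A : Set} {R : A → A → Set} (side : A → Bool) where

  Exit : A → A → List A → Set
  Exit u v xs = ∃ λ x → ∃ λ y → (side x ≡ true × side y ≡ false) × R x y × x ∈ u ∷ xs × y ∈ xs ∷ʳ v

  -- The first step out of the set is taken. The two memberships are recorded so that exits of
  -- disjoint paths through the same edge can be compared.
  exit : ∀ {u v} xs → side u ≡ true → side v ≡ false → Linked R (u ∷ (xs ∷ʳ v)) → Exit u v xs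
  exit [] u-in v-out (r ∷ _) = _ , _ , (u-in , v-out) , r , here refl , here refl
  exit {u} {v} (x ∷ xs) u-in v-out (r ∷ rs) with side x in eq
  ... | false = u , x , (u-in , eq) , r , here refl , here refl
  ... | true  with y , z , sides , yz , y∈ , z∈ ← exit xs eq v-out rs = y , z , sides , yz , there y∈ , there z∈

module _ {n} (F : Graph n) (side : Fin n → Bool) where

  open Graph F using (_~_)

  private
    ∈-∷ʳ⁻ : ∀ {x v : Fin n} xs → x ∈ xs ∷ʳ v → x ∈ xs ⊎ x ≡ v
    ∈-∷ʳ⁻ [] (here eq) = inj₂ eq
    ∈-∷ʳ⁻ (y ∷ xs) (here eq) = inj₁ (here eq)
    ∈-∷ʳ⁻ (y ∷ xs) (there x∈) = Sum.map₁ there (∈-∷ʳ⁻ xs x∈)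

  TwoExits : Set
  TwoExits = ∃ λ x → ∃ λ y → ∃ λ x′ → ∃ λ y′ →
    ((side x ≡ true × side y ≡ false) × x ~ y) × ((side x′ ≡ true × side y′ ≡ false) × x′ ~ y′) × (x , y) ≢ (x′ , y′)

  -- If two internally disjoint paths left through the same edge, its start would be common to both
  -- paths and hence be `u`, and its end likewise `v`. For nonadjacent `u` and `v` there is no such
  -- edge.
  two-exits : ∀ {u v} → KConnected 2 F → side u ≡ true → side v ≡ false → ¬ u ~ v → TwoExits
  two-exits {u} {v} (_ , connected) u-in v-out u≁v
    with connected u v (λ {refl → contradiction (trans (sym u-in) v-out) λ ()})
  ... | _ ∷ [] , _ , _ , s≤s ()
  ... | xs ∷ ys ∷ _ , (_ , lx) ∷ (_ , ly) ∷ _ , ((_ , disjoint) ∷ _) ∷ _ , _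
    with x , y , sides , xy , x∈ , y∈ ← exit side xs u-in v-out lx
       | x′ , y′ , sides′ , xy′ , x′∈ , y′∈ ← exit side ys u-in v-out ly =
    x , y , x′ , y′ , (sides , xy) , (sides′ , xy′) , λ {refl → u≁v (subst₂ _~_ (start x∈ x′∈) (end y∈ y′∈) xy)}
    where
    start : ∀ {x} → x ∈ u ∷ xs → x ∈ u ∷ ys → x ≡ u
    start (here eq)  _          = eq
    start (there _)  (here eq)  = eq
    start (there x∈) (there x∈′) = contradiction (x∈ , x∈′) disjoint
    end : ∀ {y} → y ∈ xs ∷ʳ v → y ∈ ys ∷ʳ v → y ≡ v
    end y∈ y∈′ with ∈-∷ʳ⁻ xs y∈ | ∈-∷ʳ⁻ ys y∈′
    ... | inj₂ eq | _       = eq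
    ... | inj₁ _  | inj₂ eq = eq
    ... | inj₁ y∈ | inj₁ y∈′ = contradiction (y∈ , y∈′) disjoint

-- The five parts and their cuts

-- The five parts: the quadrilateral 0, 1, 18, 19 with its inside, and the
-- four copies of K₄.
part : ℕ → ℕ
part 0 = 0
part 1 = 0
part 2 = 1
part 3 = 1
part 4 = 1
part 5 = 1
part 6 = 2
part 7 = 2
part 8 = 2
part 9 = 2
part 10 = 3
part 11 = 3
part 12 = 3
part 13 = 3
part 14 = 4
part 15 = 4
part 16 = 4
part 17 = 4
part _ = 0

bonds : List (ℕ × ℕ)
bonds = take 10 skeleton

bondCrossings : List ((ℕ × ℕ) × (ℕ × ℕ))
bondCrossings = take 5 crossingPairs

inParts : List ℕ → ℕ → Bool
inParts ps v = does (part v ∈ₙ? ps)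

Leaves : List ℕ → ℕ × ℕ → Set
Leaves ps (c , d) = inParts ps c ≢ inParts ps d

leaves? : ∀ ps e → Dec (Leaves ps e)
leaves? ps (c , d) = ¬? (inParts ps c Bool.≟ inParts ps d)

-- Unions of parts, each with a vertex inside and a vertex outside that are
-- not adjacent.
cuts : List (List ℕ × ℕ × ℕ)
cuts = ((0 ∷ []) , 0 , 6) ∷ ((1 ∷ []) , 2 , 6) ∷ ((2 ∷ []) , 6 , 2) ∷ ((3 ∷ []) , 10 , 2) ∷
       ((4 ∷ []) , 14 , 2) ∷ ((2 ∷ 3 ∷ []) , 6 , 2) ∷ ((2 ∷ 4 ∷ []) , 6 , 2) ∷ []

Blocked : List (ℕ × ℕ) → Set
Blocked es = Any (λ (e , f) → e ∈ es × f ∈ es) bondCrossings ⊎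
             Any (λ (ps , _) → length (filter (leaves? ps) es) ℕ.≤ 1) cuts

abstract

  -- If every single part keeps two edges, one edge of each pair is kept. The degree conditions then
  -- leave two patterns, up to the choice between the two edges joining parts 0 and 1: the triangle
  -- 0, 1, 3 with a double edge between 2 and 4, and the triangle 0, 1, 4 with a double edge between
  -- 2 and 3. No edge leaves the double edge, which is why {2, 4} and {2, 3} are the only larger
  -- cuts needed.
  all-blocked : All Blocked (sublists bonds)
  all-blocked = from-yes (all? (λ es →
    any? (λ (e , f) → (e ∈ₑ? es) ×-dec (f ∈ₑ? es)) bondCrossings ⊎-dec
    any? (λ (ps , _) → length (filter (leaves? ps) es) ℕ.≤? 1) cuts) (sublists bonds))

  cuts-valid : All (λ (ps , u , v) → (inParts ps u ≡ true × inParts ps v ≡ false) × (u ℕ.< 18 × v ℕ.< 18) ×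
                                     ((u , v) ∉ skeleton × (v , u) ∉ skeleton)) cuts
  cuts-valid = from-yes (all? (λ (ps , u , v) →
    ((inParts ps u Bool.≟ true) ×-dec (inParts ps v Bool.≟ false)) ×-dec ((u ℕ.<? 18) ×-dec (v ℕ.<? 18)) ×-dec
    (¬? ((u , v) ∈ₑ? skeleton) ×-dec ¬? ((v , u) ∈ₑ? skeleton))) cuts)

  bonds-between-parts : All (λ (c , d) → part c ≡ part d ⊎ (c , d) ∈ bonds) skeleton
  bonds-between-parts = from-yes (all? (λ (c , d) → (part c ℕ.≟ part d) ⊎-dec ((c , d) ∈ₑ? bonds)) skeleton)

  bonds⊆skeleton : All (_∈ skeleton) bonds
  bonds⊆skeleton = from-yes (all? (_∈ₑ? skeleton) bonds)

  bondCrossings-distinct : All (λ (e , f) → e ≢ f) bondCrossings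
  bondCrossings-distinct = from-yes (all? (λ (e , f) → ¬? (e ≟ₑ f)) bondCrossings)

skeletonSegment : ℕ × ℕ → Segment
skeletonSegment (a , b) = embed (corner a) , embed (corner b)

_≟ₚ_ : (p q : Point) → Dec (p ≡ q)
_≟ₚ_ = ≡-dec ℚ._≟_ ℚ._≟_

Avoids : Point → ℕ × ℕ → Set
Avoids p (a , b) = p ≢ embed (corner a) × p ≢ embed (corner b)

Meets : ℕ × ℕ → ℕ × ℕ → ℚ → ℚ → Set
Meets e f t u = ((0ℚ ℚ.< t × t ℚ.< 1ℚ) × (0ℚ ℚ.< u × u ℚ.< 1ℚ)) × p ≡ along (skeletonSegment f) u × Avoids p e × Avoids p f
  where p = along (skeletonSegment e) t

meets? : ∀ e f t u → Dec (Meets e f t u)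
meets? e@(a , b) f@(c , d) t u =
  (((0ℚ ℚ.<? t) ×-dec (t ℚ.<? 1ℚ)) ×-dec ((0ℚ ℚ.<? u) ×-dec (u ℚ.<? 1ℚ))) ×-dec
  (p ≟ₚ along (skeletonSegment f) u) ×-dec
  (¬? (p ≟ₚ embed (corner a)) ×-dec ¬? (p ≟ₚ embed (corner b))) ×-dec
  (¬? (p ≟ₚ embed (corner c)) ×-dec ¬? (p ≟ₚ embed (corner d)))
  where p = along (skeletonSegment e) t

record Meet (ef : (ℕ × ℕ) × (ℕ × ℕ)) : Set where
  constructor meetAt
  field
    t u  : ℚ
    meets : True (meets? (proj₁ ef) (proj₂ ef) t u)

-- The converse of the bound on crossings: these pairs really cross, which is needed to contradict
-- planeness. The parameters solve the linear systems of the five pairs of lines, and `True` lets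
-- evaluation confirm them.
bonds-meet : All Meet bondCrossings
bonds-meet = meetAt (+ 19 / 77) (+ 37 / 77) _ ∷ meetAt (+ 17 / 41) (+ 27 / 41) _ ∷ meetAt (+ 7 / 24) (+ 3 / 8) _ ∷
             meetAt (+ 77 / 100) (+ 11 / 25) _ ∷ meetAt (+ 53 / 92) (+ 3 / 46) _ ∷ []

-- No spanning plane subgraph is 2-connected

module NoPlane (i : ℕ) where

  open Geometry i
  open Family i
  open Edge

  vert : ℕ → Fin (21 ℕ.+ i)
  vert = clamp

  vert-toℕ : ∀ u → vert (toℕ u) ≡ u
  vert-toℕ u = Fin.toℕ-injective (toℕ-clamp (bound u))

  stretch-≤ : ∀ {v} → v ℕ.< 20 → stretch v ℕ.≤ 20 ℕ.+ i
  stretch-≤ {v} v<20 = below (v ℕ.<? 19)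
    where
    below : Dec (v ℕ.< 19) → stretch v ℕ.≤ 20 ℕ.+ i
    below (yes v<19) = subst (ℕ._≤ 20 ℕ.+ i) (sym (stretch-< v<19)) (ℕ.≤-trans (ℕ.<⇒≤ v<20) (ℕ.m≤m+n 20 i))
    below (no v≮19)  = ℕ.≤-reflexive (stretch-≥ v≮19)

  toℕ-vert : ∀ {v} → v ℕ.< 18 → toℕ (vert v) ≡ v
  toℕ-vert v<18 = toℕ-clamp (ℕ.≤-trans (ℕ.<⇒≤ v<18) (ℕ.m≤m+n 18 (2 ℕ.+ i)))

  toℕ-stretch : ∀ {v} → v ℕ.< 20 → toℕ (vert (stretch v)) ≡ stretch v
  toℕ-stretch v<20 = toℕ-clamp (stretch-≤ v<20)

  skeletonEdge : ∀ {e} → e ∈ skeleton → Edge G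
  skeletonEdge {c , d} cd∈ = record
    { src      = vert c
    ; tgt      = vert (stretch d)
    ; ordered  = subst₂ ℕ._<_ (sym c≡) (sym d≡) (link-ordered (rigid cd∈))
    ; adjacent = inj₁ (subst₂ Link (sym c≡) (sym d≡)
        (inj₁ (Any.map (λ {refl → refl , refl}) cd∈)))
    }
    where
    c≡ = toℕ-vert (proj₁ (All.lookup skeleton-ordered cd∈))
    d≡ = toℕ-stretch (proj₂ (proj₂ (All.lookup skeleton-ordered cd∈)))

  skeletonEdge-segment : ∀ {e} (e∈ : e ∈ skeleton) → segment (skeletonEdge e∈) ≡ skeletonSegment e
  skeletonEdge-segment {c , d} cd∈ =
    trans (cong₂ seg (toℕ-vert (proj₁ (All.lookup skeleton-ordered cd∈)))
                     (toℕ-stretch (proj₂ (proj₂ (All.lookup skeleton-ordered cd∈)))))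
          (rigid-seg cd∈)

  skeletonEdge-injective : ∀ {e f} (e∈ : e ∈ skeleton) (f∈ : f ∈ skeleton) →
                           ends (skeletonEdge e∈) ≡ ends (skeletonEdge f∈) → e ≡ f
  skeletonEdge-injective {a , b} {c , d} ab∈ cd∈ eq with All.lookup skeleton-ordered ab∈ | All.lookup skeleton-ordered cd∈
  ... | a<18 , _ , b<20 | c<18 , _ , d<20 = cong₂ _,_
    (trans (sym (toℕ-vert a<18)) (trans (cong (toℕ ∘ proj₁) eq) (toℕ-vert c<18)))
    (stretch-injective b<20 d<20 (trans (sym (toℕ-stretch b<20)) (trans (cong (toℕ ∘ proj₂) eq) (toℕ-stretch d<20))))

  open Drawing drawing using (Cross)
  open Arcs G position (λ _ _ → []) using (InteriorPoint)

  inner : ∀ {e p} (e∈ : e ∈ skeleton) → InsideSegment p (skeletonSegment e) → Avoids p e → InteriorPoint p (skeletonEdge e∈)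
  inner {e} {p} e∈ p-inside (p≢src , p≢tgt) = inside⇒interior (skeletonEdge e∈)
    (subst (InsideSegment p) (sym eq) p-inside)
    (λ p≡ → p≢src (trans p≡ (cong proj₁ eq))) (λ p≡ → p≢tgt (trans p≡ (cong proj₂ eq)))
    where eq = skeletonEdge-segment e∈

  meet⇒cross : ∀ {e f} (e∈ : e ∈ skeleton) (f∈ : f ∈ skeleton) → e ≢ f → Meet (e , f) → Cross (skeletonEdge e∈) (skeletonEdge f∈)
  meet⇒cross {e} {f} e∈ f∈ e≢f (meetAt t u m)
    with ((0<t , t<1) , (0<u , u<1)) , p≡ , avoids-e , avoids-f ← toWitness m =
    along (skeletonSegment e) t , (λ eq → e≢f (skeletonEdge-injective e∈ f∈ eq)) ,
    inner e∈ (t , 0<t , t<1 , refl) avoids-e , inner f∈ (u , 0<u , u<1 , p≡) avoids-f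

  part-stretch : ∀ {v} → v ℕ.< 20 → part (stretch v) ≡ part v
  part-stretch v<20 with <20-cases v<20
  ... | inj₁ v<18 = cong part (stretch-< (ℕ.m<n⇒m<1+n v<18))
  ... | inj₂ (inj₁ refl) = refl
  ... | inj₂ (inj₂ refl) = refl

  link-bond : ∀ {a b} → Shape a b → part a ≢ part b → ∃ λ d → (a , d) ∈ bonds × b ≡ stretch d
  link-bond (rigid {c} {d} cd∈) neq with All.lookup bonds-between-parts cd∈
  ... | inj₁ eq = contradiction (trans eq (sym (part-stretch (proj₂ (proj₂ (All.lookup skeleton-ordered cd∈)))))) neq
  ... | inj₂ cd∈′ = d , cd∈′ , refl
  link-bond (spoke z≤n _) neq = contradiction refl neq
  link-bond (spoke (s≤s z≤n) _) neq = contradiction refl neq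
  link-bond (step ℓ) neq = contradiction refl neq

  module _ (F : Graph (21 ℕ.+ i)) (spanning : IsSpanningPlaneSubgraph onePlane F) (connected : KConnected 2 F) where

    open Graph F using () renaming (_~_ to _~F_; _~?_ to _~F?_; sym to F-sym)
    open IsSpanningPlaneSubgraph spanning using (subgraph; plane)

    Kept : ℕ × ℕ → Set
    Kept (c , d) = vert c ~F vert (stretch d)

    kept? : Unary.Decidable Kept
    kept? (c , d) = vert c ~F? vert (stretch d)

    kept : List (ℕ × ℕ)
    kept = filter kept? bonds

    module _ (ps : List ℕ) where

      inside : Fin (21 ℕ.+ i) → Bool
      inside u = inParts ps (toℕ u)

      -- Bonds are listed from the smaller end, while an exit may run along its bond in either
      -- direction.
      record ExitBond (x y : Fin (21 ℕ.+ i)) : Set where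
        constructor exitBond
        field
          bond    : ℕ × ℕ
          bond∈   : bond ∈ filter (leaves? ps) kept
          orient  : (toℕ x ≡ proj₁ bond × toℕ y ≡ stretch (proj₂ bond)) ⊎
                    (toℕ y ≡ proj₁ bond × toℕ x ≡ stretch (proj₂ bond))

      member : ∀ {c d} → (c , d) ∈ bonds → Kept (c , d) → inParts ps c ≢ inParts ps (stretch d) →
               (c , d) ∈ filter (leaves? ps) kept
      member {c} {d} cd∈ k neq = ∈-filter⁺ (leaves? ps) (∈-filter⁺ kept? cd∈ k)
        (λ eq → neq (trans eq (cong (λ p → does (p ∈ₙ? ps))
          (sym (part-stretch (proj₂ (proj₂ (All.lookup skeleton-ordered (All.lookup bonds⊆skeleton cd∈)))))))))

      exit-bond : ∀ {x y} → inside x ≡ true → inside y ≡ false → x ~F y → ExitBond x y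
      exit-bond {x} {y} x-in y-out x~y with subgraph x~y
      ... | inj₁ l with d , cd∈ , y≡ ← link-bond (shape l) (λ eq →
        Bool.not-¬ refl (trans (sym x-in) (trans (cong (λ p → does (p ∈ₙ? ps)) eq) y-out))) =
        exitBond (toℕ x , d)
          (member cd∈ (subst₂ _~F_ (sym (vert-toℕ x)) (trans (sym (vert-toℕ y)) (cong vert y≡)) x~y)
            (λ eq → Bool.not-¬ refl (trans (sym x-in) (trans eq (trans (cong (inParts ps) (sym y≡)) y-out)))))
          (inj₁ (refl , y≡))
      ... | inj₂ l with d , cd∈ , x≡ ← link-bond (shape l) (λ eq →
        Bool.not-¬ refl (trans (sym x-in) (trans (cong (λ p → does (p ∈ₙ? ps)) (sym eq)) y-out))) =
        exitBond (toℕ y , d)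
          (member cd∈ (subst₂ _~F_ (sym (vert-toℕ y)) (trans (sym (vert-toℕ x)) (cong vert x≡)) (F-sym x~y))
            (λ eq → Bool.not-¬ refl (trans (sym x-in) (trans (cong (inParts ps) x≡) (trans (sym eq) y-out)))))
          (inj₂ (refl , x≡))

      -- Two exits along one bond in the same direction coincide; in opposite directions they would
      -- put one vertex both inside and outside.
      exit-bonds-distinct : ∀ {x y x′ y′} → inside x ≡ true → inside y ≡ false → inside x′ ≡ true → inside y′ ≡ false →
                            (x , y) ≢ (x′ , y′) → (e : ExitBond x y) (e′ : ExitBond x′ y′) →
                            ExitBond.bond e ≢ ExitBond.bond e′
      exit-bonds-distinct x-in y-out x′-in y′-out neq (exitBond _ _ o) (exitBond _ _ o′) refl with o | o′
      ... | inj₁ (x≡ , y≡) | inj₁ (x′≡ , y′≡) =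
        neq (cong₂ _,_ (Fin.toℕ-injective (trans x≡ (sym x′≡))) (Fin.toℕ-injective (trans y≡ (sym y′≡))))
      ... | inj₂ (y≡ , x≡) | inj₂ (y′≡ , x′≡) =
        neq (cong₂ _,_ (Fin.toℕ-injective (trans x≡ (sym x′≡))) (Fin.toℕ-injective (trans y≡ (sym y′≡))))
      ... | inj₁ (x≡ , y≡) | inj₂ (y′≡ , x′≡) =
        Bool.not-¬ refl (trans (sym x-in) (trans (cong (inParts ps) (trans x≡ (sym y′≡))) y′-out))
      ... | inj₂ (y≡ , x≡) | inj₁ (x′≡ , y′≡) =
        Bool.not-¬ refl (trans (sym x′-in) (trans (cong (inParts ps) (trans x′≡ (sym y≡))) y-out))

    -- Spokes and steps have an end at 18 or beyond, and below 18 `stretch` is the identity, so a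
    -- link could only be a skeleton edge.
    nonadjacent : ∀ {u v} → u ℕ.< 18 → v ℕ.< 18 → (u , v) ∉ skeleton → ¬ Link u v
    nonadjacent {u} {v} u<18 v<18 uv∉ l = go (shape l) refl refl
      where
      go : ∀ {a b} → Shape a b → a ≡ u → b ≡ v → ⊥
      go (rigid {c} {d} cd∈) refl eq = uv∉ (subst (λ d → (c , d) ∈ skeleton)
        (stretch-injective (proj₂ (proj₂ (All.lookup skeleton-ordered cd∈))) (ℕ.m<n⇒m<1+n (ℕ.m<n⇒m<1+n v<18))
          (trans eq (sym (stretch-< (ℕ.m<n⇒m<1+n v<18))))) cd∈)
      go (spoke {ℓ = ℓ} _ _) _ refl = ℕ.m+n≮m 18 (suc ℓ) v<18
      go (step ℓ) refl _ = ℕ.m+n≮m 18 ℓ u<18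

    -- The two exits forced by 2-connectedness run along two different kept bonds.
    cut-kept : ∀ {ps u v} → (ps , u , v) ∈ cuts → ¬ length (filter (leaves? ps) kept) ℕ.≤ 1
    cut-kept {ps} {u} {v} cut∈
      with (u-in , v-out) , (u<18 , v<18) , (uv∉ , vu∉) ← All.lookup cuts-valid cut∈
      with x , y , x′ , y′ , ((x-in , y-out) , x~y) , ((x′-in , y′-out) , x′~y′) , neq ←
        two-exits F (inside ps) {vert u} {vert v} connected
          (trans (cong (inParts ps) (toℕ-vert u<18)) u-in) (trans (cong (inParts ps) (toℕ-vert v<18)) v-out)
          (λ u~v → Sum.[ (λ l → nonadjacent u<18 v<18 uv∉ (subst₂ Link (toℕ-vert u<18) (toℕ-vert v<18) l))
                       , (λ l → nonadjacent v<18 u<18 vu∉ (subst₂ Link (toℕ-vert v<18) (toℕ-vert u<18) l)) ] (subgraph u~v)) =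
      distinct-members (ExitBond.bond∈ e) (ExitBond.bond∈ e′) (exit-bonds-distinct ps x-in y-out x′-in y′-out neq e e′)
      where
      e  = exit-bond ps x-in y-out x~y
      e′ = exit-bond ps x′-in y′-out x′~y′

    crossing-kept : ∀ {e f} → (e , f) ∈ bondCrossings → ¬ (e ∈ kept × f ∈ kept)
    crossing-kept {e} {f} x (e∈ , f∈) = plane (skeletonEdge e∈′) (skeletonEdge f∈′)
      (proj₂ (∈-filter⁻ kept? e∈)) (proj₂ (∈-filter⁻ kept? f∈))
      (meet⇒cross e∈′ f∈′ (All.lookup bondCrossings-distinct x) (All.lookup bonds-meet x))
      where
      e∈′ = All.lookup bonds⊆skeleton (proj₁ (∈-filter⁻ kept? {xs = bonds} e∈))
      f∈′ = All.lookup bonds⊆skeleton (proj₁ (∈-filter⁻ kept? {xs = bonds} f∈))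

    not-2-connected : ⊥
    not-2-connected with All.lookup all-blocked (filter∈sublists kept? bonds)
    ... | inj₁ both with _ , x , b ← find both = crossing-kept x b
    ... | inj₂ few  with _ , c , l ← find few  = cut-kept c l

-- Path systems and their transport

-- Paths and systems of paths in the sense of Defs, for an arbitrary relation.
record Path {A : Set} (R : Rel A 0ℓ) (u v : A) (xs : List A) : Set where
  constructor path
  field
    unique : Unique (u ∷ (xs ∷ʳ v))
    linked : Linked R (u ∷ (xs ∷ʳ v))

Internally : ∀ {A : Set} → Rel (List A) 0ℓ
Internally xs ys = xs ≢ ys × Disjoint xs ys

record FourPaths {A : Set} (R : Rel A 0ℓ) (u v : A) : Set where
  constructor fourPaths
  field
    {paths}  : List (List A)
    valid    : All (Path R u v) paths
    disjoint : AllPairs Internally paths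
    four     : 4 ℕ.≤ length paths

module _ {A : Set} {R : Rel A 0ℓ} (R-sym : Symmetric R) where

  linked-reverse : ∀ {xs} → Linked R xs → Linked R (reverse xs)
  linked-reverse [] = []
  linked-reverse [-] = [-]
  linked-reverse {x ∷ y ∷ xs} (r ∷ rs) =
    subst (Linked R) (sym (trans (List.unfold-reverse x (y ∷ xs)) (cong (_∷ʳ x) (List.unfold-reverse y xs))))
      (snoc (reverse xs) (subst (Linked R) (List.unfold-reverse y xs) (linked-reverse rs)))
    where
    snoc : ∀ ys → Linked R (ys ∷ʳ y) → Linked R ((ys ∷ʳ y) ∷ʳ x)
    snoc []           _        = R-sym r ∷ [-]
    snoc (_ ∷ [])     (s ∷ ss) = s ∷ snoc [] ss
    snoc (_ ∷ z ∷ ys) (s ∷ ss) = s ∷ snoc (z ∷ ys) ss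

  reverse-ends : ∀ (u v : A) xs → reverse (u ∷ (xs ∷ʳ v)) ≡ v ∷ (reverse xs ∷ʳ u)
  reverse-ends u v xs = trans (List.unfold-reverse u (xs ∷ʳ v)) (cong (_∷ʳ u) (List.reverse-++ xs (v ∷ [])))

  path-reverse : ∀ {u v xs} → Path R u v xs → Path R v u (reverse xs)
  path-reverse {u} {v} {xs} (path unique linked) = path
    (subst Unique (reverse-ends u v xs)
      (AllPairs-resp-↭ (setoid A) ≢-sym ((λ {refl p → p}) , (λ {refl p → p})) (↭⇒↭ₛ (↭-sym (↭-reverse _))) unique))
    (subst (Linked R) (reverse-ends u v xs) (linked-reverse linked))

  fourPaths-sym : ∀ {u v} → FourPaths R u v → FourPaths R v u
  fourPaths-sym (fourPaths {ps} valid disjoint four) = fourPaths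
    (All.map⁺ (All.map path-reverse valid))
    (AllPairs.map⁺ (AllPairs.map reversed disjoint))
    (subst (4 ℕ.≤_) (sym (List.length-map reverse ps)) four)
    where
    reversed : ∀ {xs ys} → Internally xs ys → Internally (reverse xs) (reverse ys)
    reversed (xs≢ys , disj) = (λ eq → xs≢ys (List.reverse-injective eq)) , λ {(x∈ , y∈) → disj (reverse⁻ x∈ , reverse⁻ y∈)}

module _ {A B : Set} {R : Rel A 0ℓ} {S : Rel B 0ℓ} (f : A → B) (D : A → Set)
         (R⇒D : ∀ {a b} → R a b → D a × D b) (hom : ∀ {a b} → R a b → S (f a) (f b))
         (inj : ∀ {a b} → D a → D b → f a ≡ f b → a ≡ b) where

  linked⇒All : ∀ {u v} xs → Linked R (u ∷ (xs ∷ʳ v)) → All D (u ∷ (xs ∷ʳ v))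
  linked⇒All [] (r ∷ [-]) = proj₁ (R⇒D r) ∷ proj₂ (R⇒D r) ∷ []
  linked⇒All (x ∷ xs) (r ∷ rs) = proj₁ (R⇒D r) ∷ linked⇒All xs rs

  unique-map : ∀ {xs} → All D xs → Unique xs → Unique (map f xs)
  unique-map []       []       = []
  unique-map (d ∷ ds) (p ∷ ps) = All.map⁺ (All.zipWith (λ (x≢y , dy) eq → x≢y (inj d dy eq)) (p , ds)) ∷ unique-map ds ps

  path-map : ∀ {u v xs} → Path R u v xs → Path S (f u) (f v) (map f xs)
  path-map {u} {v} {xs} (path unique linked) = path
    (subst Unique ends (unique-map (linked⇒All xs linked) unique))
    (subst (Linked S) ends (Linked.map⁺ (Linked.map hom linked)))
    where
    ends : map f (u ∷ (xs ∷ʳ v)) ≡ f u ∷ (map f xs ∷ʳ f v)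
    ends = cong (f u ∷_) (List.map-++ f xs (v ∷ []))

  inner-D : ∀ {u v xs} → Path R u v xs → All D xs
  inner-D {xs = xs} (path _ linked) = proj₁ (All.∷ʳ⁻ (All.tail (linked⇒All xs linked)))

  map-injective : ∀ {xs ys} → All D xs → All D ys → map f xs ≡ map f ys → xs ≡ ys
  map-injective []       []       eq = refl
  map-injective (d ∷ ds) (e ∷ es) eq =
    cong₂ _∷_ (inj d e (List.∷-injectiveˡ eq)) (map-injective ds es (List.∷-injectiveʳ eq))

  internally-map : ∀ {xs ys} → All D xs → All D ys → Internally xs ys → Internally (map f xs) (map f ys)
  internally-map {xs} {ys} ds es (xs≢ys , disjoint) = (λ eq → xs≢ys (map-injective ds es eq)) , apart
    where
    apart : Disjoint (map f xs) (map f ys)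
    apart (z∈ , z∈′) with x , x∈ , refl ← ∈-map⁻ f z∈ | y , y∈ , eq ← ∈-map⁻ f z∈′ =
      disjoint (x∈ , subst (_∈ ys) (sym (inj (All.lookup ds x∈) (All.lookup es y∈) eq)) y∈)

  -- Injectivity is asked on `D` only, which contains every vertex of a path because it contains
  -- both ends of every link. The maps to be used, `place′` and `clamp`, are injective only on the
  -- range of actual vertices.
  fourPaths-map : ∀ {u v} → FourPaths R u v → FourPaths S (f u) (f v)
  fourPaths-map (fourPaths {ps} valid disjoint four) = fourPaths
    (All.map⁺ (All.map path-map valid))
    (pairs (All.map inner-D valid) disjoint)
    (subst (4 ℕ.≤_) (sym (List.length-map (map f) ps)) four)
    where
    pairs : ∀ {ps} → All (All D) ps → AllPairs Internally ps → AllPairs Internally (map (map f) ps)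
    pairs []       []       = []
    pairs (d ∷ ds) (p ∷ ps) = All.map⁺ (All.zipWith (λ (q , e) → internally-map d e q) (p , ds)) ∷ pairs ds ps

module _ {A : Set} {R : Rel A 0ℓ} (f : ℕ → A) where

  -- The continuation is given as a walk from `f 0`, so that a stretch of the axis of any length can
  -- be glued in front of it.
  linked-down : ∀ k {ys} → (∀ j → j ℕ.< k → R (f (suc j)) (f j)) → Linked R (f 0 ∷ ys) → Linked R (applyDownFrom f (suc k) ++ ys)
  linked-down zero    _    l = l
  linked-down (suc k) step l = step k (ℕ.s≤s ℕ.≤-refl) ∷ linked-down k (λ j j<k → step j (ℕ.m≤n⇒m≤1+n j<k)) l

linked-up : ∀ {A : Set} {R : Rel A 0ℓ} (f : ℕ → A) k {ys} → (∀ j → j ℕ.< k → R (f j) (f (suc j))) →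
            Linked R (f k ∷ ys) → Linked R (applyUpTo f (suc k) ++ ys)
linked-up f zero    _    l = l
linked-up f (suc k) step l = step 0 ℕ.z<s ∷ linked-up (f ∘ suc) k (λ j j<k → step (suc j) (ℕ.s<s j<k)) l

-- A nonempty list is not disjoint from itself, so equality is possible only for two empty lists.
disjoint⇒internally : ∀ {A : Set} {xs ys : List A} → Disjoint xs ys → ¬ (xs ≡ [] × ys ≡ []) → Internally xs ys
disjoint⇒internally {xs = xs} {ys} disjoint nonempty = (λ {refl → nonempty (empty xs disjoint , empty xs disjoint)}) , disjoint
  where
  empty : ∀ xs → Disjoint xs xs → xs ≡ []
  empty []       _ = refl
  empty (x ∷ xs) d = contradiction (here refl , here refl) d

-- Tables of path systems

PathSystem : Set
PathSystem = ℕ × ℕ × List (List ℕ)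

-- The path systems below were found by computing maximum flows.
coreTable : List PathSystem
coreTable =
  (0 , 1 , (18 ∷ []) ∷ (19 ∷ []) ∷ (20 ∷ []) ∷ (2 ∷ 4 ∷ 11 ∷ 13 ∷ []) ∷ []) ∷
  (0 , 2 , [] ∷ (19 ∷ 5 ∷ []) ∷ (18 ∷ 14 ∷ 16 ∷ 3 ∷ []) ∷ (20 ∷ 1 ∷ 13 ∷ 11 ∷ 4 ∷ []) ∷ []) ∷
  (0 , 3 , (2 ∷ []) ∷ (19 ∷ 5 ∷ []) ∷ (18 ∷ 14 ∷ 16 ∷ []) ∷ (20 ∷ 1 ∷ 13 ∷ 11 ∷ 4 ∷ []) ∷ []) ∷
  (0 , 4 , (2 ∷ []) ∷ (19 ∷ 5 ∷ []) ∷ (18 ∷ 14 ∷ 16 ∷ 3 ∷ []) ∷ (20 ∷ 1 ∷ 13 ∷ 11 ∷ []) ∷ []) ∷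
  (0 , 5 , (2 ∷ []) ∷ (19 ∷ []) ∷ (18 ∷ 14 ∷ 16 ∷ 3 ∷ []) ∷ (20 ∷ 1 ∷ 13 ∷ 11 ∷ 4 ∷ []) ∷ []) ∷
  (0 , 6 , (18 ∷ 14 ∷ 15 ∷ []) ∷ (2 ∷ 4 ∷ 11 ∷ 12 ∷ 9 ∷ []) ∷ (20 ∷ 1 ∷ 13 ∷ 10 ∷ 7 ∷ []) ∷ (19 ∷ 5 ∷ 3 ∷ 16 ∷ 17 ∷ 8 ∷ []) ∷ []) ∷
  (0 , 7 , (2 ∷ 4 ∷ 11 ∷ 10 ∷ []) ∷ (18 ∷ 14 ∷ 17 ∷ 8 ∷ []) ∷ (20 ∷ 1 ∷ 13 ∷ 12 ∷ 9 ∷ []) ∷ (19 ∷ 5 ∷ 3 ∷ 16 ∷ 15 ∷ 6 ∷ []) ∷ []) ∷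
  (0 , 8 , (18 ∷ 14 ∷ 17 ∷ []) ∷ (2 ∷ 4 ∷ 11 ∷ 12 ∷ 9 ∷ []) ∷ (20 ∷ 1 ∷ 13 ∷ 10 ∷ 7 ∷ []) ∷ (19 ∷ 5 ∷ 3 ∷ 16 ∷ 15 ∷ 6 ∷ []) ∷ []) ∷
  (0 , 9 , (2 ∷ 4 ∷ 11 ∷ 12 ∷ []) ∷ (18 ∷ 14 ∷ 17 ∷ 8 ∷ []) ∷ (20 ∷ 1 ∷ 13 ∷ 10 ∷ 7 ∷ []) ∷ (19 ∷ 5 ∷ 3 ∷ 16 ∷ 15 ∷ 6 ∷ []) ∷ []) ∷
  (0 , 10 , (2 ∷ 4 ∷ 11 ∷ []) ∷ (20 ∷ 1 ∷ 13 ∷ []) ∷ (18 ∷ 14 ∷ 17 ∷ 8 ∷ 7 ∷ []) ∷ (19 ∷ 5 ∷ 3 ∷ 16 ∷ 15 ∷ 6 ∷ 9 ∷ 12 ∷ []) ∷ []) ∷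
  (0 , 11 , (2 ∷ 4 ∷ []) ∷ (20 ∷ 1 ∷ 13 ∷ []) ∷ (18 ∷ 14 ∷ 17 ∷ 8 ∷ 9 ∷ 12 ∷ []) ∷ (19 ∷ 5 ∷ 3 ∷ 16 ∷ 15 ∷ 6 ∷ 7 ∷ 10 ∷ []) ∷ []) ∷
  (0 , 12 , (2 ∷ 4 ∷ 11 ∷ []) ∷ (20 ∷ 1 ∷ 13 ∷ []) ∷ (18 ∷ 14 ∷ 17 ∷ 8 ∷ 9 ∷ []) ∷ (19 ∷ 5 ∷ 3 ∷ 16 ∷ 15 ∷ 6 ∷ 7 ∷ 10 ∷ []) ∷ []) ∷
  (0 , 13 , (20 ∷ 1 ∷ []) ∷ (2 ∷ 4 ∷ 11 ∷ []) ∷ (18 ∷ 14 ∷ 17 ∷ 8 ∷ 9 ∷ 12 ∷ []) ∷ (19 ∷ 5 ∷ 3 ∷ 16 ∷ 15 ∷ 6 ∷ 7 ∷ 10 ∷ []) ∷ []) ∷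
  (0 , 14 , (18 ∷ []) ∷ (2 ∷ 3 ∷ 16 ∷ []) ∷ (20 ∷ 1 ∷ 13 ∷ 12 ∷ 9 ∷ 8 ∷ 17 ∷ []) ∷ (19 ∷ 5 ∷ 4 ∷ 11 ∷ 10 ∷ 7 ∷ 6 ∷ 15 ∷ []) ∷ []) ∷
  (0 , 15 , (18 ∷ 14 ∷ []) ∷ (2 ∷ 3 ∷ 16 ∷ []) ∷ (20 ∷ 1 ∷ 13 ∷ 12 ∷ 9 ∷ 6 ∷ []) ∷ (19 ∷ 5 ∷ 4 ∷ 11 ∷ 10 ∷ 7 ∷ 8 ∷ 17 ∷ []) ∷ []) ∷
  (0 , 16 , (2 ∷ 3 ∷ []) ∷ (18 ∷ 14 ∷ []) ∷ (20 ∷ 1 ∷ 13 ∷ 12 ∷ 9 ∷ 8 ∷ 17 ∷ []) ∷ (19 ∷ 5 ∷ 4 ∷ 11 ∷ 10 ∷ 7 ∷ 6 ∷ 15 ∷ []) ∷ []) ∷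
  (0 , 17 , (18 ∷ 14 ∷ []) ∷ (2 ∷ 3 ∷ 16 ∷ []) ∷ (20 ∷ 1 ∷ 13 ∷ 12 ∷ 9 ∷ 8 ∷ []) ∷ (19 ∷ 5 ∷ 4 ∷ 11 ∷ 10 ∷ 7 ∷ 6 ∷ 15 ∷ []) ∷ []) ∷
  (1 , 2 , (19 ∷ 5 ∷ []) ∷ (20 ∷ 0 ∷ []) ∷ (13 ∷ 11 ∷ 4 ∷ []) ∷ (18 ∷ 14 ∷ 16 ∷ 3 ∷ []) ∷ []) ∷
  (1 , 3 , (19 ∷ 5 ∷ []) ∷ (13 ∷ 11 ∷ 4 ∷ []) ∷ (18 ∷ 14 ∷ 16 ∷ []) ∷ (20 ∷ 0 ∷ 2 ∷ []) ∷ []) ∷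
  (1 , 4 , (13 ∷ 11 ∷ []) ∷ (19 ∷ 5 ∷ []) ∷ (20 ∷ 0 ∷ 2 ∷ []) ∷ (18 ∷ 14 ∷ 16 ∷ 3 ∷ []) ∷ []) ∷
  (1 , 5 , (19 ∷ []) ∷ (13 ∷ 11 ∷ 4 ∷ []) ∷ (20 ∷ 0 ∷ 2 ∷ []) ∷ (18 ∷ 14 ∷ 16 ∷ 3 ∷ []) ∷ []) ∷
  (1 , 6 , (13 ∷ 12 ∷ 9 ∷ []) ∷ (18 ∷ 14 ∷ 15 ∷ []) ∷ (19 ∷ 5 ∷ 4 ∷ 11 ∷ 10 ∷ 7 ∷ []) ∷ (20 ∷ 0 ∷ 2 ∷ 3 ∷ 16 ∷ 17 ∷ 8 ∷ []) ∷ []) ∷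
  (1 , 7 , (13 ∷ 10 ∷ []) ∷ (18 ∷ 14 ∷ 17 ∷ 8 ∷ []) ∷ (19 ∷ 5 ∷ 4 ∷ 11 ∷ 12 ∷ 9 ∷ []) ∷ (20 ∷ 0 ∷ 2 ∷ 3 ∷ 16 ∷ 15 ∷ 6 ∷ []) ∷ []) ∷
  (1 , 8 , (13 ∷ 12 ∷ 9 ∷ []) ∷ (18 ∷ 14 ∷ 17 ∷ []) ∷ (19 ∷ 5 ∷ 4 ∷ 11 ∷ 10 ∷ 7 ∷ []) ∷ (20 ∷ 0 ∷ 2 ∷ 3 ∷ 16 ∷ 15 ∷ 6 ∷ []) ∷ []) ∷
  (1 , 9 , (13 ∷ 12 ∷ []) ∷ (18 ∷ 14 ∷ 17 ∷ 8 ∷ []) ∷ (19 ∷ 5 ∷ 4 ∷ 11 ∷ 10 ∷ 7 ∷ []) ∷ (20 ∷ 0 ∷ 2 ∷ 3 ∷ 16 ∷ 15 ∷ 6 ∷ []) ∷ []) ∷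
  (1 , 10 , (13 ∷ []) ∷ (19 ∷ 5 ∷ 4 ∷ 11 ∷ []) ∷ (18 ∷ 14 ∷ 17 ∷ 8 ∷ 7 ∷ []) ∷ (20 ∷ 0 ∷ 2 ∷ 3 ∷ 16 ∷ 15 ∷ 6 ∷ 9 ∷ 12 ∷ []) ∷ []) ∷
  (1 , 11 , (13 ∷ []) ∷ (19 ∷ 5 ∷ 4 ∷ []) ∷ (18 ∷ 14 ∷ 17 ∷ 8 ∷ 9 ∷ 12 ∷ []) ∷ (20 ∷ 0 ∷ 2 ∷ 3 ∷ 16 ∷ 15 ∷ 6 ∷ 7 ∷ 10 ∷ []) ∷ []) ∷
  (1 , 12 , (13 ∷ []) ∷ (19 ∷ 5 ∷ 4 ∷ 11 ∷ []) ∷ (18 ∷ 14 ∷ 17 ∷ 8 ∷ 9 ∷ []) ∷ (20 ∷ 0 ∷ 2 ∷ 3 ∷ 16 ∷ 15 ∷ 6 ∷ 7 ∷ 10 ∷ []) ∷ []) ∷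
  (1 , 13 , [] ∷ (19 ∷ 5 ∷ 4 ∷ 11 ∷ []) ∷ (18 ∷ 14 ∷ 17 ∷ 8 ∷ 9 ∷ 12 ∷ []) ∷ (20 ∷ 0 ∷ 2 ∷ 3 ∷ 16 ∷ 15 ∷ 6 ∷ 7 ∷ 10 ∷ []) ∷ []) ∷
  (1 , 14 , (18 ∷ []) ∷ (19 ∷ 5 ∷ 3 ∷ 16 ∷ []) ∷ (13 ∷ 12 ∷ 9 ∷ 8 ∷ 17 ∷ []) ∷ (20 ∷ 0 ∷ 2 ∷ 4 ∷ 11 ∷ 10 ∷ 7 ∷ 6 ∷ 15 ∷ []) ∷ []) ∷
  (1 , 15 , (18 ∷ 14 ∷ []) ∷ (13 ∷ 12 ∷ 9 ∷ 6 ∷ []) ∷ (19 ∷ 5 ∷ 3 ∷ 16 ∷ []) ∷ (20 ∷ 0 ∷ 2 ∷ 4 ∷ 11 ∷ 10 ∷ 7 ∷ 8 ∷ 17 ∷ []) ∷ []) ∷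
  (1 , 16 , (18 ∷ 14 ∷ []) ∷ (19 ∷ 5 ∷ 3 ∷ []) ∷ (13 ∷ 12 ∷ 9 ∷ 8 ∷ 17 ∷ []) ∷ (20 ∷ 0 ∷ 2 ∷ 4 ∷ 11 ∷ 10 ∷ 7 ∷ 6 ∷ 15 ∷ []) ∷ []) ∷
  (1 , 17 , (18 ∷ 14 ∷ []) ∷ (13 ∷ 12 ∷ 9 ∷ 8 ∷ []) ∷ (19 ∷ 5 ∷ 3 ∷ 16 ∷ []) ∷ (20 ∷ 0 ∷ 2 ∷ 4 ∷ 11 ∷ 10 ∷ 7 ∷ 6 ∷ 15 ∷ []) ∷ []) ∷
  (2 , 3 , [] ∷ (4 ∷ []) ∷ (5 ∷ []) ∷ (0 ∷ 18 ∷ 14 ∷ 16 ∷ []) ∷ []) ∷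
  (2 , 4 , [] ∷ (3 ∷ []) ∷ (5 ∷ []) ∷ (0 ∷ 18 ∷ 1 ∷ 13 ∷ 11 ∷ []) ∷ []) ∷
  (2 , 5 , [] ∷ (3 ∷ []) ∷ (4 ∷ []) ∷ (0 ∷ 19 ∷ []) ∷ []) ∷
  (2 , 6 , (3 ∷ 16 ∷ 15 ∷ []) ∷ (4 ∷ 11 ∷ 12 ∷ 9 ∷ []) ∷ (0 ∷ 18 ∷ 14 ∷ 17 ∷ 8 ∷ []) ∷ (5 ∷ 19 ∷ 1 ∷ 13 ∷ 10 ∷ 7 ∷ []) ∷ []) ∷
  (2 , 7 , (4 ∷ 11 ∷ 10 ∷ []) ∷ (3 ∷ 16 ∷ 17 ∷ 8 ∷ []) ∷ (0 ∷ 18 ∷ 14 ∷ 15 ∷ 6 ∷ []) ∷ (5 ∷ 19 ∷ 1 ∷ 13 ∷ 12 ∷ 9 ∷ []) ∷ []) ∷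
  (2 , 8 , (3 ∷ 16 ∷ 17 ∷ []) ∷ (4 ∷ 11 ∷ 12 ∷ 9 ∷ []) ∷ (0 ∷ 18 ∷ 14 ∷ 15 ∷ 6 ∷ []) ∷ (5 ∷ 19 ∷ 1 ∷ 13 ∷ 10 ∷ 7 ∷ []) ∷ []) ∷
  (2 , 9 , (4 ∷ 11 ∷ 12 ∷ []) ∷ (3 ∷ 16 ∷ 17 ∷ 8 ∷ []) ∷ (0 ∷ 18 ∷ 14 ∷ 15 ∷ 6 ∷ []) ∷ (5 ∷ 19 ∷ 1 ∷ 13 ∷ 10 ∷ 7 ∷ []) ∷ []) ∷
  (2 , 10 , (4 ∷ 11 ∷ []) ∷ (5 ∷ 19 ∷ 1 ∷ 13 ∷ []) ∷ (3 ∷ 16 ∷ 17 ∷ 8 ∷ 7 ∷ []) ∷ (0 ∷ 18 ∷ 14 ∷ 15 ∷ 6 ∷ 9 ∷ 12 ∷ []) ∷ []) ∷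
  (2 , 11 , (4 ∷ []) ∷ (5 ∷ 19 ∷ 1 ∷ 13 ∷ []) ∷ (3 ∷ 16 ∷ 17 ∷ 8 ∷ 9 ∷ 12 ∷ []) ∷ (0 ∷ 18 ∷ 14 ∷ 15 ∷ 6 ∷ 7 ∷ 10 ∷ []) ∷ []) ∷
  (2 , 12 , (4 ∷ 11 ∷ []) ∷ (5 ∷ 19 ∷ 1 ∷ 13 ∷ []) ∷ (3 ∷ 16 ∷ 17 ∷ 8 ∷ 9 ∷ []) ∷ (0 ∷ 18 ∷ 14 ∷ 15 ∷ 6 ∷ 7 ∷ 10 ∷ []) ∷ []) ∷
  (2 , 13 , (4 ∷ 11 ∷ []) ∷ (5 ∷ 19 ∷ 1 ∷ []) ∷ (3 ∷ 16 ∷ 17 ∷ 8 ∷ 9 ∷ 12 ∷ []) ∷ (0 ∷ 18 ∷ 14 ∷ 15 ∷ 6 ∷ 7 ∷ 10 ∷ []) ∷ []) ∷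
  (2 , 14 , (0 ∷ 18 ∷ []) ∷ (3 ∷ 16 ∷ []) ∷ (4 ∷ 11 ∷ 12 ∷ 9 ∷ 8 ∷ 17 ∷ []) ∷ (5 ∷ 19 ∷ 1 ∷ 13 ∷ 10 ∷ 7 ∷ 6 ∷ 15 ∷ []) ∷ []) ∷
  (2 , 15 , (3 ∷ 16 ∷ []) ∷ (0 ∷ 18 ∷ 14 ∷ []) ∷ (4 ∷ 11 ∷ 12 ∷ 9 ∷ 6 ∷ []) ∷ (5 ∷ 19 ∷ 1 ∷ 13 ∷ 10 ∷ 7 ∷ 8 ∷ 17 ∷ []) ∷ []) ∷
  (2 , 16 , (3 ∷ []) ∷ (0 ∷ 18 ∷ 14 ∷ []) ∷ (4 ∷ 11 ∷ 12 ∷ 9 ∷ 8 ∷ 17 ∷ []) ∷ (5 ∷ 19 ∷ 1 ∷ 13 ∷ 10 ∷ 7 ∷ 6 ∷ 15 ∷ []) ∷ []) ∷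
  (2 , 17 , (3 ∷ 16 ∷ []) ∷ (0 ∷ 18 ∷ 14 ∷ []) ∷ (4 ∷ 11 ∷ 12 ∷ 9 ∷ 8 ∷ []) ∷ (5 ∷ 19 ∷ 1 ∷ 13 ∷ 10 ∷ 7 ∷ 6 ∷ 15 ∷ []) ∷ []) ∷
  (3 , 4 , [] ∷ (2 ∷ []) ∷ (5 ∷ []) ∷ (16 ∷ 17 ∷ 8 ∷ 9 ∷ 12 ∷ 11 ∷ []) ∷ []) ∷
  (3 , 5 , [] ∷ (2 ∷ []) ∷ (4 ∷ []) ∷ (16 ∷ 14 ∷ 18 ∷ 0 ∷ 19 ∷ []) ∷ []) ∷
  (3 , 6 , (16 ∷ 15 ∷ []) ∷ (4 ∷ 11 ∷ 12 ∷ 9 ∷ []) ∷ (2 ∷ 0 ∷ 18 ∷ 14 ∷ 17 ∷ 8 ∷ []) ∷ (5 ∷ 19 ∷ 1 ∷ 13 ∷ 10 ∷ 7 ∷ []) ∷ []) ∷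
  (3 , 7 , (4 ∷ 11 ∷ 10 ∷ []) ∷ (16 ∷ 17 ∷ 8 ∷ []) ∷ (2 ∷ 0 ∷ 18 ∷ 14 ∷ 15 ∷ 6 ∷ []) ∷ (5 ∷ 19 ∷ 1 ∷ 13 ∷ 12 ∷ 9 ∷ []) ∷ []) ∷
  (3 , 8 , (16 ∷ 17 ∷ []) ∷ (4 ∷ 11 ∷ 12 ∷ 9 ∷ []) ∷ (2 ∷ 0 ∷ 18 ∷ 14 ∷ 15 ∷ 6 ∷ []) ∷ (5 ∷ 19 ∷ 1 ∷ 13 ∷ 10 ∷ 7 ∷ []) ∷ []) ∷
  (3 , 9 , (4 ∷ 11 ∷ 12 ∷ []) ∷ (16 ∷ 17 ∷ 8 ∷ []) ∷ (2 ∷ 0 ∷ 18 ∷ 14 ∷ 15 ∷ 6 ∷ []) ∷ (5 ∷ 19 ∷ 1 ∷ 13 ∷ 10 ∷ 7 ∷ []) ∷ []) ∷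
  (3 , 10 , (4 ∷ 11 ∷ []) ∷ (5 ∷ 19 ∷ 1 ∷ 13 ∷ []) ∷ (16 ∷ 17 ∷ 8 ∷ 7 ∷ []) ∷ (2 ∷ 0 ∷ 18 ∷ 14 ∷ 15 ∷ 6 ∷ 9 ∷ 12 ∷ []) ∷ []) ∷
  (3 , 11 , (4 ∷ []) ∷ (5 ∷ 19 ∷ 1 ∷ 13 ∷ []) ∷ (16 ∷ 17 ∷ 8 ∷ 9 ∷ 12 ∷ []) ∷ (2 ∷ 0 ∷ 18 ∷ 14 ∷ 15 ∷ 6 ∷ 7 ∷ 10 ∷ []) ∷ []) ∷
  (3 , 12 , (4 ∷ 11 ∷ []) ∷ (5 ∷ 19 ∷ 1 ∷ 13 ∷ []) ∷ (16 ∷ 17 ∷ 8 ∷ 9 ∷ []) ∷ (2 ∷ 0 ∷ 18 ∷ 14 ∷ 15 ∷ 6 ∷ 7 ∷ 10 ∷ []) ∷ []) ∷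
  (3 , 13 , (4 ∷ 11 ∷ []) ∷ (5 ∷ 19 ∷ 1 ∷ []) ∷ (16 ∷ 17 ∷ 8 ∷ 9 ∷ 12 ∷ []) ∷ (2 ∷ 0 ∷ 18 ∷ 14 ∷ 15 ∷ 6 ∷ 7 ∷ 10 ∷ []) ∷ []) ∷
  (3 , 14 , (16 ∷ []) ∷ (2 ∷ 0 ∷ 18 ∷ []) ∷ (4 ∷ 11 ∷ 12 ∷ 9 ∷ 8 ∷ 17 ∷ []) ∷ (5 ∷ 19 ∷ 1 ∷ 13 ∷ 10 ∷ 7 ∷ 6 ∷ 15 ∷ []) ∷ []) ∷
  (3 , 15 , (16 ∷ []) ∷ (2 ∷ 0 ∷ 18 ∷ 14 ∷ []) ∷ (4 ∷ 11 ∷ 12 ∷ 9 ∷ 6 ∷ []) ∷ (5 ∷ 19 ∷ 1 ∷ 13 ∷ 10 ∷ 7 ∷ 8 ∷ 17 ∷ []) ∷ []) ∷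
  (3 , 16 , [] ∷ (2 ∷ 0 ∷ 18 ∷ 14 ∷ []) ∷ (4 ∷ 11 ∷ 12 ∷ 9 ∷ 8 ∷ 17 ∷ []) ∷ (5 ∷ 19 ∷ 1 ∷ 13 ∷ 10 ∷ 7 ∷ 6 ∷ 15 ∷ []) ∷ []) ∷
  (3 , 17 , (16 ∷ []) ∷ (2 ∷ 0 ∷ 18 ∷ 14 ∷ []) ∷ (4 ∷ 11 ∷ 12 ∷ 9 ∷ 8 ∷ []) ∷ (5 ∷ 19 ∷ 1 ∷ 13 ∷ 10 ∷ 7 ∷ 6 ∷ 15 ∷ []) ∷ []) ∷
  (4 , 5 , [] ∷ (2 ∷ []) ∷ (3 ∷ []) ∷ (11 ∷ 13 ∷ 1 ∷ 19 ∷ []) ∷ []) ∷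
  (4 , 6 , (3 ∷ 16 ∷ 15 ∷ []) ∷ (11 ∷ 12 ∷ 9 ∷ []) ∷ (2 ∷ 0 ∷ 18 ∷ 14 ∷ 17 ∷ 8 ∷ []) ∷ (5 ∷ 19 ∷ 1 ∷ 13 ∷ 10 ∷ 7 ∷ []) ∷ []) ∷
  (4 , 7 , (11 ∷ 10 ∷ []) ∷ (3 ∷ 16 ∷ 17 ∷ 8 ∷ []) ∷ (2 ∷ 0 ∷ 18 ∷ 14 ∷ 15 ∷ 6 ∷ []) ∷ (5 ∷ 19 ∷ 1 ∷ 13 ∷ 12 ∷ 9 ∷ []) ∷ []) ∷
  (4 , 8 , (3 ∷ 16 ∷ 17 ∷ []) ∷ (11 ∷ 12 ∷ 9 ∷ []) ∷ (2 ∷ 0 ∷ 18 ∷ 14 ∷ 15 ∷ 6 ∷ []) ∷ (5 ∷ 19 ∷ 1 ∷ 13 ∷ 10 ∷ 7 ∷ []) ∷ []) ∷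
  (4 , 9 , (11 ∷ 12 ∷ []) ∷ (3 ∷ 16 ∷ 17 ∷ 8 ∷ []) ∷ (2 ∷ 0 ∷ 18 ∷ 14 ∷ 15 ∷ 6 ∷ []) ∷ (5 ∷ 19 ∷ 1 ∷ 13 ∷ 10 ∷ 7 ∷ []) ∷ []) ∷
  (4 , 10 , (11 ∷ []) ∷ (5 ∷ 19 ∷ 1 ∷ 13 ∷ []) ∷ (3 ∷ 16 ∷ 17 ∷ 8 ∷ 7 ∷ []) ∷ (2 ∷ 0 ∷ 18 ∷ 14 ∷ 15 ∷ 6 ∷ 9 ∷ 12 ∷ []) ∷ []) ∷
  (4 , 11 , [] ∷ (5 ∷ 19 ∷ 1 ∷ 13 ∷ []) ∷ (3 ∷ 16 ∷ 17 ∷ 8 ∷ 9 ∷ 12 ∷ []) ∷ (2 ∷ 0 ∷ 18 ∷ 14 ∷ 15 ∷ 6 ∷ 7 ∷ 10 ∷ []) ∷ []) ∷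
  (4 , 12 , (11 ∷ []) ∷ (5 ∷ 19 ∷ 1 ∷ 13 ∷ []) ∷ (3 ∷ 16 ∷ 17 ∷ 8 ∷ 9 ∷ []) ∷ (2 ∷ 0 ∷ 18 ∷ 14 ∷ 15 ∷ 6 ∷ 7 ∷ 10 ∷ []) ∷ []) ∷
  (4 , 13 , (11 ∷ []) ∷ (5 ∷ 19 ∷ 1 ∷ []) ∷ (3 ∷ 16 ∷ 17 ∷ 8 ∷ 9 ∷ 12 ∷ []) ∷ (2 ∷ 0 ∷ 18 ∷ 14 ∷ 15 ∷ 6 ∷ 7 ∷ 10 ∷ []) ∷ []) ∷
  (4 , 14 , (3 ∷ 16 ∷ []) ∷ (2 ∷ 0 ∷ 18 ∷ []) ∷ (11 ∷ 12 ∷ 9 ∷ 8 ∷ 17 ∷ []) ∷ (5 ∷ 19 ∷ 1 ∷ 13 ∷ 10 ∷ 7 ∷ 6 ∷ 15 ∷ []) ∷ []) ∷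
  (4 , 15 , (3 ∷ 16 ∷ []) ∷ (2 ∷ 0 ∷ 18 ∷ 14 ∷ []) ∷ (11 ∷ 12 ∷ 9 ∷ 6 ∷ []) ∷ (5 ∷ 19 ∷ 1 ∷ 13 ∷ 10 ∷ 7 ∷ 8 ∷ 17 ∷ []) ∷ []) ∷
  (4 , 16 , (3 ∷ []) ∷ (2 ∷ 0 ∷ 18 ∷ 14 ∷ []) ∷ (11 ∷ 12 ∷ 9 ∷ 8 ∷ 17 ∷ []) ∷ (5 ∷ 19 ∷ 1 ∷ 13 ∷ 10 ∷ 7 ∷ 6 ∷ 15 ∷ []) ∷ []) ∷
  (4 , 17 , (3 ∷ 16 ∷ []) ∷ (2 ∷ 0 ∷ 18 ∷ 14 ∷ []) ∷ (11 ∷ 12 ∷ 9 ∷ 8 ∷ []) ∷ (5 ∷ 19 ∷ 1 ∷ 13 ∷ 10 ∷ 7 ∷ 6 ∷ 15 ∷ []) ∷ []) ∷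
  (5 , 6 , (3 ∷ 16 ∷ 15 ∷ []) ∷ (4 ∷ 11 ∷ 12 ∷ 9 ∷ []) ∷ (19 ∷ 1 ∷ 13 ∷ 10 ∷ 7 ∷ []) ∷ (2 ∷ 0 ∷ 18 ∷ 14 ∷ 17 ∷ 8 ∷ []) ∷ []) ∷
  (5 , 7 , (4 ∷ 11 ∷ 10 ∷ []) ∷ (3 ∷ 16 ∷ 17 ∷ 8 ∷ []) ∷ (19 ∷ 1 ∷ 13 ∷ 12 ∷ 9 ∷ []) ∷ (2 ∷ 0 ∷ 18 ∷ 14 ∷ 15 ∷ 6 ∷ []) ∷ []) ∷
  (5 , 8 , (3 ∷ 16 ∷ 17 ∷ []) ∷ (4 ∷ 11 ∷ 12 ∷ 9 ∷ []) ∷ (19 ∷ 1 ∷ 13 ∷ 10 ∷ 7 ∷ []) ∷ (2 ∷ 0 ∷ 18 ∷ 14 ∷ 15 ∷ 6 ∷ []) ∷ []) ∷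
  (5 , 9 , (4 ∷ 11 ∷ 12 ∷ []) ∷ (3 ∷ 16 ∷ 17 ∷ 8 ∷ []) ∷ (19 ∷ 1 ∷ 13 ∷ 10 ∷ 7 ∷ []) ∷ (2 ∷ 0 ∷ 18 ∷ 14 ∷ 15 ∷ 6 ∷ []) ∷ []) ∷
  (5 , 10 , (4 ∷ 11 ∷ []) ∷ (19 ∷ 1 ∷ 13 ∷ []) ∷ (3 ∷ 16 ∷ 17 ∷ 8 ∷ 7 ∷ []) ∷ (2 ∷ 0 ∷ 18 ∷ 14 ∷ 15 ∷ 6 ∷ 9 ∷ 12 ∷ []) ∷ []) ∷
  (5 , 11 , (4 ∷ []) ∷ (19 ∷ 1 ∷ 13 ∷ []) ∷ (3 ∷ 16 ∷ 17 ∷ 8 ∷ 9 ∷ 12 ∷ []) ∷ (2 ∷ 0 ∷ 18 ∷ 14 ∷ 15 ∷ 6 ∷ 7 ∷ 10 ∷ []) ∷ []) ∷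
  (5 , 12 , (4 ∷ 11 ∷ []) ∷ (19 ∷ 1 ∷ 13 ∷ []) ∷ (3 ∷ 16 ∷ 17 ∷ 8 ∷ 9 ∷ []) ∷ (2 ∷ 0 ∷ 18 ∷ 14 ∷ 15 ∷ 6 ∷ 7 ∷ 10 ∷ []) ∷ []) ∷
  (5 , 13 , (4 ∷ 11 ∷ []) ∷ (19 ∷ 1 ∷ []) ∷ (3 ∷ 16 ∷ 17 ∷ 8 ∷ 9 ∷ 12 ∷ []) ∷ (2 ∷ 0 ∷ 18 ∷ 14 ∷ 15 ∷ 6 ∷ 7 ∷ 10 ∷ []) ∷ []) ∷
  (5 , 14 , (3 ∷ 16 ∷ []) ∷ (2 ∷ 0 ∷ 18 ∷ []) ∷ (4 ∷ 11 ∷ 12 ∷ 9 ∷ 8 ∷ 17 ∷ []) ∷ (19 ∷ 1 ∷ 13 ∷ 10 ∷ 7 ∷ 6 ∷ 15 ∷ []) ∷ []) ∷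
  (5 , 15 , (3 ∷ 16 ∷ []) ∷ (2 ∷ 0 ∷ 18 ∷ 14 ∷ []) ∷ (4 ∷ 11 ∷ 12 ∷ 9 ∷ 6 ∷ []) ∷ (19 ∷ 1 ∷ 13 ∷ 10 ∷ 7 ∷ 8 ∷ 17 ∷ []) ∷ []) ∷
  (5 , 16 , (3 ∷ []) ∷ (2 ∷ 0 ∷ 18 ∷ 14 ∷ []) ∷ (4 ∷ 11 ∷ 12 ∷ 9 ∷ 8 ∷ 17 ∷ []) ∷ (19 ∷ 1 ∷ 13 ∷ 10 ∷ 7 ∷ 6 ∷ 15 ∷ []) ∷ []) ∷
  (5 , 17 , (3 ∷ 16 ∷ []) ∷ (2 ∷ 0 ∷ 18 ∷ 14 ∷ []) ∷ (4 ∷ 11 ∷ 12 ∷ 9 ∷ 8 ∷ []) ∷ (19 ∷ 1 ∷ 13 ∷ 10 ∷ 7 ∷ 6 ∷ 15 ∷ []) ∷ []) ∷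
  (6 , 7 , [] ∷ (8 ∷ []) ∷ (9 ∷ []) ∷ (15 ∷ 16 ∷ 3 ∷ 4 ∷ 11 ∷ 10 ∷ []) ∷ []) ∷
  (6 , 8 , [] ∷ (7 ∷ []) ∷ (9 ∷ []) ∷ (15 ∷ 17 ∷ []) ∷ []) ∷
  (6 , 9 , [] ∷ (7 ∷ []) ∷ (8 ∷ []) ∷ (15 ∷ 16 ∷ 3 ∷ 4 ∷ 11 ∷ 12 ∷ []) ∷ []) ∷
  (6 , 10 , (7 ∷ []) ∷ (9 ∷ 12 ∷ []) ∷ (15 ∷ 16 ∷ 3 ∷ 4 ∷ 11 ∷ []) ∷ (8 ∷ 17 ∷ 14 ∷ 18 ∷ 1 ∷ 13 ∷ []) ∷ []) ∷
  (6 , 11 , (7 ∷ 10 ∷ []) ∷ (9 ∷ 12 ∷ []) ∷ (15 ∷ 16 ∷ 3 ∷ 4 ∷ []) ∷ (8 ∷ 17 ∷ 14 ∷ 18 ∷ 1 ∷ 13 ∷ []) ∷ []) ∷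
  (6 , 12 , (9 ∷ []) ∷ (7 ∷ 10 ∷ []) ∷ (15 ∷ 16 ∷ 3 ∷ 4 ∷ 11 ∷ []) ∷ (8 ∷ 17 ∷ 14 ∷ 18 ∷ 1 ∷ 13 ∷ []) ∷ []) ∷
  (6 , 13 , (7 ∷ 10 ∷ []) ∷ (9 ∷ 12 ∷ []) ∷ (15 ∷ 14 ∷ 18 ∷ 1 ∷ []) ∷ (8 ∷ 17 ∷ 16 ∷ 3 ∷ 4 ∷ 11 ∷ []) ∷ []) ∷
  (6 , 14 , (15 ∷ []) ∷ (8 ∷ 17 ∷ []) ∷ (9 ∷ 12 ∷ 13 ∷ 1 ∷ 18 ∷ []) ∷ (7 ∷ 10 ∷ 11 ∷ 4 ∷ 3 ∷ 16 ∷ []) ∷ []) ∷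
  (6 , 15 , [] ∷ (8 ∷ 17 ∷ []) ∷ (7 ∷ 10 ∷ 13 ∷ 1 ∷ 18 ∷ 14 ∷ []) ∷ (9 ∷ 12 ∷ 11 ∷ 4 ∷ 3 ∷ 16 ∷ []) ∷ []) ∷
  (6 , 16 , (15 ∷ []) ∷ (8 ∷ 17 ∷ []) ∷ (9 ∷ 12 ∷ 11 ∷ 4 ∷ 3 ∷ []) ∷ (7 ∷ 10 ∷ 13 ∷ 1 ∷ 18 ∷ 14 ∷ []) ∷ []) ∷
  (6 , 17 , (8 ∷ []) ∷ (15 ∷ []) ∷ (7 ∷ 10 ∷ 13 ∷ 1 ∷ 18 ∷ 14 ∷ []) ∷ (9 ∷ 12 ∷ 11 ∷ 4 ∷ 3 ∷ 16 ∷ []) ∷ []) ∷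
  (7 , 8 , [] ∷ (6 ∷ []) ∷ (9 ∷ []) ∷ (10 ∷ 11 ∷ 4 ∷ 3 ∷ 16 ∷ 17 ∷ []) ∷ []) ∷
  (7 , 9 , [] ∷ (6 ∷ []) ∷ (8 ∷ []) ∷ (10 ∷ 12 ∷ []) ∷ []) ∷
  (7 , 10 , [] ∷ (9 ∷ 12 ∷ []) ∷ (6 ∷ 15 ∷ 14 ∷ 18 ∷ 1 ∷ 13 ∷ []) ∷ (8 ∷ 17 ∷ 16 ∷ 3 ∷ 4 ∷ 11 ∷ []) ∷ []) ∷
  (7 , 11 , (10 ∷ []) ∷ (9 ∷ 12 ∷ []) ∷ (8 ∷ 17 ∷ 16 ∷ 3 ∷ 4 ∷ []) ∷ (6 ∷ 15 ∷ 14 ∷ 18 ∷ 1 ∷ 13 ∷ []) ∷ []) ∷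
  (7 , 12 , (9 ∷ []) ∷ (10 ∷ []) ∷ (6 ∷ 15 ∷ 14 ∷ 18 ∷ 1 ∷ 13 ∷ []) ∷ (8 ∷ 17 ∷ 16 ∷ 3 ∷ 4 ∷ 11 ∷ []) ∷ []) ∷
  (7 , 13 , (10 ∷ []) ∷ (9 ∷ 12 ∷ []) ∷ (8 ∷ 17 ∷ 14 ∷ 18 ∷ 1 ∷ []) ∷ (6 ∷ 15 ∷ 16 ∷ 3 ∷ 4 ∷ 11 ∷ []) ∷ []) ∷
  (7 , 14 , (6 ∷ 15 ∷ []) ∷ (8 ∷ 17 ∷ []) ∷ (10 ∷ 13 ∷ 1 ∷ 18 ∷ []) ∷ (9 ∷ 12 ∷ 11 ∷ 4 ∷ 3 ∷ 16 ∷ []) ∷ []) ∷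
  (7 , 15 , (6 ∷ []) ∷ (8 ∷ 17 ∷ []) ∷ (10 ∷ 11 ∷ 4 ∷ 3 ∷ 16 ∷ []) ∷ (9 ∷ 12 ∷ 13 ∷ 1 ∷ 18 ∷ 14 ∷ []) ∷ []) ∷
  (7 , 16 , (6 ∷ 15 ∷ []) ∷ (8 ∷ 17 ∷ []) ∷ (10 ∷ 11 ∷ 4 ∷ 3 ∷ []) ∷ (9 ∷ 12 ∷ 13 ∷ 1 ∷ 18 ∷ 14 ∷ []) ∷ []) ∷
  (7 , 17 , (8 ∷ []) ∷ (6 ∷ 15 ∷ []) ∷ (10 ∷ 11 ∷ 4 ∷ 3 ∷ 16 ∷ []) ∷ (9 ∷ 12 ∷ 13 ∷ 1 ∷ 18 ∷ 14 ∷ []) ∷ []) ∷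
  (8 , 9 , [] ∷ (6 ∷ []) ∷ (7 ∷ []) ∷ (17 ∷ 16 ∷ 3 ∷ 4 ∷ 11 ∷ 12 ∷ []) ∷ []) ∷
  (8 , 10 , (7 ∷ []) ∷ (9 ∷ 12 ∷ []) ∷ (17 ∷ 16 ∷ 3 ∷ 4 ∷ 11 ∷ []) ∷ (6 ∷ 15 ∷ 14 ∷ 18 ∷ 1 ∷ 13 ∷ []) ∷ []) ∷
  (8 , 11 , (7 ∷ 10 ∷ []) ∷ (9 ∷ 12 ∷ []) ∷ (17 ∷ 16 ∷ 3 ∷ 4 ∷ []) ∷ (6 ∷ 15 ∷ 14 ∷ 18 ∷ 1 ∷ 13 ∷ []) ∷ []) ∷
  (8 , 12 , (9 ∷ []) ∷ (7 ∷ 10 ∷ []) ∷ (17 ∷ 16 ∷ 3 ∷ 4 ∷ 11 ∷ []) ∷ (6 ∷ 15 ∷ 14 ∷ 18 ∷ 1 ∷ 13 ∷ []) ∷ []) ∷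
  (8 , 13 , (7 ∷ 10 ∷ []) ∷ (9 ∷ 12 ∷ []) ∷ (17 ∷ 14 ∷ 18 ∷ 1 ∷ []) ∷ (6 ∷ 15 ∷ 16 ∷ 3 ∷ 4 ∷ 11 ∷ []) ∷ []) ∷
  (8 , 14 , (17 ∷ []) ∷ (6 ∷ 15 ∷ []) ∷ (9 ∷ 12 ∷ 13 ∷ 1 ∷ 18 ∷ []) ∷ (7 ∷ 10 ∷ 11 ∷ 4 ∷ 3 ∷ 16 ∷ []) ∷ []) ∷
  (8 , 15 , (6 ∷ []) ∷ (17 ∷ []) ∷ (7 ∷ 10 ∷ 13 ∷ 1 ∷ 18 ∷ 14 ∷ []) ∷ (9 ∷ 12 ∷ 11 ∷ 4 ∷ 3 ∷ 16 ∷ []) ∷ []) ∷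
  (8 , 16 , (17 ∷ []) ∷ (6 ∷ 15 ∷ []) ∷ (9 ∷ 12 ∷ 11 ∷ 4 ∷ 3 ∷ []) ∷ (7 ∷ 10 ∷ 13 ∷ 1 ∷ 18 ∷ 14 ∷ []) ∷ []) ∷
  (8 , 17 , [] ∷ (6 ∷ 15 ∷ []) ∷ (7 ∷ 10 ∷ 13 ∷ 1 ∷ 18 ∷ 14 ∷ []) ∷ (9 ∷ 12 ∷ 11 ∷ 4 ∷ 3 ∷ 16 ∷ []) ∷ []) ∷
  (9 , 10 , (7 ∷ []) ∷ (12 ∷ []) ∷ (6 ∷ 15 ∷ 14 ∷ 18 ∷ 1 ∷ 13 ∷ []) ∷ (8 ∷ 17 ∷ 16 ∷ 3 ∷ 4 ∷ 11 ∷ []) ∷ []) ∷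
  (9 , 11 , (12 ∷ []) ∷ (7 ∷ 10 ∷ []) ∷ (8 ∷ 17 ∷ 16 ∷ 3 ∷ 4 ∷ []) ∷ (6 ∷ 15 ∷ 14 ∷ 18 ∷ 1 ∷ 13 ∷ []) ∷ []) ∷
  (9 , 12 , [] ∷ (7 ∷ 10 ∷ []) ∷ (6 ∷ 15 ∷ 14 ∷ 18 ∷ 1 ∷ 13 ∷ []) ∷ (8 ∷ 17 ∷ 16 ∷ 3 ∷ 4 ∷ 11 ∷ []) ∷ []) ∷
  (9 , 13 , (12 ∷ []) ∷ (7 ∷ 10 ∷ []) ∷ (8 ∷ 17 ∷ 14 ∷ 18 ∷ 1 ∷ []) ∷ (6 ∷ 15 ∷ 16 ∷ 3 ∷ 4 ∷ 11 ∷ []) ∷ []) ∷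
  (9 , 14 , (6 ∷ 15 ∷ []) ∷ (8 ∷ 17 ∷ []) ∷ (12 ∷ 13 ∷ 1 ∷ 18 ∷ []) ∷ (7 ∷ 10 ∷ 11 ∷ 4 ∷ 3 ∷ 16 ∷ []) ∷ []) ∷
  (9 , 15 , (6 ∷ []) ∷ (8 ∷ 17 ∷ []) ∷ (12 ∷ 11 ∷ 4 ∷ 3 ∷ 16 ∷ []) ∷ (7 ∷ 10 ∷ 13 ∷ 1 ∷ 18 ∷ 14 ∷ []) ∷ []) ∷
  (9 , 16 , (6 ∷ 15 ∷ []) ∷ (8 ∷ 17 ∷ []) ∷ (12 ∷ 11 ∷ 4 ∷ 3 ∷ []) ∷ (7 ∷ 10 ∷ 13 ∷ 1 ∷ 18 ∷ 14 ∷ []) ∷ []) ∷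
  (9 , 17 , (8 ∷ []) ∷ (6 ∷ 15 ∷ []) ∷ (12 ∷ 11 ∷ 4 ∷ 3 ∷ 16 ∷ []) ∷ (7 ∷ 10 ∷ 13 ∷ 1 ∷ 18 ∷ 14 ∷ []) ∷ []) ∷
  (10 , 11 , [] ∷ (12 ∷ []) ∷ (13 ∷ []) ∷ (7 ∷ 8 ∷ 17 ∷ 16 ∷ 3 ∷ 4 ∷ []) ∷ []) ∷
  (10 , 12 , [] ∷ (11 ∷ []) ∷ (13 ∷ []) ∷ (7 ∷ 9 ∷ []) ∷ []) ∷
  (10 , 13 , [] ∷ (11 ∷ []) ∷ (12 ∷ []) ∷ (7 ∷ 8 ∷ 17 ∷ 14 ∷ 18 ∷ 1 ∷ []) ∷ []) ∷
  (10 , 14 , (7 ∷ 8 ∷ 17 ∷ []) ∷ (13 ∷ 1 ∷ 18 ∷ []) ∷ (11 ∷ 4 ∷ 3 ∷ 16 ∷ []) ∷ (12 ∷ 9 ∷ 6 ∷ 15 ∷ []) ∷ []) ∷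
  (10 , 15 , (7 ∷ 6 ∷ []) ∷ (11 ∷ 4 ∷ 3 ∷ 16 ∷ []) ∷ (12 ∷ 9 ∷ 8 ∷ 17 ∷ []) ∷ (13 ∷ 1 ∷ 18 ∷ 14 ∷ []) ∷ []) ∷
  (10 , 16 , (7 ∷ 8 ∷ 17 ∷ []) ∷ (11 ∷ 4 ∷ 3 ∷ []) ∷ (12 ∷ 9 ∷ 6 ∷ 15 ∷ []) ∷ (13 ∷ 1 ∷ 18 ∷ 14 ∷ []) ∷ []) ∷
  (10 , 17 , (7 ∷ 8 ∷ []) ∷ (11 ∷ 4 ∷ 3 ∷ 16 ∷ []) ∷ (12 ∷ 9 ∷ 6 ∷ 15 ∷ []) ∷ (13 ∷ 1 ∷ 18 ∷ 14 ∷ []) ∷ []) ∷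
  (11 , 12 , [] ∷ (10 ∷ []) ∷ (13 ∷ []) ∷ (4 ∷ 3 ∷ 16 ∷ 17 ∷ 8 ∷ 9 ∷ []) ∷ []) ∷
  (11 , 13 , [] ∷ (10 ∷ []) ∷ (12 ∷ []) ∷ (4 ∷ 5 ∷ 19 ∷ 1 ∷ []) ∷ []) ∷
  (11 , 14 , (4 ∷ 3 ∷ 16 ∷ []) ∷ (13 ∷ 1 ∷ 18 ∷ []) ∷ (10 ∷ 7 ∷ 6 ∷ 15 ∷ []) ∷ (12 ∷ 9 ∷ 8 ∷ 17 ∷ []) ∷ []) ∷
  (11 , 15 , (4 ∷ 3 ∷ 16 ∷ []) ∷ (12 ∷ 9 ∷ 6 ∷ []) ∷ (10 ∷ 7 ∷ 8 ∷ 17 ∷ []) ∷ (13 ∷ 1 ∷ 18 ∷ 14 ∷ []) ∷ []) ∷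
  (11 , 16 , (4 ∷ 3 ∷ []) ∷ (10 ∷ 7 ∷ 6 ∷ 15 ∷ []) ∷ (12 ∷ 9 ∷ 8 ∷ 17 ∷ []) ∷ (13 ∷ 1 ∷ 18 ∷ 14 ∷ []) ∷ []) ∷
  (11 , 17 , (4 ∷ 3 ∷ 16 ∷ []) ∷ (12 ∷ 9 ∷ 8 ∷ []) ∷ (10 ∷ 7 ∷ 6 ∷ 15 ∷ []) ∷ (13 ∷ 1 ∷ 18 ∷ 14 ∷ []) ∷ []) ∷
  (12 , 13 , [] ∷ (10 ∷ []) ∷ (11 ∷ []) ∷ (9 ∷ 8 ∷ 17 ∷ 14 ∷ 18 ∷ 1 ∷ []) ∷ []) ∷
  (12 , 14 , (9 ∷ 8 ∷ 17 ∷ []) ∷ (13 ∷ 1 ∷ 18 ∷ []) ∷ (10 ∷ 7 ∷ 6 ∷ 15 ∷ []) ∷ (11 ∷ 4 ∷ 3 ∷ 16 ∷ []) ∷ []) ∷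
  (12 , 15 , (9 ∷ 6 ∷ []) ∷ (10 ∷ 7 ∷ 8 ∷ 17 ∷ []) ∷ (11 ∷ 4 ∷ 3 ∷ 16 ∷ []) ∷ (13 ∷ 1 ∷ 18 ∷ 14 ∷ []) ∷ []) ∷
  (12 , 16 , (9 ∷ 8 ∷ 17 ∷ []) ∷ (11 ∷ 4 ∷ 3 ∷ []) ∷ (10 ∷ 7 ∷ 6 ∷ 15 ∷ []) ∷ (13 ∷ 1 ∷ 18 ∷ 14 ∷ []) ∷ []) ∷
  (12 , 17 , (9 ∷ 8 ∷ []) ∷ (10 ∷ 7 ∷ 6 ∷ 15 ∷ []) ∷ (11 ∷ 4 ∷ 3 ∷ 16 ∷ []) ∷ (13 ∷ 1 ∷ 18 ∷ 14 ∷ []) ∷ []) ∷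
  (13 , 14 , (1 ∷ 18 ∷ []) ∷ (10 ∷ 7 ∷ 6 ∷ 15 ∷ []) ∷ (11 ∷ 4 ∷ 3 ∷ 16 ∷ []) ∷ (12 ∷ 9 ∷ 8 ∷ 17 ∷ []) ∷ []) ∷
  (13 , 15 , (1 ∷ 18 ∷ 14 ∷ []) ∷ (12 ∷ 9 ∷ 6 ∷ []) ∷ (10 ∷ 7 ∷ 8 ∷ 17 ∷ []) ∷ (11 ∷ 4 ∷ 3 ∷ 16 ∷ []) ∷ []) ∷
  (13 , 16 , (1 ∷ 18 ∷ 14 ∷ []) ∷ (11 ∷ 4 ∷ 3 ∷ []) ∷ (10 ∷ 7 ∷ 6 ∷ 15 ∷ []) ∷ (12 ∷ 9 ∷ 8 ∷ 17 ∷ []) ∷ []) ∷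
  (13 , 17 , (1 ∷ 18 ∷ 14 ∷ []) ∷ (12 ∷ 9 ∷ 8 ∷ []) ∷ (10 ∷ 7 ∷ 6 ∷ 15 ∷ []) ∷ (11 ∷ 4 ∷ 3 ∷ 16 ∷ []) ∷ []) ∷
  (14 , 15 , [] ∷ (16 ∷ []) ∷ (17 ∷ []) ∷ (18 ∷ 1 ∷ 13 ∷ 12 ∷ 9 ∷ 6 ∷ []) ∷ []) ∷
  (14 , 16 , [] ∷ (15 ∷ []) ∷ (17 ∷ []) ∷ (18 ∷ 0 ∷ 2 ∷ 3 ∷ []) ∷ []) ∷
  (14 , 17 , [] ∷ (15 ∷ []) ∷ (16 ∷ []) ∷ (18 ∷ 1 ∷ 13 ∷ 12 ∷ 9 ∷ 8 ∷ []) ∷ []) ∷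
  (15 , 16 , [] ∷ (14 ∷ []) ∷ (17 ∷ []) ∷ (6 ∷ 9 ∷ 12 ∷ 11 ∷ 4 ∷ 3 ∷ []) ∷ []) ∷
  (15 , 17 , [] ∷ (14 ∷ []) ∷ (16 ∷ []) ∷ (6 ∷ 8 ∷ []) ∷ []) ∷
  (16 , 17 , [] ∷ (14 ∷ []) ∷ (15 ∷ []) ∷ (3 ∷ 4 ∷ 11 ∷ 12 ∷ 9 ∷ 8 ∷ []) ∷ []) ∷ []

firstTable : List PathSystem
firstTable =
  (0 , 18 , [] ∷ (20 ∷ []) ∷ (19 ∷ 1 ∷ []) ∷ (2 ∷ 3 ∷ 16 ∷ 14 ∷ []) ∷ []) ∷
  (1 , 18 , [] ∷ (20 ∷ []) ∷ (19 ∷ 0 ∷ []) ∷ (13 ∷ 11 ∷ 4 ∷ 3 ∷ 16 ∷ 14 ∷ []) ∷ []) ∷ []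

lastTable : List PathSystem
lastTable =
  (0 , 19 , [] ∷ (20 ∷ []) ∷ (2 ∷ 5 ∷ []) ∷ (18 ∷ 1 ∷ []) ∷ []) ∷
  (1 , 19 , [] ∷ (20 ∷ []) ∷ (18 ∷ 0 ∷ []) ∷ (13 ∷ 11 ∷ 4 ∷ 5 ∷ []) ∷ []) ∷ []

beadTable : List PathSystem
beadTable =
  (0 , 20 , [] ∷ (18 ∷ []) ∷ (19 ∷ []) ∷ (2 ∷ 4 ∷ 11 ∷ 13 ∷ 1 ∷ []) ∷ []) ∷
  (1 , 20 , [] ∷ (18 ∷ []) ∷ (19 ∷ []) ∷ (13 ∷ 11 ∷ 4 ∷ 2 ∷ 0 ∷ []) ∷ []) ∷ []

-- After each target come its rays from 0, 1, 14 and 5, in this order and without the target itself;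
-- a ray that starts at the target is thus empty.
fanTable : List (ℕ × List ℕ × List ℕ × List ℕ × List ℕ)
fanTable =
  (2 , (0 ∷ []) , (1 ∷ 13 ∷ 11 ∷ 4 ∷ []) , (14 ∷ 16 ∷ 3 ∷ []) , (5 ∷ [])) ∷
  (3 , (0 ∷ 2 ∷ []) , (1 ∷ 13 ∷ 11 ∷ 4 ∷ []) , (14 ∷ 16 ∷ []) , (5 ∷ [])) ∷
  (4 , (0 ∷ 2 ∷ []) , (1 ∷ 13 ∷ 11 ∷ []) , (14 ∷ 16 ∷ 3 ∷ []) , (5 ∷ [])) ∷
  (5 , (0 ∷ 2 ∷ []) , (1 ∷ 13 ∷ 11 ∷ 4 ∷ []) , (14 ∷ 16 ∷ 3 ∷ []) , []) ∷
  (6 , (0 ∷ 2 ∷ 3 ∷ 16 ∷ 17 ∷ 8 ∷ []) , (1 ∷ 13 ∷ 12 ∷ 9 ∷ []) , (14 ∷ 15 ∷ []) , (5 ∷ 4 ∷ 11 ∷ 10 ∷ 7 ∷ [])) ∷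
  (7 , (0 ∷ 2 ∷ 3 ∷ 16 ∷ 15 ∷ 6 ∷ []) , (1 ∷ 13 ∷ 10 ∷ []) , (14 ∷ 17 ∷ 8 ∷ []) , (5 ∷ 4 ∷ 11 ∷ 12 ∷ 9 ∷ [])) ∷
  (8 , (0 ∷ 2 ∷ 3 ∷ 16 ∷ 15 ∷ 6 ∷ []) , (1 ∷ 13 ∷ 12 ∷ 9 ∷ []) , (14 ∷ 17 ∷ []) , (5 ∷ 4 ∷ 11 ∷ 10 ∷ 7 ∷ [])) ∷
  (9 , (0 ∷ 2 ∷ 3 ∷ 16 ∷ 15 ∷ 6 ∷ []) , (1 ∷ 13 ∷ 12 ∷ []) , (14 ∷ 17 ∷ 8 ∷ []) , (5 ∷ 4 ∷ 11 ∷ 10 ∷ 7 ∷ [])) ∷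
  (10 , (0 ∷ 2 ∷ 3 ∷ 16 ∷ 15 ∷ 6 ∷ 9 ∷ 12 ∷ []) , (1 ∷ 13 ∷ []) , (14 ∷ 17 ∷ 8 ∷ 7 ∷ []) , (5 ∷ 4 ∷ 11 ∷ [])) ∷
  (11 , (0 ∷ 2 ∷ 3 ∷ 16 ∷ 15 ∷ 6 ∷ 7 ∷ 10 ∷ []) , (1 ∷ 13 ∷ []) , (14 ∷ 17 ∷ 8 ∷ 9 ∷ 12 ∷ []) , (5 ∷ 4 ∷ [])) ∷
  (12 , (0 ∷ 2 ∷ 3 ∷ 16 ∷ 15 ∷ 6 ∷ 7 ∷ 10 ∷ []) , (1 ∷ 13 ∷ []) , (14 ∷ 17 ∷ 8 ∷ 9 ∷ []) , (5 ∷ 4 ∷ 11 ∷ [])) ∷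
  (13 , (0 ∷ 2 ∷ 3 ∷ 16 ∷ 15 ∷ 6 ∷ 7 ∷ 10 ∷ []) , (1 ∷ []) , (14 ∷ 17 ∷ 8 ∷ 9 ∷ 12 ∷ []) , (5 ∷ 4 ∷ 11 ∷ [])) ∷
  (14 , (0 ∷ 2 ∷ 4 ∷ 11 ∷ 10 ∷ 7 ∷ 6 ∷ 15 ∷ []) , (1 ∷ 13 ∷ 12 ∷ 9 ∷ 8 ∷ 17 ∷ []) , [] , (5 ∷ 3 ∷ 16 ∷ [])) ∷
  (15 , (0 ∷ 2 ∷ 4 ∷ 11 ∷ 10 ∷ 7 ∷ 8 ∷ 17 ∷ []) , (1 ∷ 13 ∷ 12 ∷ 9 ∷ 6 ∷ []) , (14 ∷ []) , (5 ∷ 3 ∷ 16 ∷ [])) ∷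
  (16 , (0 ∷ 2 ∷ 4 ∷ 11 ∷ 10 ∷ 7 ∷ 6 ∷ 15 ∷ []) , (1 ∷ 13 ∷ 12 ∷ 9 ∷ 8 ∷ 17 ∷ []) , (14 ∷ []) , (5 ∷ 3 ∷ [])) ∷
  (17 , (0 ∷ 2 ∷ 4 ∷ 11 ∷ 10 ∷ 7 ∷ 6 ∷ 15 ∷ []) , (1 ∷ 13 ∷ 12 ∷ 9 ∷ 8 ∷ []) , (14 ∷ []) , (5 ∷ 3 ∷ 16 ∷ [])) ∷ []

-- Checking the tables

coreEdges : List (ℕ × ℕ)
coreEdges = filter (λ (_ , d) → d ℕ.<? 18) skeleton

-- Here 18, 19 and 20 stand for any three vertices of the axis.
localEdges : List (ℕ × ℕ) → List (ℕ × ℕ)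
localEdges extra = coreEdges ++ (0 , 18) ∷ (1 , 18) ∷ (0 , 19) ∷ (1 , 19) ∷ (0 , 20) ∷ (1 , 20) ∷ extra

Joined : List (ℕ × ℕ) → ℕ → ℕ → Set
Joined es a b = (a , b) ∈ es ⊎ (b , a) ∈ es

joined? : ∀ es → Decidable (Joined es)
joined? es a b = ((a , b) ∈ₑ? es) ⊎-dec ((b , a) ∈ₑ? es)

path? : ∀ es u v xs → Dec (Path (Joined es) u v xs)
path? es u v xs = map′ (λ (un , l) → path un l) (λ (path un l) → un , l)
  (unique? (u ∷ (xs ∷ʳ v)) ×-dec linked? (joined? es) (u ∷ (xs ∷ʳ v)))

internally? : Decidable (Internally {ℕ})
internally? xs ys = ¬? (List.≡-dec ℕ._≟_ xs ys) ×-dec disjoint? xs ys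

ValidSystem : List (ℕ × ℕ) → PathSystem → Set
ValidSystem es (u , v , ps) = All (Path (Joined es) u v) ps × AllPairs Internally ps × 4 ℕ.≤ length ps

validSystem? : ∀ es s → Dec (ValidSystem es s)
validSystem? es (u , v , ps) = all? (path? es u v) ps ×-dec allPairs? internally? ps ×-dec (4 ℕ.≤? length ps)

system : ∀ {es u v ps} → ValidSystem es (u , v , ps) → FourPaths (Joined es) u v
system (valid , disjoint , four) = fourPaths valid disjoint four

-- These fix the meaning of the schematic axis vertices. In the first two lists 18 and 19 are the
-- ends of the axis and 20 is the first or the last bead; in the third 20 is any bead and 18 and 19
-- are its neighbours on the axis.
coreExtra lastExtra beadExtra : List (ℕ × ℕ)
coreExtra = (14 , 18) ∷ (5 , 19) ∷ (18 , 20) ∷ []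
lastExtra = (14 , 18) ∷ (5 , 19) ∷ (19 , 20) ∷ []
beadExtra = (18 , 20) ∷ (19 , 20) ∷ []

abstract

  coreTable-valid : All (ValidSystem (localEdges coreExtra)) coreTable
  coreTable-valid = from-yes (all? (validSystem? (localEdges coreExtra)) coreTable)

  firstTable-valid : All (ValidSystem (localEdges coreExtra)) firstTable
  firstTable-valid = from-yes (all? (validSystem? (localEdges coreExtra)) firstTable)

  lastTable-valid : All (ValidSystem (localEdges lastExtra)) lastTable
  lastTable-valid = from-yes (all? (validSystem? (localEdges lastExtra)) lastTable)

  beadTable-valid : All (ValidSystem (localEdges beadExtra)) beadTable
  beadTable-valid = from-yes (all? (validSystem? (localEdges beadExtra)) beadTable)

  coreTable-covers : All (λ u → All (λ v → u ℕ.< v → Any (λ (a , b , _) → u ≡ a × v ≡ b) coreTable) (upTo 18)) (upTo 18)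
  coreTable-covers = from-yes (all? (λ u → all? (λ v → (u ℕ.<? v) →-dec
    any? (λ (a , b , _) → (u ℕ.≟ a) ×-dec (v ℕ.≟ b)) coreTable) (upTo 18)) (upTo 18))

  coreEdges-skeleton : All (λ (c , d) → (c , d) ∈ skeleton × d ℕ.< 18) coreEdges
  coreEdges-skeleton = from-yes (all? (λ (c , d) → ((c , d) ∈ₑ? skeleton) ×-dec (d ℕ.<? 18)) coreEdges)

StartsAt : ℕ → List ℕ → Set
StartsAt h xs = head xs ≡ just h

-- Internally disjoint paths in the core from the four core vertices that are
-- joined to the axis; xs ∷ʳ u are the vertices of the path to u.
Ray : ℕ → ℕ → List ℕ → Set
Ray h u xs = (StartsAt h (xs ∷ʳ u) × All (ℕ._< 18) (xs ∷ʳ u)) × Unique (xs ∷ʳ u) × Linked (Joined coreEdges) (xs ∷ʳ u)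

ray? : ∀ h u xs → Dec (Ray h u xs)
ray? h u xs = (Maybe.≡-dec ℕ._≟_ (head (xs ∷ʳ u)) (just h) ×-dec all? (ℕ._<? 18) (xs ∷ʳ u)) ×-dec
              unique? (xs ∷ʳ u) ×-dec linked? (joined? coreEdges) (xs ∷ʳ u)

ValidFan : ℕ × List ℕ × List ℕ × List ℕ × List ℕ → Set
ValidFan (u , p , q , r , s) =
  (Ray 0 u p × Ray 1 u q × Ray 14 u r × Ray 5 u s) × AllPairs Internally (p ∷ q ∷ r ∷ s ∷ [])

validFan? : ∀ t → Dec (ValidFan t)
validFan? (u , p , q , r , s) =
  (ray? 0 u p ×-dec ray? 1 u q ×-dec ray? 14 u r ×-dec ray? 5 u s) ×-dec allPairs? internally? (p ∷ q ∷ r ∷ s ∷ [])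

abstract

  fanTable-valid : All ValidFan fanTable
  fanTable-valid = from-yes (all? validFan? fanTable)

  fanTable-covers : All (λ u → Any (λ (a , _) → u ≡ a) fanTable) (applyUpTo (λ k → 2 ℕ.+ k) 16)
  fanTable-covers = from-yes (all? (λ u → any? (λ (a , _) → u ℕ.≟ a) fanTable) (applyUpTo (λ k → 2 ℕ.+ k) 16))

-- Joins the core neighbours of the two ends of the axis without using an apex; together with the
-- axis it closes a cycle.
bridge : List ℕ
bridge = 14 ∷ 16 ∷ 3 ∷ 5 ∷ []

abstract

  bridge-ray : Ray 14 5 (14 ∷ 16 ∷ 3 ∷ [])
  bridge-ray = from-yes (ray? 14 5 (14 ∷ 16 ∷ 3 ∷ []))

all-disjoint : ∀ {A : Set} {P Q : A → Set} {xs ys} → (∀ {x} → P x → ¬ Q x) → All P xs → All Q ys → Disjoint xs ys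
all-disjoint P⇒¬Q ps qs (x∈ , y∈) = P⇒¬Q (All.lookup ps x∈) (All.lookup qs y∈)

axis-injective : ∀ {k l} → 18 ℕ.+ k ≡ 18 ℕ.+ l → k ≡ l
axis-injective = cong (_∸ 18)

-- 4-connectedness

module Connectivity (i : ℕ) where

  open Geometry i
  open Family i

  Adjacent : ℕ → ℕ → Set
  Adjacent a b = (a ℕ.≤ 20 ℕ.+ i × b ℕ.≤ 20 ℕ.+ i) × (Link a b ⊎ Link b a)

  Adjacent-sym : ∀ {a b} → Adjacent a b → Adjacent b a
  Adjacent-sym ((a≤ , b≤) , l) = (b≤ , a≤) , Sum.swap l

  core-bound : ∀ {v} → v ℕ.< 18 → v ℕ.≤ 20 ℕ.+ i
  core-bound v<18 = ℕ.≤-trans (ℕ.<⇒≤ v<18) (ℕ.m≤m+n 18 (2 ℕ.+ i))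

  axis-bound : ∀ {ℓ} → ℓ ℕ.≤ 2 ℕ.+ i → 18 ℕ.+ ℓ ℕ.≤ 20 ℕ.+ i
  axis-bound ℓ≤ = ℕ.+-monoʳ-≤ 18 ℓ≤

  rigid-link : ∀ {c d} → (c , d) ∈ skeleton → Link c (stretch d)
  rigid-link cd∈ = inj₁ (Any.map (λ {refl → refl , refl}) cd∈)

  core-link : ∀ {c d} → (c , d) ∈ coreEdges → Link c d × c ℕ.< 18 × d ℕ.< 18
  core-link {c} {d} cd∈ with cd∈′ , d<18 ← All.lookup coreEdges-skeleton cd∈ =
    subst (Link c) (stretch-< (ℕ.m<n⇒m<1+n d<18)) (rigid-link cd∈′) , proj₁ (All.lookup skeleton-ordered cd∈′) , d<18

  step-link : ∀ ℓ → Link (18 ℕ.+ ℓ) (19 ℕ.+ ℓ)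
  step-link ℓ = inj₂ (inj₂ (ℕ.m≤m+n 18 ℓ , refl))

  first-link : Link 14 18
  first-link = rigid-link (from-yes ((14 , 18) ∈ₑ? skeleton))

  last-link : Link 5 (20 ℕ.+ i)
  last-link = rigid-link (from-yes ((5 , 19) ∈ₑ? skeleton))

  apex-link : ∀ {a ℓ} → a ℕ.≤ 1 → ℓ ℕ.≤ 2 ℕ.+ i → Link a (18 ℕ.+ ℓ)
  apex-link {ℓ = zero} z≤n       _ = rigid-link (from-yes ((0 , 18) ∈ₑ? skeleton))
  apex-link {ℓ = zero} (s≤s z≤n) _ = rigid-link (from-yes ((1 , 18) ∈ₑ? skeleton))
  apex-link {ℓ = suc ℓ} a≤1 ℓ≤ with ℕ.m≤n⇒m<n∨m≡n ℓ≤
  ... | inj₁ (s≤s (s≤s ℓ≤i)) = inj₂ (inj₁ (a≤1 , ℕ.m≤m+n 19 ℓ , ℕ.+-monoʳ-≤ 19 ℓ≤i))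
  apex-link {ℓ = suc ℓ} z≤n       _ | inj₂ refl = rigid-link (from-yes ((0 , 19) ∈ₑ? skeleton))
  apex-link {ℓ = suc ℓ} (s≤s z≤n) _ | inj₂ refl = rigid-link (from-yes ((1 , 19) ∈ₑ? skeleton))

  -- Realises the schematic vertices 18, 19 and 20 of the tables at three different levels of the
  -- axis, so that one checked table serves every `i`.
  module Local (l₁ l₂ l₃ : ℕ) (l₁≤ : l₁ ℕ.≤ 2 ℕ.+ i) (l₂≤ : l₂ ℕ.≤ 2 ℕ.+ i) (l₃≤ : l₃ ℕ.≤ 2 ℕ.+ i)
               (l₁≢l₂ : l₁ ≢ l₂) (l₁≢l₃ : l₁ ≢ l₃) (l₂≢l₃ : l₂ ≢ l₃) where

    data Label : ℕ → ℕ → Set where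
      core   : ∀ {v} → v ℕ.< 18 → Label v v
      first  : Label 18 (18 ℕ.+ l₁)
      second : Label 19 (18 ℕ.+ l₂)
      third  : Label 20 (18 ℕ.+ l₃)

    levelOf : ℕ → ℕ
    levelOf 0 = l₁
    levelOf 1 = l₂
    levelOf _ = l₃

    place′ : ℕ → ℕ
    place′ v = if does (v ℕ.<? 18) then v else 18 ℕ.+ levelOf (v ∸ 18)

    label : ∀ {v} → v ℕ.< 21 → Label v (place′ v)
    label {v} (s≤s v≤20) with ℕ.m≤n⇒m<n∨m≡n v≤20
    ... | inj₂ refl = third
    ... | inj₁ v<20 with <20-cases v<20
    ...   | inj₁ v<18 rewrite dec-true (v ℕ.<? 18) v<18 = core v<18
    ...   | inj₂ (inj₁ refl) = first
    ...   | inj₂ (inj₂ refl) = second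

    label-core : ∀ {v} → v ℕ.< 18 → place′ v ≡ v
    label-core {v} v<18 rewrite dec-true (v ℕ.<? 18) v<18 = refl

    label-bound : ∀ {v w} → Label v w → w ℕ.≤ 20 ℕ.+ i
    label-bound (core v<18) = core-bound v<18
    label-bound first  = axis-bound l₁≤
    label-bound second = axis-bound l₂≤
    label-bound third  = axis-bound l₃≤

    core≢ : ∀ {v ℓ} → v ℕ.< 18 → v ≢ 18 ℕ.+ ℓ
    core≢ {ℓ = ℓ} v<18 refl = ℕ.m+n≮m 18 ℓ v<18

    label-injective : ∀ {v v′ w w′} → Label v w → Label v′ w′ → w ≡ w′ → v ≡ v′
    label-injective (core _) (core _) eq = eq
    label-injective (core v<18) first eq = contradiction eq (core≢ v<18)
    label-injective (core v<18) second eq = contradiction eq (core≢ v<18)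
    label-injective (core v<18) third eq = contradiction eq (core≢ v<18)
    label-injective first (core v<18) eq = contradiction (sym eq) (core≢ v<18)
    label-injective second (core v<18) eq = contradiction (sym eq) (core≢ v<18)
    label-injective third (core v<18) eq = contradiction (sym eq) (core≢ v<18)
    label-injective first first _ = refl
    label-injective second second _ = refl
    label-injective third third _ = refl
    label-injective first second eq = contradiction (axis-injective eq) l₁≢l₂
    label-injective first third eq = contradiction (axis-injective eq) l₁≢l₃
    label-injective second third eq = contradiction (axis-injective eq) l₂≢l₃
    label-injective second first eq = contradiction (axis-injective (sym eq)) l₁≢l₂
    label-injective third first eq = contradiction (axis-injective (sym eq)) l₁≢l₃
    label-injective third second eq = contradiction (axis-injective (sym eq)) l₂≢l₃

    LocalEdge : ℕ × ℕ → Set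
    LocalEdge (a , b) = (a ℕ.< 21 × b ℕ.< 21) × (Link (place′ a) (place′ b) ⊎ Link (place′ b) (place′ a))

    module _ {extra} (extra-edges : All LocalEdge extra) where

      local-edges : All LocalEdge (localEdges extra)
      local-edges = All.++⁺ {xs = coreEdges} (All.tabulate core-edge)
        (apex (s≤s z≤n) z≤n l₁≤ ∷ apex (s≤s (s≤s z≤n)) (s≤s z≤n) l₁≤ ∷
         (((s≤s z≤n) , ℕ.n≤1+n 20) , inj₁ (apex-link z≤n l₂≤)) ∷ ((s≤s (s≤s z≤n) , ℕ.n≤1+n 20) , inj₁ (apex-link (s≤s z≤n) l₂≤)) ∷
         (((s≤s z≤n) , ℕ.≤-refl) , inj₁ (apex-link z≤n l₃≤)) ∷ ((s≤s (s≤s z≤n) , ℕ.≤-refl) , inj₁ (apex-link (s≤s z≤n) l₃≤)) ∷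
         extra-edges)
        where
        core-edge : ∀ {e} → e ∈ coreEdges → LocalEdge e
        core-edge cd∈ with l , c<18 , d<18 ← core-link cd∈ =
          (up c<18 , up d<18) , inj₁ (subst₂ Link (sym (label-core c<18)) (sym (label-core d<18)) l)
          where
          up : ∀ {v} → v ℕ.< 18 → v ℕ.< 21
          up v<18 = ℕ.m<n⇒m<1+n (ℕ.m<n⇒m<1+n (ℕ.m<n⇒m<1+n v<18))
        apex : ∀ {a} → a ℕ.< 2 → a ℕ.≤ 1 → l₁ ℕ.≤ 2 ℕ.+ i → LocalEdge (a , 18)
        apex {a} a<2 a≤1 l₁≤ = (ℕ.≤-trans a<2 (ℕ.m≤m+n 2 19) , ℕ.m≤m+n 19 2) ,
          inj₁ (subst (λ v → Link v (18 ℕ.+ l₁)) (sym (label-core (ℕ.≤-trans a<2 (ℕ.m≤m+n 2 16)))) (apex-link a≤1 l₁≤))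

      local-system : ∀ {u v} → FourPaths (Joined (localEdges extra)) u v → FourPaths Adjacent (place′ u) (place′ v)
      local-system = fourPaths-map place′ (ℕ._< 21) bounds hom
        (λ u<21 v<21 → label-injective (label u<21) (label v<21))
        where
        bounds : ∀ {a b} → Joined (localEdges extra) a b → a ℕ.< 21 × b ℕ.< 21
        bounds (inj₁ e) = proj₁ (All.lookup local-edges e)
        bounds (inj₂ e) = swap (proj₁ (All.lookup local-edges e))
        edge : ∀ {a b} → LocalEdge (a , b) → Adjacent (place′ a) (place′ b)
        edge ((a< , b<) , l) = (label-bound (label a<) , label-bound (label b<)) , l
        hom : ∀ {a b} → Joined (localEdges extra) a b → Adjacent (place′ a) (place′ b)
        hom (inj₁ e) = edge (All.lookup local-edges e)
        hom (inj₂ e) = Adjacent-sym (edge (All.lookup local-edges e))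

  small : ∀ {a b} → {True (a ℕ.<? 21)} → {True (b ℕ.<? 21)} → a ℕ.< 21 × b ℕ.< 21
  small {_} {_} {a<21} {b<21} = toWitness a<21 , toWitness b<21

  module _ where

    -- Both ends of the axis and the first bead: there are 1 + i beads, so these are three different
    -- vertices even for `i` = 0.
    open Local 0 (2 ℕ.+ i) 1 z≤n ℕ.≤-refl (s≤s z≤n) (λ ()) (λ ()) (λ ())

    core-extra-edges : All LocalEdge coreExtra
    core-extra-edges = (small , inj₁ first-link) ∷ (small , inj₁ last-link) ∷ (small , inj₁ (step-link 0)) ∷ []

    core-core : ∀ {u v} → u ℕ.< 18 → v ℕ.< 18 → u ℕ.< v → FourPaths Adjacent u v
    core-core {u} {v} u<18 v<18 u<v = result (find (All.lookup (All.lookup coreTable-covers (∈-upTo⁺ u<18)) (∈-upTo⁺ v<18) u<v))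
      where
      result : (∃ λ (s : PathSystem) → s ∈ coreTable × u ≡ proj₁ s × v ≡ proj₁ (proj₂ s)) → FourPaths Adjacent u v
      result (_ , s∈ , refl , refl) = subst₂ (FourPaths Adjacent) (label-core u<18) (label-core v<18)
        (local-system core-extra-edges (system (All.lookup coreTable-valid s∈)))

    apex-first : ∀ {a} → a ℕ.≤ 1 → FourPaths Adjacent a 18
    apex-first z≤n       = local-system core-extra-edges (system (All.head firstTable-valid))
    apex-first (s≤s z≤n) = local-system core-extra-edges (system (All.head (All.tail firstTable-valid)))

  module _ where

    open Local 0 (2 ℕ.+ i) (1 ℕ.+ i) z≤n ℕ.≤-refl (ℕ.n≤1+n (1 ℕ.+ i)) (λ ()) (λ ()) (λ eq → ℕ.1+n≢n eq)

    last-extra-edges : All LocalEdge lastExtra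
    last-extra-edges = (small , inj₁ first-link) ∷ (small , inj₁ last-link) ∷ (small , inj₂ (step-link (1 ℕ.+ i))) ∷ []

    apex-last : ∀ {a} → a ℕ.≤ 1 → FourPaths Adjacent a (20 ℕ.+ i)
    apex-last z≤n       = local-system last-extra-edges (system (All.head lastTable-valid))
    apex-last (s≤s z≤n) = local-system last-extra-edges (system (All.head (All.tail lastTable-valid)))

  module _ (ℓ : ℕ) (ℓ≤i : ℓ ℕ.≤ i) where

    private
      ℓ≤2+i : ℓ ℕ.≤ 2 ℕ.+ i
      ℓ≤2+i = ℕ.m≤n⇒m≤1+n (ℕ.m≤n⇒m≤1+n ℓ≤i)

    -- The bead at level 1 + ℓ plays the role of 20, between its neighbours at the levels ℓ and 2 +
    -- ℓ.
    open Local ℓ (2 ℕ.+ ℓ) (1 ℕ.+ ℓ) ℓ≤2+i (s≤s (s≤s ℓ≤i)) (s≤s (ℕ.m≤n⇒m≤1+n ℓ≤i))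
      (λ eq → ℕ.m≢1+n+m ℓ {1} eq) (λ eq → ℕ.1+n≢n (sym eq)) (λ eq → ℕ.1+n≢n eq)

    bead-extra-edges : All LocalEdge beadExtra
    bead-extra-edges = (small , inj₁ (step-link ℓ)) ∷ (small , inj₂ (step-link (1 ℕ.+ ℓ))) ∷ []

    apex-bead : ∀ {a} → a ℕ.≤ 1 → FourPaths Adjacent a (19 ℕ.+ ℓ)
    apex-bead z≤n       = local-system bead-extra-edges (system (All.head beadTable-valid))
    apex-bead (s≤s z≤n) = local-system bead-extra-edges (system (All.head (All.tail beadTable-valid)))

  -- An apex has a single neighbour in the core, so four rays inside the core cannot meet there:
  -- three of the paths have to use its edges to the axis. Hence the separate tables for the two
  -- ends and the beads.
  apex-axis : ∀ {a ℓ} → a ℕ.≤ 1 → ℓ ℕ.≤ 2 ℕ.+ i → FourPaths Adjacent a (18 ℕ.+ ℓ)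
  apex-axis {ℓ = zero}  a≤1 _ = apex-first a≤1
  apex-axis {ℓ = suc ℓ} a≤1 (s≤s ℓ≤1+i) with ℕ.m≤n⇒m<n∨m≡n ℓ≤1+i
  ... | inj₁ (s≤s ℓ≤i) = apex-bead ℓ ℓ≤i a≤1
  ... | inj₂ refl      = apex-last a≤1

  level-step : ∀ {ℓ} → suc ℓ ℕ.≤ 2 ℕ.+ i → Adjacent (18 ℕ.+ ℓ) (19 ℕ.+ ℓ)
  level-step {ℓ} ℓ< = (axis-bound (ℕ.<⇒≤ ℓ<) , axis-bound {suc ℓ} ℓ<) , inj₁ (step-link ℓ)

  Axial : ℕ → Set
  Axial x = 18 ℕ.≤ x

  core-not-axial : ∀ {x} → x ℕ.< 18 → ¬ Axial x
  core-not-axial = ℕ.<⇒≱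

  core-adjacent : ∀ {a b} → Joined coreEdges a b → Adjacent a b
  core-adjacent (inj₁ e) with l , a<18 , b<18 ← core-link e = (core-bound a<18 , core-bound b<18) , inj₁ l
  core-adjacent (inj₂ e) with l , b<18 , a<18 ← core-link e = (core-bound a<18 , core-bound b<18) , inj₂ l

  prepend-ray : ∀ {x h u xs} → Adjacent x h → Ray h u xs → Linked Adjacent (x ∷ (xs ∷ʳ u))
  prepend-ray {xs = []}    x~h ((refl , _) , _ , l) = x~h ∷ [-]
  prepend-ray {xs = _ ∷ _} x~h ((refl , _) , _ , l) = x~h ∷ Linked.map core-adjacent l

  module _ (ℓ h : ℕ) (top : h ℕ.+ ℓ ≡ 2 ℕ.+ i) where

    private
      ℓ≤2+i : ℓ ℕ.≤ 2 ℕ.+ i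
      ℓ≤2+i = ℕ.≤-trans (ℕ.m≤n+m ℓ h) (ℕ.≤-reflexive top)

    axis-from : ℕ → ℕ
    axis-from j = 18 ℕ.+ (j ℕ.+ ℓ)

    downward upward : List ℕ
    downward = applyDownFrom (18 ℕ.+_) ℓ
    upward = applyUpTo (λ j → axis-from (suc j)) h

    downward-linked : ∀ {ys} → Linked Adjacent (18 ∷ ys) → Linked Adjacent (18 ℕ.+ ℓ ∷ downward ++ ys)
    downward-linked = linked-down (18 ℕ.+_) ℓ (λ j j<ℓ → Adjacent-sym (level-step (ℕ.≤-trans j<ℓ ℓ≤2+i)))

    upward-linked : ∀ {ys} → Linked Adjacent (20 ℕ.+ i ∷ ys) → Linked Adjacent (18 ℕ.+ ℓ ∷ upward ++ ys)
    upward-linked {ys} l = linked-up axis-from h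
      (λ j j<h → level-step (ℕ.≤-trans (ℕ.+-monoˡ-≤ ℓ j<h) (ℕ.≤-reflexive top)))
      (subst (λ n → Linked Adjacent (18 ℕ.+ n ∷ ys)) (sym top) l)

    downward-< : All (λ x → Axial x × x ℕ.< 18 ℕ.+ ℓ) downward
    downward-< = All.applyDownFrom⁺₁ (18 ℕ.+_) ℓ (λ {j} j<ℓ → ℕ.m≤m+n 18 j , ℕ.+-monoʳ-< 18 j<ℓ)

    upward-> : All (λ x → 18 ℕ.+ ℓ ℕ.< x) upward
    upward-> = All.applyUpTo⁺₂ (λ j → axis-from (suc j)) h (λ j → ℕ.+-monoʳ-< 18 (s≤s (ℕ.m≤n+m ℓ j)))

    downward-unique : Unique (18 ℕ.+ ℓ ∷ downward)
    downward-unique = Unique.applyDownFrom⁺₁ (18 ℕ.+_) (suc ℓ) (λ j<k _ eq → ℕ.<⇒≢ j<k (sym (axis-injective eq)))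

    upward-unique : Unique (18 ℕ.+ ℓ ∷ upward)
    upward-unique = Unique.applyUpTo⁺₁ axis-from (suc h)
      (λ j<k _ eq → ℕ.<⇒≢ j<k (ℕ.+-cancelʳ-≡ ℓ _ _ (axis-injective eq)))

    axial-upward : All Axial upward
    axial-upward = All.map (λ lt → ℕ.≤-trans (ℕ.m≤m+n 18 ℓ) (ℕ.<⇒≤ lt)) upward->

    axial-downward : All Axial downward
    axial-downward = All.map proj₁ downward-<

    downward-upward : Disjoint downward upward
    downward-upward = all-disjoint (λ (_ , x<ℓ) ℓ<x → ℕ.<-asym x<ℓ ℓ<x) downward-< upward->

    mixed-path : ∀ {A C u} → Unique (18 ℕ.+ ℓ ∷ A) → All Axial A → All (ℕ._< 18) (C ∷ʳ u) → Unique (C ∷ʳ u) →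
                 Linked Adjacent (18 ℕ.+ ℓ ∷ A ++ (C ∷ʳ u)) → Path Adjacent (18 ℕ.+ ℓ) u (A ++ C)
    mixed-path {A} {C} {u} uA axial cores uC linked = path (subst Unique eq unique) (subst (Linked Adjacent) eq linked)
      where
      eq : 18 ℕ.+ ℓ ∷ A ++ (C ∷ʳ u) ≡ 18 ℕ.+ ℓ ∷ (A ++ C) ∷ʳ u
      eq = cong (18 ℕ.+ ℓ ∷_) (sym (List.++-assoc A C (u ∷ [])))
      unique : Unique (18 ℕ.+ ℓ ∷ A ++ (C ∷ʳ u))
      unique = Unique.++⁺ uA uC (λ (x∈ , y∈) → core-not-axial (All.lookup cores y∈) (All.lookup (ℕ.m≤m+n 18 ℓ ∷ axial) x∈))

    -- Axial and core vertices have disjoint ranges of labels, so the axial halves and the core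
    -- halves can be compared separately.
    mixed-internally : ∀ {A B C D} → All Axial A → All Axial B → All (ℕ._< 18) C → All (ℕ._< 18) D →
                       Disjoint A B → Internally C D → Internally (A ++ C) (B ++ D)
    mixed-internally {A} {B} {C} {D} aA aB cC cD A#B (C≢D , C#D) = disjoint⇒internally apart
      (λ (eq , eq′) → C≢D (trans (List.++-conicalʳ A C eq) (sym (List.++-conicalʳ B D eq′))))
      where
      apart : Disjoint (A ++ C) (B ++ D)
      apart (x∈ , y∈) with ∈-++⁻ A x∈ | ∈-++⁻ B y∈
      ... | inj₁ a | inj₁ b = A#B (a , b)
      ... | inj₁ a | inj₂ d = core-not-axial (All.lookup cD d) (All.lookup aA a)
      ... | inj₂ c | inj₁ b = core-not-axial (All.lookup cC c) (All.lookup aB b)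
      ... | inj₂ c | inj₂ d = C#D (c , d)

    -- An axis vertex reaches 0 and 1 directly, 14 by descending to the first end and 5 by ascending
    -- to the last one; from there the fan leads to `u`. At an end of the axis one of the two
    -- stretches is empty.
    axis-core : ∀ {u p q r s} → ValidFan (u , p , q , r , s) → FourPaths Adjacent (18 ℕ.+ ℓ) u
    axis-core {u} {p} {q} {r} {s}
      ((P@((_ , cp) , up , _) , Q@((_ , cq) , uq , _) , R@((_ , cr) , ur , _) , S@((_ , cs) , us , _)) ,
       (pq ∷ pr ∷ ps ∷ []) ∷ (qr ∷ qs ∷ []) ∷ (rs ∷ []) ∷ [] ∷ []) = fourPaths
      (mixed-path ([] ∷ []) [] cp up (prepend-ray (Adjacent-sym (apex z≤n)) P) ∷
       mixed-path ([] ∷ []) [] cq uq (prepend-ray (Adjacent-sym (apex (s≤s z≤n))) Q) ∷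
       mixed-path downward-unique axial-downward cr ur (downward-linked (prepend-ray 18~14 R)) ∷
       mixed-path upward-unique axial-upward cs us (upward-linked (prepend-ray last~5 S)) ∷ [])
      ((mixed-internally [] [] (init cp) (init cq) (λ ()) pq ∷
        mixed-internally [] axial-downward (init cp) (init cr) (λ ()) pr ∷
        mixed-internally [] axial-upward (init cp) (init cs) (λ ()) ps ∷ []) ∷
       (mixed-internally [] axial-downward (init cq) (init cr) (λ ()) qr ∷
        mixed-internally [] axial-upward (init cq) (init cs) (λ ()) qs ∷ []) ∷
       (mixed-internally axial-downward axial-upward (init cr) (init cs) downward-upward rs ∷ []) ∷ [] ∷ [])
      ℕ.≤-refl
      where
      init : ∀ {xs} → All (ℕ._< 18) (xs ∷ʳ u) → All (ℕ._< 18) xs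
      init = proj₁ ∘ All.∷ʳ⁻
      apex : ∀ {a} → a ℕ.≤ 1 → Adjacent a (18 ℕ.+ ℓ)
      apex a≤1 = (core-bound (ℕ.≤-trans (s≤s a≤1) (ℕ.m≤m+n 2 16)) , axis-bound ℓ≤2+i) , inj₁ (apex-link a≤1 ℓ≤2+i)
      18~14 : Adjacent 18 14
      18~14 = (ℕ.m≤m+n 18 (2 ℕ.+ i) , ℕ.m≤m+n 14 (6 ℕ.+ i)) , inj₂ first-link
      last~5 : Adjacent (20 ℕ.+ i) 5
      last~5 = (ℕ.≤-refl , ℕ.m≤m+n 5 (15 ℕ.+ i)) , inj₂ last-link

  module _ (k m h : ℕ) (top : h ℕ.+ (suc m ℕ.+ k) ≡ 2 ℕ.+ i) where

    private
      ℓ : ℕ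
      ℓ = suc m ℕ.+ k

      ℓ≤2+i : ℓ ℕ.≤ 2 ℕ.+ i
      ℓ≤2+i = ℕ.≤-trans (ℕ.m≤n+m ℓ h) (ℕ.≤-reflexive top)

      k<ℓ : k ℕ.< ℓ
      k<ℓ = s≤s (ℕ.m≤n+m k m)

      from-k from-ℓ : ℕ → ℕ
      from-k j = 18 ℕ.+ (j ℕ.+ k)
      from-ℓ j = 18 ℕ.+ (j ℕ.+ ℓ)

    direct detour down-k down-ℓ : List ℕ
    down-k = applyDownFrom (18 ℕ.+_) k
    down-ℓ = applyDownFrom (λ j → from-ℓ (suc j)) h
    direct = applyUpTo (λ j → from-k (suc j)) m
    detour = down-k ++ bridge ++ down-ℓ

    direct-vertices : 18 ℕ.+ k ∷ (direct ∷ʳ (18 ℕ.+ ℓ)) ≡ applyUpTo from-k (2 ℕ.+ m)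
    direct-vertices = List.applyUpTo-∷ʳ from-k (suc m)

    direct-path : Path Adjacent (18 ℕ.+ k) (18 ℕ.+ ℓ) direct
    direct-path = path
      (subst Unique (sym direct-vertices) (Unique.applyUpTo⁺₁ from-k (2 ℕ.+ m)
        (λ x<y _ eq → ℕ.<⇒≢ x<y (ℕ.+-cancelʳ-≡ k _ _ (axis-injective eq)))))
      (subst (Linked Adjacent) (sym direct-vertices) (Linked.applyUpTo⁺₁ from-k (2 ℕ.+ m)
        (λ {j} j< → level-step (ℕ.≤-trans (ℕ.+-monoˡ-≤ k (ℕ.s≤s⁻¹ j<)) ℓ≤2+i))))

    apex-path : ∀ {a} → a ℕ.≤ 1 → Path Adjacent (18 ℕ.+ k) (18 ℕ.+ ℓ) (a ∷ [])
    apex-path {a} a≤1 = path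
      (((λ eq → core≢ (sym eq)) ∷ (λ eq → ℕ.<⇒≢ k<ℓ (axis-injective eq)) ∷ []) ∷ (core≢ ∷ []) ∷ [] ∷ [])
      (Adjacent-sym (apex (ℕ.≤-trans (ℕ.<⇒≤ k<ℓ) ℓ≤2+i)) ∷ apex ℓ≤2+i ∷ [-])
      where
      a<18 : a ℕ.< 18
      a<18 = ℕ.≤-trans (s≤s a≤1) (ℕ.m≤m+n 2 16)
      core≢ : ∀ {n} → a ≢ 18 ℕ.+ n
      core≢ {n} refl = ℕ.m+n≮m 18 n a<18
      apex : ∀ {n} → n ℕ.≤ 2 ℕ.+ i → Adjacent a (18 ℕ.+ n)
      apex n≤ = (core-bound a<18 , axis-bound n≤) , inj₁ (apex-link a≤1 n≤)

    down-k-< : ∀ {n} → n ℕ.≤ k → All (λ x → Axial x × x ℕ.< 18 ℕ.+ n) (applyDownFrom (18 ℕ.+_) n)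
    down-k-< {n} _ = All.applyDownFrom⁺₁ (18 ℕ.+_) n (λ {j} j<n → ℕ.m≤m+n 18 j , ℕ.+-monoʳ-< 18 j<n)

    from-ℓ-≥ : ∀ n → All (λ x → 18 ℕ.+ ℓ ℕ.≤ x) (applyDownFrom from-ℓ n)
    from-ℓ-≥ n = All.applyDownFrom⁺₂ from-ℓ n (λ j → ℕ.+-monoʳ-≤ 18 (ℕ.m≤n+m ℓ j))

    detour-vertices : 18 ℕ.+ k ∷ (detour ∷ʳ (18 ℕ.+ ℓ)) ≡
                      applyDownFrom (18 ℕ.+_) (suc k) ++ bridge ++ applyDownFrom from-ℓ (suc h)
    detour-vertices = cong (18 ℕ.+ k ∷_) (trans (List.++-assoc down-k (bridge ++ down-ℓ) _)
      (cong (λ xs → down-k ++ bridge ++ xs) (List.applyDownFrom-∷ʳ from-ℓ h)))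

    -- The walk leaves the axis at the first end, crosses the bridge and comes back from the last
    -- end, so on the axis it stays outside the interval between its ends.
    detour-path : Path Adjacent (18 ℕ.+ k) (18 ℕ.+ ℓ) detour
    detour-path = path (subst Unique (sym detour-vertices) unique) (subst (Linked Adjacent) (sym detour-vertices) linked)
      where
      bridge-core : All (ℕ._< 18) bridge
      bridge-core = proj₂ (proj₁ bridge-ray)
      unique : Unique (applyDownFrom (18 ℕ.+_) (suc k) ++ bridge ++ applyDownFrom from-ℓ (suc h))
      unique = Unique.++⁺
        (Unique.applyDownFrom⁺₁ (18 ℕ.+_) (suc k) (λ x<y _ eq → ℕ.<⇒≢ x<y (sym (axis-injective eq))))
        (Unique.++⁺ (proj₁ (proj₂ bridge-ray))
          (Unique.applyDownFrom⁺₁ from-ℓ (suc h) (λ x<y _ eq → ℕ.<⇒≢ x<y (sym (ℕ.+-cancelʳ-≡ ℓ _ _ (axis-injective eq)))))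
          (all-disjoint (λ x<18 ℓ≤x → core-not-axial x<18 (ℕ.≤-trans (ℕ.m≤m+n 18 ℓ) ℓ≤x)) bridge-core (from-ℓ-≥ (suc h))))
        (all-disjoint {P = λ x → Axial x × x ℕ.≤ 18 ℕ.+ k} {Q = λ x → x ℕ.< 18 ⊎ 18 ℕ.+ ℓ ℕ.≤ x}
          (λ (axial , x≤k) → Sum.[ (λ x<18 → core-not-axial x<18 axial)
                                 , (λ ℓ≤x → ℕ.<⇒≱ (ℕ.+-monoʳ-< 18 k<ℓ) (ℕ.≤-trans ℓ≤x x≤k)) ])
          (All.applyDownFrom⁺₁ (18 ℕ.+_) (suc k) (λ {j} j<n → ℕ.m≤m+n 18 j , ℕ.+-monoʳ-≤ 18 (ℕ.s≤s⁻¹ j<n)))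
          (All.++⁺ (All.map inj₁ bridge-core) (All.map inj₂ (from-ℓ-≥ (suc h)))))
      linked : Linked Adjacent (applyDownFrom (18 ℕ.+_) (suc k) ++ bridge ++ applyDownFrom from-ℓ (suc h))
      linked = linked-down (18 ℕ.+_) k (λ j j<k → Adjacent-sym (level-step (ℕ.≤-trans j<k (ℕ.≤-trans (ℕ.<⇒≤ k<ℓ) ℓ≤2+i))))
        (((ℕ.m≤m+n 18 (2 ℕ.+ i) , ℕ.m≤m+n 14 (6 ℕ.+ i)) , inj₂ first-link) ∷ cross (proj₂ (proj₂ bridge-ray)))
        where
        end~ : Adjacent 5 (from-ℓ h)
        end~ = subst (λ n → Adjacent 5 (18 ℕ.+ n)) (sym top) ((ℕ.m≤m+n 5 (15 ℕ.+ i) , ℕ.≤-refl) , inj₁ last-link)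
        cross : Linked (Joined coreEdges) bridge → Linked Adjacent (bridge ++ applyDownFrom from-ℓ (suc h))
        cross (r ∷ r′ ∷ r″ ∷ [-]) = core-adjacent r ∷ core-adjacent r′ ∷ core-adjacent r″ ∷ end~ ∷
          -- The walk stops at level ℓ, so its continuation is empty.
          subst (Linked Adjacent) (List.++-identityʳ _) (linked-down from-ℓ h
            (λ j j<h → Adjacent-sym (level-step (ℕ.≤-trans (ℕ.+-monoˡ-≤ ℓ j<h) (ℕ.≤-reflexive top)))) [-])

    down-ℓ-> : All (λ x → 18 ℕ.+ ℓ ℕ.< x) down-ℓ
    down-ℓ-> = All.applyDownFrom⁺₂ (λ j → from-ℓ (suc j)) h (λ j → ℕ.+-monoʳ-< 18 (s≤s (ℕ.m≤n+m ℓ j)))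

    direct-between : All (λ x → 18 ℕ.+ k ℕ.< x × x ℕ.< 18 ℕ.+ ℓ) direct
    direct-between = All.applyUpTo⁺₁ (λ j → from-k (suc j)) m
      (λ {j} j<m → ℕ.+-monoʳ-< 18 (s≤s (ℕ.m≤n+m k j)) , ℕ.+-monoʳ-< 18 (ℕ.+-monoˡ-< k (s≤s j<m)))

    -- Two paths use one apex each; the other two are the arcs of the cycle formed by the axis and
    -- the bridge.
    axis-axis : FourPaths Adjacent (18 ℕ.+ k) (18 ℕ.+ ℓ)
    axis-axis = fourPaths
      (apex-path z≤n ∷ apex-path (s≤s z≤n) ∷ direct-path ∷ detour-path ∷ [])
      ((((λ ()) , λ {(here refl , here ())}) ∷ apart z≤n direct-≥2 ∷ apart z≤n detour-≥2 ∷ []) ∷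
       (apart (s≤s z≤n) direct-≥2 ∷ apart (s≤s z≤n) detour-≥2 ∷ []) ∷
       (disjoint⇒internally direct-detour (λ (_ , eq) → bridge≢[] (List.++-conicalʳ down-k _ eq)) ∷ []) ∷ [] ∷ [])
      ℕ.≤-refl
      where
      bridge≢[] : bridge ++ down-ℓ ≢ []
      bridge≢[] ()
      apart : ∀ {a xs} → a ℕ.≤ 1 → All (2 ℕ.≤_) xs → Internally (a ∷ []) xs
      apart a≤1 xs≥2 = disjoint⇒internally (all-disjoint (λ x≤1 2≤x → ℕ.<⇒≱ 2≤x x≤1) (a≤1 ∷ []) xs≥2) (λ ())
      2≤18+ : ∀ {n x} → 18 ℕ.+ n ℕ.≤ x → 2 ℕ.≤ x
      2≤18+ {n} = ℕ.≤-trans (ℕ.m≤m+n 2 (16 ℕ.+ n))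
      direct-≥2 : All (2 ℕ.≤_) direct
      direct-≥2 = All.map (λ (k<x , _) → 2≤18+ {k} (ℕ.<⇒≤ k<x)) direct-between
      detour-≥2 : All (2 ℕ.≤_) detour
      detour-≥2 = All.++⁺ (All.map (λ (axial , _) → 2≤18+ {0} axial) (down-k-< ℕ.≤-refl))
        (All.++⁺ (s≤s (s≤s z≤n) ∷ s≤s (s≤s z≤n) ∷ s≤s (s≤s z≤n) ∷ s≤s (s≤s z≤n) ∷ [])
          (All.map (λ lt → 2≤18+ {ℓ} (ℕ.<⇒≤ lt)) down-ℓ->))
      direct-detour : Disjoint direct detour
      direct-detour = all-disjoint {Q = λ x → x ℕ.≤ 18 ℕ.+ k ⊎ 18 ℕ.+ ℓ ℕ.≤ x}
        (λ (k<x , x<ℓ) → Sum.[ ℕ.<⇒≱ k<x , ℕ.<⇒≱ x<ℓ ]) direct-between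
        (All.++⁺ (All.map (λ (_ , x<k) → inj₁ (ℕ.<⇒≤ x<k)) (down-k-< ℕ.≤-refl))
          (All.++⁺ (All.map (λ x<18 → inj₁ (ℕ.≤-trans (ℕ.<⇒≤ x<18) (ℕ.m≤m+n 18 k))) (proj₂ (proj₁ bridge-ray)))
            (All.map (λ lt → inj₂ (ℕ.<⇒≤ lt)) down-ℓ->)))

  to-top : ∀ {ℓ} → ℓ ℕ.≤ 2 ℕ.+ i → ∃ λ h → h ℕ.+ ℓ ≡ 2 ℕ.+ i
  to-top {ℓ} ℓ≤ = 2 ℕ.+ i ∸ ℓ , ℕ.m∸n+n≡m ℓ≤

  axis-axis-< : ∀ {k ℓ} → ℓ ℕ.≤ 2 ℕ.+ i → k ℕ.< ℓ → FourPaths Adjacent (18 ℕ.+ k) (18 ℕ.+ ℓ)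
  axis-axis-< {k} {ℓ} ℓ≤ k<ℓ = subst (λ n → FourPaths Adjacent (18 ℕ.+ k) (18 ℕ.+ n)) split
    -- There are ℓ ∸ suc k axis vertices strictly between the two and 2 + i ∸ ℓ above the higher
    -- one.
    (axis-axis k (ℓ ∸ suc k) (proj₁ (to-top ℓ≤)) (trans (cong (proj₁ (to-top ℓ≤) ℕ.+_) split) (proj₂ (to-top ℓ≤))))
    where
    split : suc (ℓ ∸ suc k) ℕ.+ k ≡ ℓ
    split = trans (sym (ℕ.+-suc (ℓ ∸ suc k) k)) (ℕ.m∸n+n≡m k<ℓ)

  axis-any-core : ∀ {u ℓ} → u ℕ.< 18 → ℓ ℕ.≤ 2 ℕ.+ i → FourPaths Adjacent (18 ℕ.+ ℓ) u
  axis-any-core {u} {ℓ} u<18 ℓ≤ with 2 ℕ.≤? u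
  ... | no 2≰u = fourPaths-sym Adjacent-sym (apex-axis (ℕ.s≤s⁻¹ (ℕ.≰⇒> 2≰u)) ℓ≤)
  ... | yes 2≤u with k , refl ← ≤⇒∃ 2≤u =
    result (find (All.lookup fanTable-covers (∈-applyUpTo⁺ (λ k → 2 ℕ.+ k) (ℕ.s≤s⁻¹ (ℕ.s≤s⁻¹ u<18)))))
    where
    result : ∀ {u} → (∃ λ t → t ∈ fanTable × u ≡ proj₁ t) → FourPaths Adjacent (18 ℕ.+ ℓ) u
    result (_ , t∈ , refl) = axis-core ℓ (proj₁ (to-top ℓ≤)) (proj₂ (to-top ℓ≤)) (All.lookup fanTable-valid t∈)

  four-paths : ∀ {u v} → Vertex u → Vertex v → u ≢ v → FourPaths Adjacent u v
  four-paths (core {u} u<18) (core {v} v<18) u≢v with ℕ.<-cmp u v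
  ... | tri< u<v _ _ = core-core u<18 v<18 u<v
  ... | tri≈ _ u≡v _ = contradiction u≡v u≢v
  ... | tri> _ _ v<u = fourPaths-sym Adjacent-sym (core-core v<18 u<18 v<u)
  four-paths (core u<18) (onAxis ℓ≤) _ = fourPaths-sym Adjacent-sym (axis-any-core u<18 ℓ≤)
  four-paths (onAxis ℓ≤) (core u<18) _ = axis-any-core u<18 ℓ≤
  four-paths (onAxis {k} k≤) (onAxis {ℓ} ℓ≤) u≢v with ℕ.<-cmp k ℓ
  ... | tri< k<ℓ _ _ = axis-axis-< ℓ≤ k<ℓ
  ... | tri≈ _ k≡ℓ _ = contradiction (cong (18 ℕ.+_) k≡ℓ) u≢v
  ... | tri> _ _ ℓ<k = fourPaths-sym Adjacent-sym (axis-axis-< k≤ ℓ<k)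

  4-connected : KConnected 4 G
  4-connected = s≤s (s≤s z≤n) , λ u v u≢v →
    -- The systems live on natural numbers; `clamp` carries them to the vertices and inverts `toℕ`
    -- at the two ends.
    local u v (fourPaths-map clamp (ℕ._≤ 20 ℕ.+ i) proj₁ hom inj
      (four-paths (vertex (bound u)) (vertex (bound v)) (λ eq → u≢v (Fin.toℕ-injective eq))))
    where
    open Graph G using (_~_)
    hom : ∀ {a b} → Adjacent a b → clamp a ~ clamp b
    hom ((a≤ , b≤) , l) = Sum.map (subst₂ Link (sym (toℕ-clamp a≤)) (sym (toℕ-clamp b≤)))
                                  (subst₂ Link (sym (toℕ-clamp b≤)) (sym (toℕ-clamp a≤))) l
    inj : ∀ {a b} → a ℕ.≤ 20 ℕ.+ i → b ℕ.≤ 20 ℕ.+ i → clamp {20 ℕ.+ i} a ≡ clamp b → a ≡ b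
    inj a≤ b≤ eq = trans (sym (toℕ-clamp a≤)) (trans (cong toℕ eq) (toℕ-clamp b≤))
    local : ∀ u v → FourPaths _~_ (clamp (toℕ u)) (clamp (toℕ v)) → LocalConnectivity≥ G u v 4
    local u v ps with fourPaths valid disjoint four ← subst₂ (FourPaths _~_) (NoPlane.vert-toℕ i u) (NoPlane.vert-toℕ i v) ps =
      _ , All.map (λ (path unique linked) → unique , linked) valid , disjoint , four

theorem3 : ∃ λ (G : ℕ → OnePlaneGraph) →
    (∀ i → KConnected 4 (graph (G i))
    × ¬ (∃ λ (F : Graph (order (G i))) →
    IsSpanningPlaneSubgraph (G i) F × KConnected 2 F))
    × (∀ i j → i ≢ j → ¬ (graph (G i) ≅ graph (G j)))
theorem3 = Family.onePlane ,
  (λ i → Connectivity.4-connected i , λ (F , spanning , connected) → NoPlane.not-2-connected i F spanning connected) ,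
  -- An isomorphism preserves the order, and the order 21 + i determines `i`.
  (λ i j i≢j (φ , _) → i≢j (cong (_∸ 21) (↔⇒≡ φ)))
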